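{- A $\mathbb{Z}_2$-symmetric graph $G$ is $(2,2)$-$C_i$-tight if and only if $G$ can be generated from $F_1$ or $F_2$ (with their involutions as described) by a finite sequence of the following operations: symmetrised 0-extensions, symmetrised 1-extensions, symmetrised vertex-to-$K_4$ operations, symmetrised vertex-to-$C_4$ operations at non-fixed vertices, and joining two graphs already so generated by two new edges $xy,x'y'$ (with $x$ in the first graph and $y$ in the second).
   Context: A $\mathbb{Z}_2$-symmetric graph is a finite simple graph $G=(V,E)$ with an automorphism $\theta$, $\theta^2=\mathrm{id}$; write $v'=\theta(v)$; graphs are considered up to isomorphisms commuting with the involutions. A vertex is fixed if $v'=v$; an edge $uv$ is fixed if $\{u',v'\}=\{u,v\}$. $G$ is $(2,2)$-sparse if every subgraph $(V',E')$ with $V'\ne\emptyset$ has $|E'|\le2|V'|-2$, $(2,2)$-tight if also $|E|=2|V|-2$; $(2,2)$-$C_i$-tight if $(2,2)$-tight and $\theta$ fixes no vertex and no edge. Base graphs: $F_1$ has vertices $a,b,c,d,e,f$, edges all pairs between $\{c,d\}$ and $\{a,b,e,f\}$ plus $ab,ef$, involution $a\leftrightarrow f$, $b\leftrightarrow e$, $c\leftrightarrow d$. $F_2$ consists of two disjoint copies of $K_4$ on $\{a_1,a_2,a_3,a_4\}$ and $\{b_1,b_2,b_3,b_4\}$ plus edges $a_3b_3$, $a_4b_4$, with involution $a_1\leftrightarrow b_1$, $a_2\leftrightarrow b_2$, $a_3\leftrightarrow b_4$, $a_4\leftrightarrow b_3$. Operations (new vertices always come in pairs $s,s'$ swapped by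 the extended involution, and the result is required to be simple): - symmetrised 0-extension: add $v,v'$, $v$ adjacent to distinct $a,b$, $v'$ adjacent to $a',b'$; - symmetrised 1-extension: for a non-fixed edge $ab$ and a vertex $c\notin\{a,b\}$, delete $ab,a'b'$, add $v$ adjacent to $a,b,c$ and $v'$ adjacent to $a',b',c'$; - symmetrised vertex-to-$K_4$: at a non-fixed vertex $w$, add $a,b,c,a',b',c'$ making $\{w,a,b,c\}$ and $\{w',a',b',c'\}$ cliques, and for each former neighbour $u$ of $w$ replace the edge $wu$ by $d_uu$ for a chosen $d_u\in\{w,a,b,c\}$, doing the image choice at $w'$; - symmetrised vertex-to-$C_4$ at a non-fixed vertex $w$: choose distinct neighbours $v_1,v_2$ of $w$, add $u$ adjacent to $v_1,v_2$ (keeping $wv_1,wv_2$), move any subset of the remaining edges $wv_i$ to $uv_i$, and do the image operation at $w'$ with $u'$; - joining: disjoint union of two such graphs plus edges $xy,x'y'$. -}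

module Defs where

open import Algebra.Properties.CommutativeMonoid.Sum using (sum)
open import Data.Bool.Base using (Bool; true; false; T; not; if_then_else_; _∧_)
open import Data.Fin.Base using (Fin; zero; suc)
open import Data.Fin.Patterns using (2F; 3F)
open import Data.Fin.Properties using (_<?_)
open import Data.Fin.Subset using (Subset; _∈_; _∉_; Nonempty; ∣_∣)
open import Data.Nat.Base using (ℕ; _+_; _*_; _≤_)
open import Data.Nat.Properties using (+-0-commutativeMonoid)
open import Data.Product.Base using (_×_; _,_; map₂)
open import Data.Sum.Base as Sum using (_⊎_; inj₁; inj₂)
open import Function.Base using (_on_)
open import Function.Bundles using (_↔_; _⇔_; Inverse)
open import Relation.Binary.Construct.Closure.Symmetric using (SymClosure)
open import Relation.Binary.Construct.Union using (_∪_)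
open import Relation.Binary.Core using (Rel)
open import Relation.Binary.PropositionalEquality.Core using (_≡_; _≢_)
open import Relation.Nullary.Decidable.Core using (does)
open import Relation.Nullary.Negation.Core using (¬_)
open import Level using (0ℓ)

record Graph (n : ℕ) : Set where
  field
    adj     : Fin n → Fin n → Bool
    adj-sym : ∀ u v → adj u v ≡ adj v u
    irrefl  : ∀ v → adj v v ≡ false

  infix 4 _~_

  _~_ : Rel (Fin n) 0ℓ
  u ~ v = T (adj u v)

-- Each edge is counted once, at its ordered pair of endpoints i < j.
∣E_∣ : ∀ {n} → Graph n → ℕ
∣E_∣ {n} G = Σ λ i → Σ λ j → if does (i <? j) ∧ adj i j then 1 else 0
  where
  open Graph G
  Σ : (Fin n → ℕ) → ℕ
  Σ = sum +-0-commutativeMonoid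

-- A subgraph (V′ , E′), not necessarily induced; E′ is stored as the edge set
-- of a graph on all of Fin n.
record Subgraph {n} (G : Graph n) : Set where
  field
    V′ : Subset n
    E′ : Graph n
    E′⊆E : ∀ {u v} → Graph._~_ E′ u v → Graph._~_ G u v
    ends : ∀ {u v} → Graph._~_ E′ u v → u ∈ V′ × v ∈ V′

-- The bounds 2|V| − 2 are written additively: truncated subtraction would make
-- the empty graph tight.
Sparse : ∀ {n} → Graph n → Set
Sparse G = (S : Subgraph G) → let open Subgraph S in
  Nonempty V′ → ∣E E′ ∣ + 2 ≤ 2 * ∣ V′ ∣

Tight : ∀ {n} → Graph n → Set
Tight {n} G = Sparse G × ∣E G ∣ + 2 ≡ 2 * n

record ℤ₂Graph : Set where
  field
    order  : ℕ
    graph  : Graph order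
  open Graph graph public
  field
    θ      : Fin order → Fin order
    θ-inv  : ∀ v → θ (θ v) ≡ v
    θ-auto : ∀ u v → adj (θ u) (θ v) ≡ adj u v

-- Equality of unordered pairs, {u , v} = {x , y}.
SamePair : ∀ {A : Set} → A → A → A → A → Set
SamePair u v x y = (u ≡ x × v ≡ y) ⊎ (u ≡ y × v ≡ x)

module _ (G : ℤ₂Graph) where
  open ℤ₂Graph G

  FixedVertex : Fin order → Set
  FixedVertex v = θ v ≡ v

  FixedEdge : Fin order → Fin order → Set
  FixedEdge u v = SamePair (θ u) (θ v) u v

  CiTight : Set
  CiTight = Tight graph
          × (∀ v → ¬ FixedVertex v)
          × (∀ u v → u ~ v → ¬ FixedEdge u v)

-- A vertex set with an involution τ and a relation R, standing for the graph
-- whose edges are the unordered pairs {x , y} and {τ x , τ y} with R x y.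
-- Hence only one edge of each τ-orbit need be listed in R, in one direction.
record Presentation : Set₁ where
  field
    Vertex : Set
    τ      : Vertex → Vertex
    R      : Rel Vertex 0ℓ

  -- As τ is an involution, R on τ is the image of R under τ.
  Edge : Rel Vertex 0ℓ
  Edge = SymClosure (R ∪ (R on τ))

-- H is isomorphic to the presented graph, compatibly with the involutions.
-- Since H is a simple graph, so is whatever it realises.
record _Realises_ (H : ℤ₂Graph) (P : Presentation) : Set where
  open ℤ₂Graph H
  open Presentation P
  field
    bijection : Fin order ↔ Vertex
  open Inverse bijection using (to)
  field
    equivariant : ∀ v → to (θ v) ≡ τ (to v)
    edges       : ∀ u v → u ~ v ⇔ Edge (to u) (to v)

module F₁ where
  data Vertex : Set where
    a b c d e f : Vertex

  τ : Vertex → Vertex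
  τ a = f
  τ b = e
  τ c = d
  τ d = c
  τ e = b
  τ f = a

  data R : Rel Vertex 0ℓ where
    ca : R c a
    cb : R c b
    ce : R c e
    cf : R c f
    da : R d a
    db : R d b
    de : R d e
    df : R d f
    ab : R a b
    ef : R e f

F₁ : Presentation
F₁ = record { F₁ }

-- The vertices aᵢ and bᵢ, with indices shifted to start from 0.
module F₂ where
  data Vertex : Set where
    a b : Fin 4 → Vertex

  swap₂₃ : Fin 4 → Fin 4
  swap₂₃ 2F = 3F
  swap₂₃ 3F = 2F
  swap₂₃ i  = i

  τ : Vertex → Vertex
  τ (a i) = b (swap₂₃ i)
  τ (b i) = a (swap₂₃ i)

  data R : Rel Vertex 0ℓ where
    aa   : ∀ {i j} → i ≢ j → R (a i) (a j)
    bb   : ∀ {i j} → i ≢ j → R (b i) (b j)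
    a₂b₂ : R (a 2F) (b 2F)
    a₃b₃ : R (a 3F) (b 3F)

F₂ : Presentation
F₂ = record { F₂ }

-- inj₂ (i , false) and inj₂ (i , true) are the i-th new vertex and its partner.
Extended : ℤ₂Graph → ℕ → Set
Extended G k = Fin (ℤ₂Graph.order G) ⊎ (Fin k × Bool)

pattern old x = inj₁ x
pattern new i = inj₂ (i , false)

extend : (G : ℤ₂Graph) (k : ℕ) → Rel (Extended G k) 0ℓ → Presentation
extend G k R = record
  { Vertex = Extended G k
  ; τ      = Sum.map (ℤ₂Graph.θ G) (map₂ not)
  ; R      = R
  }

module _ (G : ℤ₂Graph) where
  open ℤ₂Graph G

  private
    V : Set
    V = Fin order

  data ZeroExtR (a b : V) : Rel (Extended G 1) 0ℓ where
    keep : ∀ {x y} → x ~ y → ZeroExtR a b (old x) (old y)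
    va   : ZeroExtR a b (new zero) (old a)
    vb   : ZeroExtR a b (new zero) (old b)

  data OneExtR (a b c : V) : Rel (Extended G 1) 0ℓ where
    keep : ∀ {x y} → x ~ y → ¬ SamePair x y a b → ¬ SamePair x y (θ a) (θ b) →
           OneExtR a b c (old x) (old y)
    va   : OneExtR a b c (new zero) (old a)
    vb   : OneExtR a b c (new zero) (old b)
    vc   : OneExtR a b c (new zero) (old c)

  NotIncident : V → V → V → Set
  NotIncident w x y = x ≢ w × y ≢ w

  K₄-vertex : V → Fin 4 → Extended G 3
  K₄-vertex w zero    = old w
  K₄-vertex w (suc i) = new i

  -- d u is the vertex of the new K₄ that receives the edge wu.  In the graphs
  -- this is applied to, w and θ w are non-adjacent (no edge is fixed), so the
  -- replacements at w and at θ w do not interfere.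
  data ToK₄R (w : V) (d : V → Fin 4) : Rel (Extended G 3) 0ℓ where
    keep   : ∀ {x y} → x ~ y → NotIncident w x y → NotIncident (θ w) x y →
             ToK₄R w d (old x) (old y)
    clique : ∀ {i j} → i ≢ j → ToK₄R w d (K₄-vertex w i) (K₄-vertex w j)
    move   : ∀ {u} → w ~ u → ToK₄R w d (K₄-vertex w (d u)) (old u)

  -- The edges wx with x ∈ M are the ones moved to the new vertex u.
  data ToC₄R (w v₁ v₂ : V) (M : Subset order) : Rel (Extended G 1) 0ℓ where
    keep : ∀ {x y} → x ~ y → NotIncident w x y → NotIncident (θ w) x y →
           ToC₄R w v₁ v₂ M (old x) (old y)
    stay : ∀ {x} → w ~ x → x ∉ M → ToC₄R w v₁ v₂ M (old w) (old x)
    move : ∀ {x} → w ~ x → x ∈ M → ToC₄R w v₁ v₂ M (new zero) (old x)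
    uv₁  : ToC₄R w v₁ v₂ M (new zero) (old v₁)
    uv₂  : ToC₄R w v₁ v₂ M (new zero) (old v₂)

data JoinR (G₁ G₂ : ℤ₂Graph) (x : Fin (ℤ₂Graph.order G₁)) (y : Fin (ℤ₂Graph.order G₂)) :
           Rel (Fin (ℤ₂Graph.order G₁) ⊎ Fin (ℤ₂Graph.order G₂)) 0ℓ where
  left  : ∀ {u v} → ℤ₂Graph._~_ G₁ u v → JoinR G₁ G₂ x y (inj₁ u) (inj₁ v)
  right : ∀ {u v} → ℤ₂Graph._~_ G₂ u v → JoinR G₁ G₂ x y (inj₂ u) (inj₂ v)
  xy    : JoinR G₁ G₂ x y (inj₁ x) (inj₂ y)

join : (G₁ G₂ : ℤ₂Graph) → Fin (ℤ₂Graph.order G₁) → Fin (ℤ₂Graph.order G₂) → Presentation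
join G₁ G₂ x y = record
  { Vertex = Fin (ℤ₂Graph.order G₁) ⊎ Fin (ℤ₂Graph.order G₂)
  ; τ      = Sum.map (ℤ₂Graph.θ G₁) (ℤ₂Graph.θ G₂)
  ; R      = JoinR G₁ G₂ x y
  }

data Generated (H : ℤ₂Graph) : Set where
  base₁ : H Realises F₁ → Generated H

  base₂ : H Realises F₂ → Generated H

  zeroExtension : (G : ℤ₂Graph) → Generated G → let open ℤ₂Graph G in
    (a b : Fin order) → a ≢ b →
    H Realises extend G 1 (ZeroExtR G a b) → Generated H

  oneExtension : (G : ℤ₂Graph) → Generated G → let open ℤ₂Graph G in
    (a b c : Fin order) → a ~ b → ¬ FixedEdge G a b → c ≢ a → c ≢ b →
    H Realises extend G 1 (OneExtR G a b c) → Generated H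

  vertexToK₄ : (G : ℤ₂Graph) → Generated G → let open ℤ₂Graph G in
    (w : Fin order) → ¬ FixedVertex G w → (d : Fin order → Fin 4) →
    H Realises extend G 3 (ToK₄R G w d) → Generated H

  vertexToC₄ : (G : ℤ₂Graph) → Generated G → let open ℤ₂Graph G in
    (w v₁ v₂ : Fin order) → ¬ FixedVertex G w → w ~ v₁ → w ~ v₂ → v₁ ≢ v₂ →
    (M : Subset order) → v₁ ∉ M → v₂ ∉ M →
    H Realises extend G 1 (ToC₄R G w v₁ v₂ M) → Generated H

  joining : (G₁ G₂ : ℤ₂Graph) → Generated G₁ → Generated G₂ →
    (x : Fin (ℤ₂Graph.order G₁)) (y : Fin (ℤ₂Graph.order G₂)) →
    H Realises join G₁ G₂ x y → Generated H

-- Let F X = 4 |X| - 4 - e(X , X), where e counts ordered adjacent pairs.  Then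
-- (2,2)-sparsity says that F is nonnegative on nonempty sets, and tightness
-- that moreover F vanishes on the whole vertex set.  F is modular up to the
-- edges that cross, it is even, and on θ-invariant sets it is divisible by 4.
--
-- Each operation changes F by an explicit amount, hence preserves tightness.
-- Conversely, argue by induction on the order.  A vertex of degree 2 is removed
-- by an inverse 0-extension.  Let v have neighbours a, b, c.  An inverse
-- 1-extension adding ab fails only if ab is an edge, or b = θ a, or a tight set
-- contains a and b and avoids v and θ v.  Comparing the three pairs leaves v in
-- a K₄ or in a copy of F₁.  A K₄ joined by edges to its image gives a copy of
-- F₂; otherwise the K₄ is contracted, or, if an outside vertex u has two
-- neighbours in it, v is merged into u by an inverse vertex-to-C₄.
--
-- If nothing applies, every vertex of degree 3 lies in an invariant tight copy
-- of F₁ or F₂.  These copies are minimal among invariant tight sets, hence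
-- pairwise disjoint.  A proper copy left by just two edges exhibits a joining.
-- If at least four edges leave each copy, then the sum of deg - 4 is nonnegative
-- over each copy and over the remaining vertices, whereas its total is -4.

module Submission where

open import Defs
open import Data.Bool.Base using (Bool; true; false; T; not; _∧_; _∨_; if_then_else_)
open import Data.Bool.Properties using (T?; ∧-comm; ∨-comm; ∧-identityʳ; ∧-zeroʳ; ∨-identityʳ) renaming (_≟_ to _≟ᵇ_)
open import Data.Empty using (⊥; ⊥-elim)
open import Data.Fin.Base using (Fin; zero; suc)
open import Data.Fin.Patterns using (0F; 1F; 2F; 3F; 4F; 5F)
open import Data.Fin.Properties using (_≟_; any?; all?; +↔⊎; _<?_; <-cmp; <-asym; <-irrefl; pigeonhole; suc-injective)
open import Data.Fin.Subset as Subset using (Subset; ∣_∣)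
open import Data.Fin.Subset.Properties using (anySubset?; x∈⁅x⁆; x∈⁅y⁆⇒x≡y)
open import Data.Integer.Base using (ℤ; +_; -[1+_]; 0ℤ; 1ℤ; _+_; _*_; _-_; -_; _≤_; _<_; +≤+)
open import Data.Integer.Properties as ℤ using (≤-refl; ≤-trans; ≤-reflexive)
open import Data.Integer.Tactic.RingSolver using (solve-∀)
open import Data.Nat.Base as ℕ using (ℕ; zero; suc; z≤n; s≤s)
open import Data.Nat.Properties as ℕ using ()
open import Data.Nat.Induction using (<-wellFounded)
open import Induction.WellFounded using (Acc; acc)
open import Data.Product.Base using (_×_; _,_; proj₁; proj₂; ∃; map₂)
open import Data.Sum.Base as Sum using (_⊎_; inj₁; inj₂; [_,_]′)
open import Data.Sum.Properties using (inj₁-injective; inj₂-injective)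
open import Data.Unit.Base using (tt)
open import Data.Vec.Base using (lookup; tabulate)
open import Data.Vec.Properties using (lookup∘tabulate; lookup⇒[]=; []=⇒lookup)
open import Function.Base using (_∘_; id; case_of_)
open import Function.Bundles using (_⇔_; _↔_; mk⇔; mk↔ₛ′; Equivalence; Inverse)
open import Function.Construct.Composition using (_↔-∘_)
open import Function.Construct.Symmetry using (↔-sym)
open import Relation.Binary.Construct.Closure.Symmetric using (fwd; bwd)
open import Relation.Binary.Definitions using (tri<; tri≈; tri>)
open import Relation.Binary.PropositionalEquality
open import Relation.Nullary.Decidable using (Dec; yes; no; does; _×-dec_; _⊎-dec_; _→-dec_; ¬?; from-yes; from-no; map′; dec-true; dec-false)
open import Relation.Nullary.Negation using (¬_; contradiction)
open import Algebra.Properties.Semiring.Sum ℤ.+-*-semiring using (sum; sum-replicate-zero; *-distribˡ-sum)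
open import Algebra.Properties.CommutativeMonoid.Sum ℤ.+-0-commutativeMonoid using (∑-distrib-+; ∑-comm; sum-permute)

-- The obstacle is that edges come in pairs. Adding both pq and its image costs 4 on a set that
-- contains all four ends, whereas evenness only says that `F` is at least 2 on a nonempty set that
-- is not tight. Divisibility by 4 on invariant sets closes this gap.
--
-- A tight set that avoids v never contains all three neighbours of v, since adding v would lower
-- `F` to -2. Two blocking sets share a neighbour, so their union would be such a set; hence at most
-- one of the three pairs is blocked. Adjacencies and the symmetry let a single blocking set grow to
-- the same contradiction.
--
-- Divisibility also enters the final count. If L edges leave an invariant tight set, its complement
-- has `F` equal to 2L - 4. For a nonempty complement this is a nonnegative multiple of 4, so L is 2
-- or at least 4. The sum of deg - 4 over the set is L - 4; over all n vertices it is -4, because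
-- the degrees add up to 4n - 4.
--
-- Minimality of the copies rests on sizes: a nonempty invariant tight set has at least six
-- vertices, and a copy has at most eight.

private
  variable
    n m k : ℕ
    A B P Q : Set

-- Booleans, indicators and finite sums

opaque
  -- Integer values make every bound a ring identity plus nonnegative terms. The sum stays symbolic
  -- outside its basic laws and the evaluation of small concrete graphs.
  ∑ : (Fin n → ℤ) → ℤ
  ∑ {zero} f = 0ℤ
  ∑ {suc n} f = f zero + ∑ (f ∘ suc)

opaque
  unfolding ∑

  ∑≡sum : (f : Fin n → ℤ) → ∑ f ≡ sum f
  ∑≡sum {zero} f = refl
  ∑≡sum {suc n} f = cong (λ z → f zero + z) (∑≡sum (f ∘ suc))

⟦_⟧ : Bool → ℤ
⟦ true ⟧ = 1ℤ
⟦ false ⟧ = 0ℤ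

≤-by : ∀ {a b} c → 0ℤ ≤ c → b ≡ a + c → a ≤ b
≤-by {a} c h refl = subst (_≤ a + c) (ℤ.+-identityʳ a) (ℤ.+-monoʳ-≤ a h)

0≤-by : ∀ {b} c → 0ℤ ≤ c → b ≡ c → 0ℤ ≤ b
0≤-by c h refl = h

0≤+ : ∀ {a b} → 0ℤ ≤ a → 0ℤ ≤ b → 0ℤ ≤ a + b
0≤+ = ℤ.+-mono-≤

0≤* : ∀ {a b} → 0ℤ ≤ a → 0ℤ ≤ b → 0ℤ ≤ a * b
0≤* {+ a} {+ b} _ _ = subst (0ℤ ≤_) (ℤ.pos-* a b) (+≤+ z≤n)

0≤- : ∀ {a b} → a ≤ b → 0ℤ ≤ b - a
0≤- = ℤ.i≤j⇒0≤j-i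

0≤⟦_⟧ : ∀ b → 0ℤ ≤ ⟦ b ⟧
0≤⟦ true ⟧ = +≤+ z≤n
0≤⟦ false ⟧ = ≤-refl

⟦_⟧≤1 : ∀ b → ⟦ b ⟧ ≤ 1ℤ
⟦ true ⟧≤1 = ≤-refl
⟦ false ⟧≤1 = +≤+ z≤n

⟦⟧-true : ∀ {b} → T b → ⟦ b ⟧ ≡ 1ℤ
⟦⟧-true {true} _ = refl

⟦⟧-false : ∀ {b} → ¬ T b → ⟦ b ⟧ ≡ 0ℤ
⟦⟧-false {true} h = contradiction tt h
⟦⟧-false {false} _ = refl

T-does : (d : Dec P) → T (does d) → P
T-does (yes p) _ = p

does-T : (d : Dec P) → P → T (does d)
does-T (yes _) _ = tt
does-T (no ¬p) p = ¬p p

T-irr : ∀ {b} → ¬ T b → b ≡ false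
T-irr {true} h = ⊥-elim (h tt)
T-irr {false} h = refl

T⇔≡ : ∀ {a b} → (T a → T b) → (T b → T a) → a ≡ b
T⇔≡ {true} {true} f g = refl
T⇔≡ {true} {false} f g = ⊥-elim (f tt)
T⇔≡ {false} {true} f g = ⊥-elim (g tt)
T⇔≡ {false} {false} f g = refl

∧-i : ∀ {a b} → T a → T b → T (a ∧ b)
∧-i {true} {true} _ _ = tt

∧-e₁ : ∀ {a b} → T (a ∧ b) → T a
∧-e₁ {true} _ = tt

∧-e₂ : ∀ {a b} → T (a ∧ b) → T b
∧-e₂ {true} h = h

∨-i₁ : ∀ {a b} → T a → T (a ∨ b)
∨-i₁ {true} _ = tt

∨-i₂ : ∀ {a b} → T b → T (a ∨ b)
∨-i₂ {true} _ = tt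
∨-i₂ {false} h = h

∨-e : ∀ {a b} → T (a ∨ b) → T a ⊎ T b
∨-e {true} h = inj₁ tt
∨-e {false} h = inj₂ h

not-i : ∀ {a} → ¬ T a → T (not a)
not-i {true} h = h tt
not-i {false} h = tt

not-e : ∀ {a} → T (not a) → ¬ T a
not-e {false} _ ()

-- Identities between 0/1-valued sums are reduced to equivalences of
-- propositions through ind-unique.
Ind : ℤ → Set → Set
Ind z P = (z ≡ 1ℤ × P) ⊎ (z ≡ 0ℤ × ¬ P)

ind-Bool : ∀ b → Ind ⟦ b ⟧ (T b)
ind-Bool true = inj₁ (refl , tt)
ind-Bool false = inj₂ (refl , λ ())

ind-⊎ : ∀ {z w} → Ind z P → Ind w Q → (P → Q → ⊥) → Ind (z + w) (P ⊎ Q)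
ind-⊎ (inj₁ (refl , p)) (inj₁ (refl , q)) d = ⊥-elim (d p q)
ind-⊎ (inj₁ (refl , p)) (inj₂ (refl , q)) d = inj₁ (refl , inj₁ p)
ind-⊎ (inj₂ (refl , p)) (inj₁ (refl , q)) d = inj₁ (refl , inj₂ q)
ind-⊎ (inj₂ (refl , p)) (inj₂ (refl , q)) d = inj₂ (refl , [ p , q ]′)

ind-× : ∀ {z w} → Ind z P → Ind w Q → Ind (z * w) (P × Q)
ind-× (inj₁ (refl , p)) (inj₁ (refl , q)) = inj₁ (refl , p , q)
ind-× (inj₁ (refl , p)) (inj₂ (refl , q)) = inj₂ (refl , q ∘ proj₂)
ind-× (inj₂ (refl , p)) (inj₁ (refl , q)) = inj₂ (refl , p ∘ proj₁)
ind-× (inj₂ (refl , p)) (inj₂ (refl , q)) = inj₂ (refl , p ∘ proj₁)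

ind-map : ∀ {z} → (P → Q) → (Q → P) → Ind z P → Ind z Q
ind-map f g (inj₁ (e , p)) = inj₁ (e , f p)
ind-map f g (inj₂ (e , p)) = inj₂ (e , p ∘ g)

ind-unique : ∀ {z w} → Ind z P → Ind w P → z ≡ w
ind-unique (inj₁ (refl , p)) (inj₁ (refl , q)) = refl
ind-unique (inj₁ (refl , p)) (inj₂ (refl , q)) = contradiction p q
ind-unique (inj₂ (refl , p)) (inj₁ (refl , q)) = contradiction q p
ind-unique (inj₂ (refl , p)) (inj₂ (refl , q)) = refl

ind-≤ : ∀ {z w} → Ind z P → Ind w Q → (P → Q) → z ≤ w
ind-≤ (inj₁ (refl , p)) (inj₁ (refl , q)) f = ≤-refl
ind-≤ (inj₁ (refl , p)) (inj₂ (refl , q)) f = contradiction (f p) q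
ind-≤ (inj₂ (refl , p)) (inj₁ (refl , q)) f = +≤+ z≤n
ind-≤ (inj₂ (refl , p)) (inj₂ (refl , q)) f = ≤-refl

δ : Fin n → Fin n → ℤ
δ a x = ⟦ does (a ≟ x) ⟧

ind-δ : (a x : Fin n) → Ind (δ a x) (x ≡ a)
ind-δ a x with a ≟ x
... | yes e = inj₁ (refl , sym e)
... | no ¬e = inj₂ (refl , ¬e ∘ sym)

opaque
  unfolding ∑

  ∑-cong : {f g : Fin n → ℤ} → (∀ x → f x ≡ g x) → ∑ f ≡ ∑ g
  ∑-cong {zero} h = refl
  ∑-cong {suc n} h = cong₂ _+_ (h zero) (∑-cong (h ∘ suc))

∑-+ : (f g : Fin n → ℤ) → ∑ (λ x → f x + g x) ≡ ∑ f + ∑ g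
∑-+ f g = trans (∑≡sum (λ x → f x + g x)) (trans (∑-distrib-+ f g) (sym (cong₂ _+_ (∑≡sum f) (∑≡sum g))))

∑-* : ∀ c (f : Fin n → ℤ) → ∑ (λ x → c * f x) ≡ c * ∑ f
∑-* c f = trans (∑≡sum (λ x → c * f x)) (trans (sym (*-distribˡ-sum c f)) (cong (c *_) (sym (∑≡sum f))))

∑-0 : ∀ n → ∑ {n} (λ _ → 0ℤ) ≡ 0ℤ
∑-0 n = trans (∑≡sum {n} (λ _ → 0ℤ)) (sum-replicate-zero n)

opaque
  unfolding ∑

  ∑-mono : {f g : Fin n → ℤ} → (∀ x → f x ≤ g x) → ∑ f ≤ ∑ g
  ∑-mono {zero} h = ≤-refl
  ∑-mono {suc n} h = ℤ.+-mono-≤ (h zero) (∑-mono (h ∘ suc))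

0≤∑ : {f : Fin n → ℤ} → (∀ x → 0ℤ ≤ f x) → 0ℤ ≤ ∑ f
0≤∑ {n} {f} h = subst (λ z → z ≤ ∑ f) (∑-0 n) (∑-mono h)

∑-neg : (f : Fin n → ℤ) → ∑ (λ x → - f x) ≡ - ∑ f
∑-neg f = trans (∑-cong (λ x → sym (ℤ.-1*i≡-i (f x)))) (trans (∑-* (- 1ℤ) f) (ℤ.-1*i≡-i (∑ f)))

∑-- : (f g : Fin n → ℤ) → ∑ (λ x → f x - g x) ≡ ∑ f - ∑ g
∑-- f g = trans (∑-+ f (λ x → - g x)) (cong (_+_ (∑ f)) (∑-neg g))

opaque
  unfolding ∑

  ∑-const : ∀ n c → ∑ {n} (λ _ → c) ≡ + n * c
  ∑-const zero c = refl
  ∑-const (suc n) c = trans (cong (λ z → c + z) (∑-const n c)) (sym (trans (cong (_* c) (ℤ.pos-+ 1 n)) (lem (+ n) c)))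
    where
    lem : ∀ x c → (1ℤ + x) * c ≡ c + x * c
    lem = solve-∀

opaque
  unfolding ∑

  ∑-δ : (a : Fin n) (f : Fin n → ℤ) → ∑ (λ x → δ a x * f x) ≡ f a
  ∑-δ {suc n} zero f = trans (cong₂ _+_ (ℤ.*-identityˡ (f zero)) (∑-0 n)) (ℤ.+-identityʳ _)
  ∑-δ {suc n} (suc a) f = trans (ℤ.+-identityˡ _) (trans (∑-cong step) (∑-δ a (f ∘ suc)))
    where
    step : ∀ x → δ (suc a) (suc x) * f (suc x) ≡ δ a x * f (suc x)
    step x = cong (_* f (suc x)) (ind-unique (ind-δ (suc a) (suc x)) (ind-map (cong suc) (λ { refl → refl }) (ind-δ a x)))

≤∑-at : (a : Fin n) {f : Fin n → ℤ} → (∀ x → 0ℤ ≤ f x) → f a ≤ ∑ f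
≤∑-at a {f} h = subst (_≤ ∑ f) (∑-δ a f) (∑-mono step)
  where
  step : ∀ x → δ a x * f x ≤ f x
  step x with a ≟ x
  ... | yes _ = ≤-reflexive (ℤ.*-identityˡ (f x))
  ... | no _ = h x

-- Each difference `g x - f x` is at most the sum of these nonnegative differences, which is at most
-- 0. Applied to rows and then to entries, this turns equal edge counts into equal edge sets.
∑-≡⇒≡ : {f g : Fin n → ℤ} → (∀ x → f x ≤ g x) → ∑ g ≤ ∑ f → ∀ x → f x ≡ g x
∑-≡⇒≡ {f = f} {g} h le x = ℤ.≤-antisym (h x) (ℤ.i-j≤0⇒i≤j bound)
  where
  bound : g x - f x ≤ 0ℤ
  bound = ≤-trans (≤∑-at x (λ y → 0≤- (h y))) (≤-trans (≤-reflexive (∑-- g f)) (ℤ.i≤j⇒i-j≤0 le))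

∑-swap : (f : Fin n → Fin m → ℤ) → ∑ (λ x → ∑ (f x)) ≡ ∑ (λ y → ∑ (λ x → f x y))
∑-swap f = trans (double f) (trans (∑-comm f) (sym (double (λ y x → f x y))))
  where
  double : ∀ {n m} (f : Fin n → Fin m → ℤ) → ∑ (λ x → ∑ (f x)) ≡ sum (λ x → sum (f x))
  double f = trans (∑-cong (λ x → ∑≡sum (f x))) (∑≡sum (λ x → sum (f x)))

opaque
  unfolding ∑

  ∑-++ : ∀ m {n} (f : Fin m ⊎ Fin n → ℤ) → ∑ (f ∘ Inverse.to (+↔⊎ {m} {n})) ≡ ∑ (f ∘ inj₁) + ∑ (f ∘ inj₂)
  ∑-++ zero f = sym (ℤ.+-identityˡ _)
  ∑-++ (suc m) {n} f = begin
    f (inj₁ zero) + ∑ (λ x → f (Inverse.to (+↔⊎ {suc m} {n}) (suc x)))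
      ≡⟨⟩
    f (inj₁ zero) + ∑ (λ x → f (Sum.map suc id (Inverse.to (+↔⊎ {m} {n}) x)))
      ≡⟨ cong (λ z → f (inj₁ zero) + z) (∑-++ m (f ∘ Sum.map suc id)) ⟩
    f (inj₁ zero) + (∑ (f ∘ inj₁ ∘ suc) + ∑ (f ∘ inj₂))
      ≡⟨ sym (ℤ.+-assoc (f (inj₁ zero)) _ _) ⟩
    ∑ (f ∘ inj₁) + ∑ (f ∘ inj₂) ∎
    where open ≡-Reasoning

∑-↔ : (i : Fin n ↔ A) (j : Fin m ↔ A) (f : A → ℤ) → ∑ (f ∘ Inverse.to i) ≡ ∑ (f ∘ Inverse.to j)
∑-↔ i j f = trans (∑≡sum (f ∘ Inverse.to i)) (trans (sum-permute (f ∘ Inverse.to i) π) (trans (sym (∑≡sum (f ∘ Inverse.to i ∘ Inverse.to π))) (∑-cong (λ x → cong f (Inverse.strictlyInverseˡ i (Inverse.to j x))))))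
  where
  π = ↔-sym i ↔-∘ j

∑-⊎ : (i : Fin n ↔ (Fin m ⊎ A)) (j : Fin k ↔ A) (f : Fin m ⊎ A → ℤ) →
      ∑ (f ∘ Inverse.to i) ≡ ∑ (f ∘ inj₁) + ∑ (f ∘ inj₂ ∘ Inverse.to j)
∑-⊎ {m = m} {k = k} i j f = trans (∑-↔ i i′ f) (∑-++ m (λ x → f (g x)))
  where
  g : Fin m ⊎ Fin k → _
  g = Sum.map id (Inverse.to j)
  g⁻ : _ → Fin m ⊎ Fin k
  g⁻ = Sum.map id (Inverse.from j)
  i′ = mk↔ₛ′ g g⁻
         (λ { (inj₁ x) → refl ; (inj₂ y) → cong inj₂ (Inverse.strictlyInverseˡ j y) })
         (λ { (inj₁ x) → refl ; (inj₂ y) → cong inj₂ (Inverse.strictlyInverseʳ j y) })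
       ↔-∘ +↔⊎

halves : Fin k ⊎ Fin k → Fin k × Bool
halves (inj₁ i) = i , false
halves (inj₂ i) = i , true

pairs↔ : ∀ k → Fin (k ℕ.+ k) ↔ (Fin k × Bool)
pairs↔ k = mk↔ₛ′ halves (λ { (i , false) → inj₁ i ; (i , true) → inj₂ i })
    (λ { (i , false) → refl ; (i , true) → refl })
    (λ { (inj₁ i) → refl ; (inj₂ i) → refl })
  ↔-∘ +↔⊎

∑-pairs : ∀ k (f : Fin k × Bool → ℤ) →
          ∑ (f ∘ Inverse.to (pairs↔ k)) ≡ ∑ (λ i → f (i , false)) + ∑ (λ i → f (i , true))
∑-pairs k f = ∑-++ k (f ∘ halves)

image : (Fin k → Fin n) → Fin n → Bool
image φ x = does (any? λ i → φ i ≟ x)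

image-∈ : (φ : Fin k → Fin n) (i : Fin k) → T (image φ (φ i))
image-∈ φ i = does-T (any? λ j → φ j ≟ φ i) (i , refl)

image-∋ : (φ : Fin k → Fin n) {x : Fin n} → T (image φ x) → ∃ λ i → φ i ≡ x
image-∋ φ {x} h with any? (λ j → φ j ≟ x)
... | yes p = p

opaque
  unfolding ∑

  ind-image : (φ : Fin k → Fin n) → (∀ {i j} → φ i ≡ φ j → i ≡ j) → ∀ x → Ind (∑ λ i → δ (φ i) x) (∃ λ i → φ i ≡ x)
  ind-image {zero} φ inj x = inj₂ (refl , λ ())
  ind-image {suc k} φ inj x = ind-map
    (λ { (inj₁ e) → zero , sym e ; (inj₂ (i , e)) → suc i , e })
    (λ { (zero , e) → inj₁ (sym e) ; (suc i , e) → inj₂ (i , e) })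
    (ind-⊎ (ind-δ (φ zero) x) (ind-image (φ ∘ suc) (suc-injective ∘ inj) x)
           (λ { e (i , e′) → case inj (trans (sym e) (sym e′)) of λ () }))

∑-image : (φ : Fin k → Fin n) → (∀ {i j} → φ i ≡ φ j → i ≡ j) → (f : Fin n → ℤ) →
          ∑ (λ x → ⟦ image φ x ⟧ * f x) ≡ ∑ (f ∘ φ)
∑-image φ inj f = begin
  ∑ (λ x → ⟦ image φ x ⟧ * f x)            ≡⟨ ∑-cong (λ x → cong (_* f x) (step x)) ⟩
  ∑ (λ x → ∑ (λ i → δ (φ i) x) * f x)      ≡⟨ ∑-cong (λ x → trans (ℤ.*-comm (∑ (λ i → δ (φ i) x)) (f x)) (sym (∑-* (f x) (λ i → δ (φ i) x)))) ⟩
  ∑ (λ x → ∑ (λ i → f x * δ (φ i) x))      ≡⟨ ∑-swap (λ x i → f x * δ (φ i) x) ⟩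
  ∑ (λ i → ∑ (λ x → f x * δ (φ i) x))      ≡⟨ ∑-cong (λ i → trans (∑-cong (λ x → ℤ.*-comm (f x) (δ (φ i) x))) (∑-δ (φ i) f)) ⟩
  ∑ (f ∘ φ)                                ∎
  where
  open ≡-Reasoning
  step : ∀ x → ⟦ image φ x ⟧ ≡ ∑ (λ i → δ (φ i) x)
  step x = ind-unique (ind-map (image-∋ φ) (λ { (i , refl) → image-∈ φ i }) (ind-Bool (image φ x))) (ind-image φ inj x)

∑-inj-≤ : (φ : Fin k → Fin n) → (∀ {i j} → φ i ≡ φ j → i ≡ j) → {f : Fin n → ℤ} → (∀ x → 0ℤ ≤ f x) → ∑ (f ∘ φ) ≤ ∑ f
∑-inj-≤ φ inj {f} h = subst (_≤ ∑ f) (∑-image φ inj f) (∑-mono step)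
  where
  step : ∀ x → ⟦ image φ x ⟧ * f x ≤ f x
  step x with image φ x
  ... | true = ≤-reflexive (ℤ.*-identityˡ (f x))
  ... | false = h x

-- Vertex sets and the function F

∀Bool? : {P : Bool → Set} → (∀ b → Dec (P b)) → Dec (∀ b → P b)
∀Bool? P? = map′ (λ { (t , f) true → t ; (t , f) false → f }) (λ h → h true , h false) (P? true ×-dec P? false)

Matrix Sub : ℕ → Set
Matrix n = Fin n → Fin n → Bool
Sub n = Fin n → Bool

infixl 6 _∪_ _∖_
infixl 7 _∩_

_∪_ _∩_ _∖_ : Sub n → Sub n → Sub n
(X ∪ Y) x = X x ∨ Y x
(X ∩ Y) x = X x ∧ Y x
(X ∖ Y) x = X x ∧ not (Y x)

full : Sub n
full _ = true

single : Fin n → Sub n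
single v x = does (v ≟ x)

single-∈ : (v : Fin n) → T (single v v)
single-∈ v = subst T (sym (dec-true (v ≟ v) refl)) tt

single-∋ : (v : Fin n) {x : Fin n} → T (single v x) → x ≡ v
single-∋ v {x} h with v ≟ x
... | yes e = sym e

∣_∣ₛ : Sub n → ℤ
∣ X ∣ₛ = ∑ λ x → ⟦ X x ⟧

E : Matrix n → (Fin n → Fin n → ℤ) → ℤ
E a g = ∑ λ x → ∑ λ y → ⟦ a x y ⟧ * g x y

link : Matrix n → Sub n → Sub n → ℤ
link a X Y = E a λ x y → ⟦ X x ⟧ * ⟦ Y y ⟧

deg : Matrix n → Fin n → Sub n → ℤ
deg a v X = ∑ λ x → ⟦ a v x ⟧ * ⟦ X x ⟧

-- Twice the freedom 2|X| - 2 - i(X), since link counts ordered pairs.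
opaque
  F : Matrix n → Sub n → ℤ
  F a X = + 4 * ∣ X ∣ₛ - + 4 - link a X X

module _ (a : Matrix n) where

  E-cong : {g h : Fin n → Fin n → ℤ} → (∀ x y → g x y ≡ h x y) → E a g ≡ E a h
  E-cong e = ∑-cong λ x → ∑-cong λ y → cong (⟦ a x y ⟧ *_) (e x y)

  E-+ : (g h : Fin n → Fin n → ℤ) → E a (λ x y → g x y + h x y) ≡ E a g + E a h
  E-+ g h = trans
    (∑-cong λ x → trans (∑-cong λ y → ℤ.*-distribˡ-+ ⟦ a x y ⟧ (g x y) (h x y)) (∑-+ _ _))
    (∑-+ _ _)

  E-pos : {g : Fin n → Fin n → ℤ} → (∀ x y → 0ℤ ≤ g x y) → 0ℤ ≤ E a g
  E-pos h = 0≤∑ λ x → 0≤∑ λ y → 0≤* 0≤⟦ a x y ⟧ (h x y)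

  0≤link : ∀ X Y → 0ℤ ≤ link a X Y
  0≤link X Y = E-pos λ x y → 0≤* 0≤⟦ X x ⟧ 0≤⟦ Y y ⟧

  opaque
    unfolding F

    F-cong : {X Y : Sub n} → (∀ x → X x ≡ Y x) → F a X ≡ F a Y
    F-cong e = cong₂ (λ s l → + 4 * s - + 4 - l) (∑-cong λ x → cong ⟦_⟧ (e x))
      (E-cong λ x y → cong₂ (λ b c → ⟦ b ⟧ * ⟦ c ⟧) (e x) (e y))

  -- Every `φ i` owns a row of the double sum, so the pairs are counted separately even when `ψ`
  -- repeats a value.
  pairs≤link : (X Y : Sub n) (φ ψ : Fin k → Fin n) → (∀ {i j} → φ i ≡ φ j → i ≡ j) →
    (∀ i → T (a (φ i) (ψ i)) × T (X (φ i)) × T (Y (ψ i))) → + k ≤ link a X Y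
  pairs≤link {k} X Y φ ψ inj h = ≤-trans (≤-reflexive (trans (sym (ℤ.*-identityʳ (+ k))) (sym (∑-const k 1ℤ))))
    (≤-trans (∑-mono bound) (∑-inj-≤ φ inj row-pos))
    where
    row : Fin n → ℤ
    row x = ∑ λ y → ⟦ a x y ⟧ * (⟦ X x ⟧ * ⟦ Y y ⟧)
    entry-pos : ∀ x y → 0ℤ ≤ ⟦ a x y ⟧ * (⟦ X x ⟧ * ⟦ Y y ⟧)
    entry-pos x y = 0≤* 0≤⟦ a x y ⟧ (0≤* 0≤⟦ X x ⟧ 0≤⟦ Y y ⟧)
    row-pos : ∀ x → 0ℤ ≤ row x
    row-pos x = 0≤∑ (entry-pos x)
    bound : ∀ i → 1ℤ ≤ row (φ i)
    bound i with h i
    ... | e , p , q = subst (_≤ row (φ i))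
      (cong₂ _*_ (⟦⟧-true e) (cong₂ _*_ (⟦⟧-true p) (⟦⟧-true q)))
      (≤∑-at (ψ i) (entry-pos (φ i)))

  size≤deg : ∀ v (X : Sub n) (φ : Fin k → Fin n) → (∀ {i j} → φ i ≡ φ j → i ≡ j) →
    (∀ i → T (a v (φ i)) × T (X (φ i))) → + k ≤ deg a v X
  size≤deg {k} v X φ inj h = ≤-trans (≤-reflexive (trans (sym (ℤ.*-identityʳ (+ k))) (sym (∑-const k 1ℤ))))
    (≤-trans (∑-mono bound) (∑-inj-≤ φ inj λ x → 0≤* 0≤⟦ a v x ⟧ 0≤⟦ X x ⟧))
    where
    bound : ∀ i → 1ℤ ≤ ⟦ a v (φ i) ⟧ * ⟦ X (φ i) ⟧
    bound i with h i
    ... | e , p = ≤-reflexive (sym (cong₂ _*_ (⟦⟧-true e) (⟦⟧-true p)))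

  link-single : ∀ v X → link a (single v) X ≡ deg a v X
  link-single v X = trans (∑-cong λ x → trans (∑-cong λ y → lem ⟦ a x y ⟧ (δ v x) ⟦ X y ⟧) (∑-* (δ v x) (λ y → ⟦ a x y ⟧ * ⟦ X y ⟧)))
    (∑-δ v λ x → ∑ λ y → ⟦ a x y ⟧ * ⟦ X y ⟧)
    where
    lem : ∀ p q r → p * (q * r) ≡ q * (p * r)
    lem = solve-∀

  module Symmetric (a-sym : ∀ x y → a x y ≡ a y x) where

    E-swap : (g : Fin n → Fin n → ℤ) → E a (λ x y → g y x) ≡ E a g
    E-swap g = trans (∑-swap λ x y → ⟦ a x y ⟧ * g y x) (∑-cong λ y → ∑-cong λ x → cong (λ b → ⟦ b ⟧ * g y x) (a-sym x y))

    link-sym : ∀ X Y → link a X Y ≡ link a Y X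
    link-sym X Y = trans (sym (E-swap λ x y → ⟦ X x ⟧ * ⟦ Y y ⟧)) (E-cong λ x y → ℤ.*-comm ⟦ X y ⟧ ⟦ Y x ⟧)

    opaque
      unfolding F

      -- Inclusion and exclusion for ordered pairs: the pairs inside the union that lie neither in X
      -- nor in Y run between the two differences, in either direction, whence the factor 2. The
      -- identity holds entry by entry and is checked there on all truth values.
      modular : ∀ X Y → F a (X ∪ Y) + F a (X ∩ Y) + + 2 * link a (X ∖ Y) (Y ∖ X) ≡ F a X + F a Y
      modular X Y = trans
        (alg₁ ∣ X ∪ Y ∣ₛ ∣ X ∩ Y ∣ₛ (link a (X ∪ Y) (X ∪ Y)) (link a (X ∩ Y) (X ∩ Y)) (link a (X ∖ Y) (Y ∖ X)))
        (trans (cong₂ (λ s l → + 4 * s - + 8 - l) sizes links) (alg₂ ∣ X ∣ₛ ∣ Y ∣ₛ (link a X X) (link a Y Y)))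
        where
        alg₁ : ∀ s t l k d → (+ 4 * s - + 4 - l) + (+ 4 * t - + 4 - k) + + 2 * d ≡ + 4 * (s + t) - + 8 - (l + k - d - d)
        alg₁ = solve-∀
        alg₂ : ∀ s t l k → + 4 * (s + t) - + 8 - (l + k) ≡ (+ 4 * s - + 4 - l) + (+ 4 * t - + 4 - k)
        alg₂ = solve-∀
        alg₃ : ∀ u d e v → u + v - d - e ≡ (u + v) - (d + e)
        alg₃ = solve-∀
        sizes : ∣ X ∪ Y ∣ₛ + ∣ X ∩ Y ∣ₛ ≡ ∣ X ∣ₛ + ∣ Y ∣ₛ
        sizes = trans (sym (∑-+ (λ x → ⟦ X x ∨ Y x ⟧) (λ x → ⟦ X x ∧ Y x ⟧)))
          (trans (∑-cong λ x → bits (X x) (Y x)) (∑-+ (λ x → ⟦ X x ⟧) (λ x → ⟦ Y x ⟧)))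
          where
          bits : ∀ p q → ⟦ p ∨ q ⟧ + ⟦ p ∧ q ⟧ ≡ ⟦ p ⟧ + ⟦ q ⟧
          bits = from-yes (∀Bool? λ p → ∀Bool? λ q → ⟦ p ∨ q ⟧ + ⟦ p ∧ q ⟧ ℤ.≟ ⟦ p ⟧ + ⟦ q ⟧)
        links : link a (X ∪ Y) (X ∪ Y) + link a (X ∩ Y) (X ∩ Y) - link a (X ∖ Y) (Y ∖ X) - link a (X ∖ Y) (Y ∖ X)
              ≡ link a X X + link a Y Y
        links = trans (cong (λ z → link a (X ∪ Y) (X ∪ Y) + link a (X ∩ Y) (X ∩ Y) - link a (X ∖ Y) (Y ∖ X) - z) (link-sym (X ∖ Y) (Y ∖ X)))
          (shift (link a (X ∪ Y) (X ∪ Y)) (link a (X ∩ Y) (X ∩ Y)) (link a (X ∖ Y) (Y ∖ X)) (link a (Y ∖ X) (X ∖ Y)) (link a X X + link a Y Y) total)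
          where
          shift : ∀ u v d e r → u + v ≡ r + (d + e) → u + v - d - e ≡ r
          shift u v d e r h = trans (alg₃ u d e v) (trans (cong (_- (d + e)) h) (alg₄ r (d + e)))
            where
            alg₄ : ∀ r d → r + d - d ≡ r
            alg₄ = solve-∀
          sq : Sub n → Sub n → Fin n → Fin n → ℤ
          sq Z W x y = ⟦ Z x ⟧ * ⟦ W y ⟧
          bits : ∀ p q r s → ⟦ p ∨ q ⟧ * ⟦ r ∨ s ⟧ + ⟦ p ∧ q ⟧ * ⟦ r ∧ s ⟧
               ≡ ⟦ p ⟧ * ⟦ r ⟧ + ⟦ q ⟧ * ⟦ s ⟧ + (⟦ p ∧ not q ⟧ * ⟦ s ∧ not r ⟧ + ⟦ q ∧ not p ⟧ * ⟦ r ∧ not s ⟧)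
          bits = from-yes (∀Bool? λ p → ∀Bool? λ q → ∀Bool? λ r → ∀Bool? λ s →
            ⟦ p ∨ q ⟧ * ⟦ r ∨ s ⟧ + ⟦ p ∧ q ⟧ * ⟦ r ∧ s ⟧
            ℤ.≟ ⟦ p ⟧ * ⟦ r ⟧ + ⟦ q ⟧ * ⟦ s ⟧ + (⟦ p ∧ not q ⟧ * ⟦ s ∧ not r ⟧ + ⟦ q ∧ not p ⟧ * ⟦ r ∧ not s ⟧))
          total : link a (X ∪ Y) (X ∪ Y) + link a (X ∩ Y) (X ∩ Y)
                ≡ link a X X + link a Y Y + (link a (X ∖ Y) (Y ∖ X) + link a (Y ∖ X) (X ∖ Y))
          total = trans (sym (E-+ (sq (X ∪ Y) (X ∪ Y)) (sq (X ∩ Y) (X ∩ Y))))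
            (trans (E-cong λ x y → bits (X x) (Y x) (X y) (Y y))
            (trans (E-+ (λ x y → sq X X x y + sq Y Y x y) (λ x y → sq (X ∖ Y) (Y ∖ X) x y + sq (Y ∖ X) (X ∖ Y) x y))
            (cong₂ _+_ (E-+ (sq X X) (sq Y Y)) (E-+ (sq (X ∖ Y) (Y ∖ X)) (sq (Y ∖ X) (X ∖ Y))))))

∅ : Sub n
∅ _ = false

module _ {a : Matrix n} where

  link-cong : {X X′ Y Y′ : Sub n} → (∀ x → X x ≡ X′ x) → (∀ x → Y x ≡ Y′ x) → link a X Y ≡ link a X′ Y′
  link-cong e f = E-cong a λ x y → cong₂ (λ b c → ⟦ b ⟧ * ⟦ c ⟧) (e x) (f y)

  opaque
    unfolding F

    F-∅ : F a ∅ ≡ - + 4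
    F-∅ = cong₂ (λ s l → + 4 * s - + 4 - l) (∑-0 n)
      (trans (∑-cong λ x → trans (∑-cong λ y → ℤ.*-zeroʳ ⟦ a x y ⟧) (∑-0 n)) (∑-0 n))

∣single∣ : (v : Fin n) → ∣ single v ∣ₛ ≡ 1ℤ
∣single∣ v = trans (∑-cong λ x → sym (ℤ.*-identityʳ (δ v x))) (∑-δ v λ _ → 1ℤ)

∣full∣ : ∀ n → ∣ full {n} ∣ₛ ≡ + n
∣full∣ n = trans (∑-const n 1ℤ) (ℤ.*-identityʳ (+ n))

0≤∣_∣ₛ : (X : Sub n) → 0ℤ ≤ ∣ X ∣ₛ
0≤∣ X ∣ₛ = 0≤∑ λ x → 0≤⟦ X x ⟧

∣∣-square : (X : Sub n) → ∑ (λ x → ∑ λ y → ⟦ X x ⟧ * ⟦ X y ⟧) ≡ ∣ X ∣ₛ * ∣ X ∣ₛ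
∣∣-square X = trans (∑-cong λ x → trans (∑-* ⟦ X x ⟧ (λ y → ⟦ X y ⟧)) (ℤ.*-comm ⟦ X x ⟧ ∣ X ∣ₛ)) (∑-* ∣ X ∣ₛ λ x → ⟦ X x ⟧)

⟦⟧-idem : ∀ b → ⟦ b ⟧ * ⟦ b ⟧ ≡ ⟦ b ⟧
⟦⟧-idem true = refl
⟦⟧-idem false = refl

module _ {a : Matrix n} (X : Sub n) where

  -- In the row of x the two distinct columns x and `f x` carry no edge. If X has s vertices, at
  -- most s² - 2s of its s² ordered pairs remain. The intended `f` is the involution.
  link-bound : (f : Fin n → Fin n) → (∀ x → X (f x) ≡ X x) → (∀ x → ¬ T (a x (f x))) →
    (∀ x → ¬ T (a x x)) → (∀ x → f x ≢ x) → link a X X ≤ ∣ X ∣ₛ * ∣ X ∣ₛ - + 2 * ∣ X ∣ₛ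
  link-bound f Xf miss irr f≢ = ≤-trans (∑-mono λ x → ∑-mono λ y → step x y) (≤-reflexive total)
    where
    w : Fin n → Fin n → ℤ
    w x y = ⟦ X x ⟧ * ⟦ X y ⟧
    step : ∀ x y → ⟦ a x y ⟧ * w x y ≤ w x y - (δ x y * w x y + δ (f x) y * w x y)
    step x y with ind-⊎ (ind-δ x y) (ind-δ (f x) y) (λ { refl e → f≢ x (sym e) })
    ... | inj₁ (e , p) = ≤-reflexive (trans (cong (_* w x y) (⟦⟧-false (none p))) (lem (w x y) (δ x y) (δ (f x) y) e))
      where
      none : y ≡ x ⊎ y ≡ f x → ¬ T (a x y)
      none (inj₁ refl) = irr x
      none (inj₂ refl) = miss x
      lem : ∀ w d e → d + e ≡ 1ℤ → 0ℤ * w ≡ w - (d * w + e * w)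
      lem w d e h = trans (lem₁ w) (trans (cong (λ z → w - z * w) (sym h)) (lem₂ w d e))
        where
        lem₁ : ∀ w → 0ℤ * w ≡ w - 1ℤ * w
        lem₁ = solve-∀
        lem₂ : ∀ w d e → w - (d + e) * w ≡ w - (d * w + e * w)
        lem₂ = solve-∀
    ... | inj₂ (e , p) = ≤-trans (bound (a x y)) (≤-reflexive (lem (w x y) (δ x y) (δ (f x) y) e))
      where
      bound : ∀ b → ⟦ b ⟧ * w x y ≤ w x y
      bound true = ≤-reflexive (ℤ.*-identityˡ (w x y))
      bound false = 0≤* 0≤⟦ X x ⟧ 0≤⟦ X y ⟧
      lem : ∀ w d e → d + e ≡ 0ℤ → w ≡ w - (d * w + e * w)
      lem w d e h = trans (lem₁ w) (trans (cong (λ z → w - z * w) (sym h)) (lem₂ w d e))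
        where
        lem₁ : ∀ w → w ≡ w - 0ℤ * w
        lem₁ = solve-∀
        lem₂ : ∀ w d e → w - (d + e) * w ≡ w - (d * w + e * w)
        lem₂ = solve-∀
    part : (g : Fin n → Fin n) → (∀ x → X (g x) ≡ X x) → ∑ (λ x → ∑ λ y → δ (g x) y * w x y) ≡ ∣ X ∣ₛ
    part g Xg = ∑-cong λ x → trans (∑-δ (g x) (w x)) (trans (cong (λ b → ⟦ X x ⟧ * ⟦ b ⟧) (Xg x)) (⟦⟧-idem (X x)))
    total : ∑ (λ x → ∑ λ y → w x y - (δ x y * w x y + δ (f x) y * w x y)) ≡ ∣ X ∣ₛ * ∣ X ∣ₛ - + 2 * ∣ X ∣ₛ
    total = trans (∑-cong λ x → ∑-- (w x) (λ y → δ x y * w x y + δ (f x) y * w x y))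
      (trans (∑-- (λ x → ∑ (w x)) (λ x → ∑ λ y → δ x y * w x y + δ (f x) y * w x y))
      (cong₂ _-_ (∣∣-square X)
        (trans (∑-cong λ x → ∑-+ (λ y → δ x y * w x y) (λ y → δ (f x) y * w x y))
        (trans (∑-+ (λ x → ∑ λ y → δ x y * w x y) (λ x → ∑ λ y → δ (f x) y * w x y))
        (trans (cong₂ _+_ (part id λ _ → refl) (part f Xf)) (lem ∣ X ∣ₛ))))))
      where
      lem : ∀ s → s + s ≡ + 2 * s
      lem = solve-∀

record Graphical (a : Matrix n) : Set where
  field
    a-sym : ∀ x y → a x y ≡ a y x
    a-irr : ∀ x → ¬ T (a x x)

  open Symmetric a a-sym public

  ~-sym : ∀ {x y} → T (a x y) → T (a y x)
  ~-sym {x} {y} = subst T (a-sym x y)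

  ~⇒≢ : ∀ {x y} → T (a x y) → x ≢ y
  ~⇒≢ e refl = a-irr _ e

  -- This is `modular` with an empty intersection, whose `F` is -4; moved to the other side, it
  -- becomes the `+ 4`.
  F-disjoint : ∀ X Y → (∀ x → T (X x) → ¬ T (Y x)) → F a (X ∪ Y) ≡ F a X + F a Y + + 4 - + 2 * link a X Y
  F-disjoint X Y dis = lem {f = F a X} {F a Y} (modular X Y) (trans (F-cong a {X ∩ Y} {∅} (λ x → bit (X x) (Y x) (dis x))) (F-∅ {a = a}))
    (link-cong {a = a} {X ∖ Y} {X} {Y ∖ X} {Y} (λ x → bit₁ (X x) (Y x) (dis x)) (λ x → bit₂ (X x) (Y x) (dis x)))
    where
    bit : ∀ p q → (T p → ¬ T q) → p ∧ q ≡ false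
    bit true true h = contradiction tt (h tt)
    bit true false h = refl
    bit false q h = refl
    bit₁ : ∀ p q → (T p → ¬ T q) → p ∧ not q ≡ p
    bit₁ true true h = contradiction tt (h tt)
    bit₁ true false h = refl
    bit₁ false q h = refl
    bit₂ : ∀ p q → (T p → ¬ T q) → q ∧ not p ≡ q
    bit₂ true true h = contradiction tt (h tt)
    bit₂ true false h = refl
    bit₂ false true h = refl
    bit₂ false false h = refl
    lem : ∀ {u i l l′ f g} → u + i + + 2 * l ≡ f + g → i ≡ - + 4 → l ≡ l′ → u ≡ f + g + + 4 - + 2 * l′
    lem {u} {i} {l} {f = f} {g} h refl refl = trans (lem₁ u l) (cong (λ z → z + + 4 - + 2 * l) h)
      where
      lem₁ : ∀ u l → u ≡ (u + - + 4 + + 2 * l) + + 4 - + 2 * l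
      lem₁ = solve-∀

  opaque
    unfolding F

    F-single : ∀ v → F a (single v) ≡ 0ℤ
    F-single v = cong₂ (λ s l → + 4 * s - + 4 - l) (∣single∣ v) (trans (link-single a v (single v))
      (trans (∑-cong λ x → ℤ.*-comm ⟦ a v x ⟧ (δ v x)) (trans (∑-δ v λ x → ⟦ a v x ⟧) (⟦⟧-false (a-irr v)))))

  F-insert : ∀ X v → ¬ T (X v) → F a (X ∪ single v) ≡ F a X + + 4 - + 2 * deg a v X
  F-insert X v v∉X = trans (F-disjoint X (single v) λ x x∈X h → v∉X (subst (T ∘ X) (single-∋ v h) x∈X))
    (trans (cong₂ (λ z l → F a X + z + + 4 - + 2 * l) (F-single v) (trans (link-sym X (single v)) (link-single a v X)))
    (cong (λ z → z + + 4 - + 2 * deg a v X) (ℤ.+-identityʳ (F a X))))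

  -- Counts each edge at its increasing pair, as the definition of the number of edges does, and so
  -- links that number to the ordered counts.
  upper : (Fin n → Fin n → ℤ) → ℤ
  upper g = ∑ λ x → ∑ λ y → ⟦ does (x <? y) ∧ a x y ⟧ * g x y

  E-upper : (g : Fin n → Fin n → ℤ) → (∀ x y → g x y ≡ g y x) → E a g ≡ + 2 * upper g
  E-upper g g-sym = trans (∑-cong λ x → trans (∑-cong λ y → step x y) (∑-+ (λ y → up x y * g x y) (λ y → up y x * g y x)))
    (trans (∑-+ (λ x → ∑ λ y → up x y * g x y) (λ x → ∑ λ y → up y x * g y x))
    (trans (cong (λ z → upper g + z) (∑-swap λ x y → up y x * g y x)) (lem (upper g))))
    where
    up : Fin n → Fin n → ℤ
    up x y = ⟦ does (x <? y) ∧ a x y ⟧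
    lem : ∀ s → s + s ≡ + 2 * s
    lem = solve-∀
    lem₁ : ∀ p q r → p * q ≡ p * q + 0ℤ * r
    lem₁ = solve-∀
    lem₂ : ∀ p q → p * q ≡ 0ℤ * q + p * q
    lem₂ = solve-∀
    step : ∀ x y → ⟦ a x y ⟧ * g x y ≡ up x y * g x y + up y x * g y x
    step x y with <-cmp x y
    ... | tri< l _ _ rewrite dec-true (x <? y) l | dec-false (y <? x) (<-asym l) = lem₁ ⟦ a x y ⟧ (g x y) (g y x)
    ... | tri> _ _ l rewrite dec-true (y <? x) l | dec-false (x <? y) (<-asym l) | a-sym y x | g-sym y x = lem₂ ⟦ a x y ⟧ (g x y)
    ... | tri≈ _ refl _ rewrite dec-false (x <? x) (<-irrefl refl) = cong (λ b → b * g x x) (⟦⟧-false (a-irr x))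

  opaque
    unfolding F

    F-even : ∀ X → ∃ λ z → F a X ≡ + 2 * z
    F-even X = _ , trans (cong (λ l → + 4 * ∣ X ∣ₛ - + 4 - l) (E-upper (λ x y → ⟦ X x ⟧ * ⟦ X y ⟧) λ x y → ℤ.*-comm ⟦ X x ⟧ ⟦ X y ⟧))
      (lem ∣ X ∣ₛ (upper λ x y → ⟦ X x ⟧ * ⟦ X y ⟧))
      where
      lem : ∀ s u → + 4 * s - + 4 - + 2 * u ≡ + 2 * (+ 2 * s - + 2 - u)
      lem = solve-∀

record Involutive (a : Matrix n) (θ : Fin n → Fin n) : Set where
  field
    graphical : Graphical a
    θ-inv : ∀ x → θ (θ x) ≡ x
    θ-auto : ∀ x y → a (θ x) (θ y) ≡ a x y
    θ-free : ∀ x → θ x ≢ x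
    ~̸θ : ∀ x → ¬ T (a x (θ x))

  open Graphical graphical public

  θ-injective : ∀ {x y} → θ x ≡ θ y → x ≡ y
  θ-injective {x} {y} e = trans (sym (θ-inv x)) (trans (cong θ e) (θ-inv y))

  ~-θ : ∀ {x y} → T (a x y) → T (a (θ x) (θ y))
  ~-θ {x} {y} = subst T (sym (θ-auto x y))

  Invariant : Sub n → Set
  Invariant X = ∀ x → X (θ x) ≡ X x

  ∑-θ : (f : Fin n → ℤ) → ∑ (f ∘ θ) ≡ ∑ f
  ∑-θ f = ∑-↔ (mk↔ₛ′ θ θ θ-inv θ-inv) (mk↔ₛ′ id id (λ _ → refl) λ _ → refl) f

  E-θ : (g : Fin n → Fin n → ℤ) → E a (λ x y → g (θ x) (θ y)) ≡ E a g
  E-θ g = trans (∑-cong λ x → trans (∑-cong λ y → cong (λ b → ⟦ b ⟧ * g (θ x) (θ y)) (sym (θ-auto x y)))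
      (∑-θ λ y → ⟦ a (θ x) y ⟧ * g (θ x) y))
    (∑-θ λ x → ∑ λ y → ⟦ a x y ⟧ * g x y)

  deg-θ : ∀ v X → deg a (θ v) X ≡ deg a v (X ∘ θ)
  deg-θ v X = trans (sym (∑-θ λ x → ⟦ a (θ v) x ⟧ * ⟦ X x ⟧)) (∑-cong λ x → cong (λ b → ⟦ b ⟧ * ⟦ X (θ x) ⟧) (θ-auto v x))

  opaque
    unfolding F

    F-θ : ∀ X → F a (X ∘ θ) ≡ F a X
    F-θ X = cong₂ (λ s l → + 4 * s - + 4 - l) (∑-θ λ x → ⟦ X x ⟧) (E-θ λ x y → ⟦ X x ⟧ * ⟦ X y ⟧)

  -- The four ordered pairs (x , y), (y , x), (θ x , θ y), (θ y , θ x) are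
  -- distinct for an edge xy; splitting along a transversal of the θ-orbits
  -- reduces the count to two symmetric loopless matrices.
  opaque
    unfolding F

    F-invariant : ∀ X → Invariant X → ∃ λ z → F a X ≡ + 4 * z
    F-invariant X inv = _ , trans (cong (λ l → + 4 * ∣ X ∣ₛ - + 4 - l) links)
        (lem ∣ X ∣ₛ (upper hh) (Graphical.upper twisted hh))
      where
      lem : ∀ s u v → + 4 * s - + 4 - (+ 4 * u + + 4 * v) ≡ + 4 * (s - 1ℤ - u - v)
      lem = solve-∀
      h h′ : Fin n → ℤ
      h x = ⟦ X x ∧ does (x <? θ x) ⟧
      h′ x = ⟦ X x ∧ does (θ x <? x) ⟧
      hh : Fin n → Fin n → ℤ
      hh x y = h x * h y
      h+h′ : ∀ x → ⟦ X x ⟧ ≡ h x + h′ x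
      h+h′ x with X x
      ... | false = refl
      ... | true with <-cmp x (θ x)
      ...   | tri< l _ _ rewrite dec-true (x <? θ x) l | dec-false (θ x <? x) (<-asym l) = refl
      ...   | tri> _ _ g rewrite dec-true (θ x <? x) g | dec-false (x <? θ x) (<-asym g) = refl
      ...   | tri≈ _ e _ = contradiction (sym e) (θ-free x)
      h′-θ : ∀ x → h′ (θ x) ≡ h x
      h′-θ x rewrite inv x | θ-inv x = refl
      -- An edge between the transversal and its image is read as an edge on the transversal alone.
      -- This matrix is symmetric because θ is an automorphism, and a loop of it would be an edge
      -- from x to `θ x`.
      b : Matrix n
      b x y = a x (θ y)
      twisted : Graphical b
      twisted = record
        { a-sym = λ x y → trans (a-sym x (θ y)) (trans (sym (θ-auto (θ y) x)) (cong (λ z → a z (θ x)) (θ-inv y)))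
        ; a-irr = ~̸θ
        }
      expand : ∀ p q r s → (p + q) * (r + s) ≡ (p * r + q * s) + (p * s + q * r)
      expand = solve-∀
      same : E a (λ x y → h′ x * h′ y) ≡ + 2 * upper hh
      same = trans (sym (E-θ λ x y → h′ x * h′ y)) (trans (E-cong a λ x y → cong₂ _*_ (h′-θ x) (h′-θ y))
        (E-upper hh λ x y → ℤ.*-comm (h x) (h y)))
      cross : E a (λ x y → h x * h′ y) ≡ + 2 * Graphical.upper twisted hh
      cross = trans (∑-cong λ x → trans (sym (∑-θ λ y → ⟦ a x y ⟧ * (h x * h′ y)))
          (∑-cong λ y → cong (λ z → ⟦ a x (θ y) ⟧ * (h x * z)) (h′-θ y)))
        (Graphical.E-upper twisted hh λ x y → ℤ.*-comm (h x) (h y))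
      links : link a X X ≡ + 4 * upper hh + + 4 * Graphical.upper twisted hh
      links = trans (E-cong a λ x y → trans (cong₂ _*_ (h+h′ x) (h+h′ y)) (expand (h x) (h′ x) (h y) (h′ y)))
        (trans (E-+ a (λ x y → h x * h y + h′ x * h′ y) (λ x y → h x * h′ y + h′ x * h y))
        (trans (cong₂ _+_ (E-+ a hh (λ x y → h′ x * h′ y)) (E-+ a (λ x y → h x * h′ y) (λ x y → h′ x * h y)))
        (trans (cong₂ _+_ (cong₂ _+_ (E-upper hh λ x y → ℤ.*-comm (h x) (h y)) same)
           (cong₂ _+_ cross (trans (trans (E-cong a λ x y → ℤ.*-comm (h′ x) (h y)) (E-swap λ x y → h x * h′ y)) cross)))
        (fours (upper hh) (Graphical.upper twisted hh)))))
        where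
        fours : ∀ u v → (+ 2 * u + + 2 * u) + (+ 2 * v + + 2 * v) ≡ + 4 * u + + 4 * v
        fours = solve-∀

-- Comparison with the definitions of sparsity and tightness

-- The working form of `CiTight`: vertex sets stand for the subgraphs they induce, and once no
-- vertex is fixed, a fixed edge can only join x to `θ x`.
record Ci (a : Matrix n) (θ : Fin n → Fin n) : Set where
  field
    involutive : Involutive a θ
    sparse : ∀ X {v} → T (X v) → 0ℤ ≤ F a X
    tight : F a full ≡ 0ℤ

  open Involutive involutive public

module _ (G : Graph n) where
  open Graph G

  graphical : Graphical adj
  graphical = record { a-sym = adj-sym ; a-irr = λ x e → subst T (irrefl x) e }

  open Graphical graphical using (upper)

  ∣E∣-upper : + ∣E G ∣ ≡ upper λ _ _ → 1ℤ
  ∣E∣-upper = trans (cast λ i → ΣN λ j → bit i j) (∑-cong λ i → trans (cast (bit i)) (∑-cong λ j → lem (does (i <? j) ∧ adj i j)))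
    where
    open import Algebra.Properties.CommutativeMonoid.Sum ℕ.+-0-commutativeMonoid using () renaming (sum to ΣN)
    bit : Fin n → Fin n → ℕ
    bit i j = if does (i <? j) ∧ adj i j then 1 else 0
    lem : ∀ b → + (if b then 1 else 0) ≡ ⟦ b ⟧ * 1ℤ
    lem true = refl
    lem false = refl
    opaque
      unfolding ∑

      cast : ∀ {n} (f : Fin n → ℕ) → + (ΣN f) ≡ ∑ (λ i → + (f i))
      cast {zero} f = refl
      cast {suc n} f = trans (ℤ.pos-+ (f zero) (ΣN (f ∘ suc))) (cong (λ z → + f zero + z) (cast (f ∘ suc)))

  2∣E∣ : + 2 * + ∣E G ∣ ≡ E adj λ _ _ → 1ℤ
  2∣E∣ = trans (cong (+ 2 *_) ∣E∣-upper) (sym (Graphical.E-upper graphical (λ _ _ → 1ℤ) λ _ _ → refl))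

∣∣-lookup : (S : Subset n) → + ∣ S ∣ ≡ ∣ lookup S ∣ₛ
∣∣-lookup {n} S = step S
  where
  opaque
    unfolding ∑

    step : ∀ {n} (S : Subset n) → + ∣ S ∣ ≡ ∣ lookup S ∣ₛ
    step Data.Vec.Base.[] = refl
    step (true Data.Vec.Base.∷ S) = trans (ℤ.pos-+ 1 ∣ S ∣) (cong (λ z → 1ℤ + z) (step S))
    step (false Data.Vec.Base.∷ S) = trans (step S) (sym (ℤ.+-identityˡ _))

∈⇒T : ∀ {S : Subset n} {x} → x Subset.∈ S → T (lookup S x)
∈⇒T h = subst T (sym ([]=⇒lookup h)) tt

T⇒∈ : ∀ {S : Subset n} {x} → T (lookup S x) → x Subset.∈ S
T⇒∈ {S = S} {x} h = lookup⇒[]= x S (T-true h)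
  where
  T-true : ∀ {b} → T b → b ≡ true
  T-true {true} _ = refl

∣tabulate∣ : (X : Sub n) → + ∣ tabulate X ∣ ≡ ∣ X ∣ₛ
∣tabulate∣ X = trans (∣∣-lookup (tabulate X)) (∑-cong λ x → cong ⟦_⟧ (lookup∘tabulate X x))

twice : ∀ e s → + 4 * + s - + 4 - + 2 * + e ≡ + 2 * (+ (2 ℕ.* s) - + (e ℕ.+ 2))
twice e s = trans (lem (+ e) (+ s)) (cong₂ (λ u v → + 2 * (u - v)) (sym (ℤ.pos-* 2 s)) (sym (ℤ.pos-+ e 2)))
  where
  lem : ∀ e s → + 4 * s - + 4 - + 2 * e ≡ + 2 * (+ 2 * s - (e + + 2))
  lem = solve-∀

twice-≤ : ∀ e s → e ℕ.+ 2 ℕ.≤ 2 ℕ.* s → 0ℤ ≤ + 4 * + s - + 4 - + 2 * + e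
twice-≤ e s h = 0≤-by _ (0≤* {+ 2} (+≤+ z≤n) (0≤- (+≤+ h))) (twice e s)

twice-≥ : ∀ e s → 0ℤ ≤ + 4 * + s - + 4 - + 2 * + e → e ℕ.+ 2 ℕ.≤ 2 ℕ.* s
twice-≥ e s h = ℤ.drop‿+≤+ (ℤ.0≤i-j⇒j≤i (ℤ.*-cancelˡ-≤-pos 0ℤ (+ (2 ℕ.* s) - + (e ℕ.+ 2)) (+ 2) (subst (0ℤ ≤_) (twice e s) h)))

twice-≡ : ∀ e s → + 4 * + s - + 4 - + 2 * + e ≡ 0ℤ → e ℕ.+ 2 ≡ 2 ℕ.* s
twice-≡ e s h = ℤ.+-injective (sym (ℤ.i-j≡0⇒i≡j (+ (2 ℕ.* s)) (+ (e ℕ.+ 2))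
  (ℤ.*-cancelˡ-≡ (+ 2) (+ (2 ℕ.* s) - + (e ℕ.+ 2)) 0ℤ (trans (sym (twice e s)) h))))

≡-twice : ∀ e s → e ℕ.+ 2 ≡ 2 ℕ.* s → + 4 * + s - + 4 - + 2 * + e ≡ 0ℤ
≡-twice e s h = trans (twice e s) (trans (cong (λ z → + 2 * (+ z - + (e ℕ.+ 2))) (sym h)) (cong (+ 2 *_) (ℤ.+-inverseʳ (+ (e ℕ.+ 2)))))

opaque
  unfolding F

  F-count : ∀ {a : Matrix n} {X : Sub n} {s l} → ∣ X ∣ₛ ≡ + s → link a X X ≡ l → F a X ≡ + 4 * + s - + 4 - l
  F-count p q = cong₂ (λ u v → + 4 * u - + 4 - v) p q

link-full : (a : Matrix n) → link a full full ≡ E a λ _ _ → 1ℤ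
link-full a = refl

module _ (G : Graph n) where
  open Graph G

  private
    F-full : F adj full ≡ + 4 * + n - + 4 - + 2 * + ∣E G ∣
    F-full = F-count {a = adj} {full} (∣full∣ n) (trans (link-full adj) (sym (2∣E∣ G)))

  Sparse⇒ : Sparse G → ∀ X {v} → T (X v) → 0ℤ ≤ F adj X
  Sparse⇒ sp X {v} v∈X = subst (0ℤ ≤_) (sym (F-count {a = adj} {X} (sym (∣tabulate∣ X)) links))
      (twice-≤ ∣E H ∣ ∣ tabulate X ∣ (sp S (v , in-X v∈X)))
    where
    in-X : ∀ {x} → T (X x) → x Subset.∈ tabulate X
    in-X {x} h = T⇒∈ (subst T (sym (lookup∘tabulate X x)) h)
    H : Graph n
    H = record
      { adj = λ x y → adj x y ∧ (X x ∧ X y)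
      ; adj-sym = λ x y → cong₂ _∧_ (adj-sym x y) (∧-comm (X x) (X y))
      ; irrefl = λ x → cong (λ b → b ∧ (X x ∧ X x)) (irrefl x)
      }
    S : Subgraph G
    S = record { V′ = tabulate X ; E′ = H ; E′⊆E = ∧-e₁ ; ends = λ {x} {y} e →
      in-X (∧-e₁ (∧-e₂ {adj x y} e)) , in-X (∧-e₂ {X x} (∧-e₂ {adj x y} e)) }
    links : link adj X X ≡ + 2 * + ∣E H ∣
    links = sym (trans (2∣E∣ H) (∑-cong λ x → ∑-cong λ y → bit (adj x y) (X x) (X y)))
      where
      bit : ∀ p q r → ⟦ p ∧ (q ∧ r) ⟧ * 1ℤ ≡ ⟦ p ⟧ * (⟦ q ⟧ * ⟦ r ⟧)
      bit = from-yes (∀Bool? λ p → ∀Bool? λ q → ∀Bool? λ r → ⟦ p ∧ (q ∧ r) ⟧ * 1ℤ ℤ.≟ ⟦ p ⟧ * (⟦ q ⟧ * ⟦ r ⟧))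

  -- Among the subgraphs on a given vertex set the induced one has the most edges, and `F` charges
  -- exactly those.
  ⇒Sparse : (∀ X {v} → T (X v) → 0ℤ ≤ F adj X) → Sparse G
  ⇒Sparse sp S (v , v∈V) = twice-≥ ∣E E′ ∣ ∣ V′ ∣ (0≤-by _ (0≤+ (sp X (∈⇒T v∈V)) (0≤- links))
      (trans (lem (+ ∣ V′ ∣) (link adj X X) (+ ∣E E′ ∣)) (cong (λ z → z + (link adj X X - + 2 * + ∣E E′ ∣)) (sym (F-count {a = adj} {X} (sym (∣∣-lookup V′)) refl)))))
    where
    open Subgraph S
    X = lookup V′
    lem : ∀ s l e → + 4 * s - + 4 - + 2 * e ≡ (+ 4 * s - + 4 - l) + (l - + 2 * e)
    lem = solve-∀
    links : + 2 * + ∣E E′ ∣ ≤ link adj X X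
    links = ≤-trans (≤-reflexive (2∣E∣ E′)) (∑-mono λ x → ∑-mono λ y → step x y)
      where
      step : ∀ x y → ⟦ Graph.adj E′ x y ⟧ * 1ℤ ≤ ⟦ adj x y ⟧ * (⟦ X x ⟧ * ⟦ X y ⟧)
      step x y = ind-≤ (ind-× (ind-Bool (Graph.adj E′ x y)) (inj₁ (refl , tt)))
        (ind-× (ind-Bool (adj x y)) (ind-× (ind-Bool (X x)) (ind-Bool (X y))))
        λ (e , _) → E′⊆E e , ∈⇒T (proj₁ (ends e)) , ∈⇒T (proj₂ (ends e))

  Tight⇒ : Tight G → F adj full ≡ 0ℤ
  Tight⇒ (_ , h) = trans F-full (≡-twice ∣E G ∣ n h)

  ⇒Tight : F adj full ≡ 0ℤ → ∣E G ∣ ℕ.+ 2 ≡ 2 ℕ.* n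
  ⇒Tight h = twice-≡ ∣E G ∣ n (trans (sym F-full) h)

module _ (G : ℤ₂Graph) where
  open ℤ₂Graph G

  CiTight⇒Ci : CiTight G → Ci adj θ
  CiTight⇒Ci (t , fv , fe) = record
    { involutive = record
      { graphical = graphical graph
      ; θ-inv = θ-inv
      ; θ-auto = θ-auto
      ; θ-free = fv
      ; ~̸θ = λ x e → fe x (θ x) e (inj₂ (refl , θ-inv x))
      }
    ; sparse = Sparse⇒ graph (proj₁ t)
    ; tight = Tight⇒ graph t
    }

  Ci⇒CiTight : Ci adj θ → CiTight G
  Ci⇒CiTight c = (⇒Sparse graph sparse , ⇒Tight graph tight) , θ-free , λ where
      u v e (inj₁ (h , _)) → θ-free u h
      u v e (inj₂ (h , _)) → ~̸θ u (subst (λ z → T (adj u z)) (sym h) e)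
    where open Ci c using (sparse; tight; θ-free; ~̸θ)

-- Decompositions of the vertex set

opaque
  unfolding F

  F-def : ∀ (a : Matrix n) X → F a X ≡ + 4 * ∣ X ∣ₛ - + 4 - link a X X
  F-def a X = refl

-- Every graph lives on some `Fin`, so a subset must be relabelled before it can carry one of the
-- smaller graphs of the induction.
record Enumeration (p : Sub n) : Set where
  field
    size : ℕ
    elem : Fin size → Fin n
    elem-∈ : ∀ i → T (p (elem i))
    index : ∀ x → T (p x) → ∃ λ i → elem i ≡ x
    elem-injective : ∀ {i j} → elem i ≡ elem j → i ≡ j

enumerate : (p : Sub n) → Enumeration p
enumerate {zero} p = record
  { size = 0 ; elem = λ () ; elem-∈ = λ () ; index = λ () ; elem-injective = λ { {()} } }
enumerate {suc n} p = cons (p zero) refl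
  where
  open Enumeration (enumerate (p ∘ suc))
  cons : ∀ b → p zero ≡ b → Enumeration p
  cons true e = record
    { size = suc size
    ; elem = λ { zero → zero ; (suc i) → suc (elem i) }
    ; elem-∈ = λ { zero → subst T (sym e) tt ; (suc i) → elem-∈ i }
    ; index = λ { zero _ → zero , refl ; (suc x) h → case index x h of λ { (i , e) → suc i , cong suc e } }
    ; elem-injective = λ { {zero} {zero} _ → refl ; {suc i} {suc j} e → cong suc (elem-injective (suc-injective e)) }
    }
  cons false e = record
    { size = size
    ; elem = suc ∘ elem
    ; elem-∈ = elem-∈
    ; index = λ { zero h → ⊥-elim (subst T e h) ; (suc x) h → case index x h of λ { (i , e) → i , cong suc e } }
    ; elem-injective = elem-injective ∘ suc-injective
    }

module _ (p : Sub n) (j : B → Fin n) (j-injective : ∀ {b c} → j b ≡ j c → b ≡ c)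
  (j-∉ : ∀ b → ¬ T (p (j b))) (cover : ∀ x → ¬ T (p x) → ∃ λ b → j b ≡ x) where

  open Enumeration (enumerate p)

  split : Fin n ↔ (Fin size ⊎ B)
  split = mk↔ₛ′ (λ x → to x (T? (p x))) from to∘from (λ x → from∘to x (T? (p x)))
    where
    to : ∀ x → Dec (T (p x)) → Fin size ⊎ B
    to x (yes h) = inj₁ (proj₁ (index x h))
    to x (no h) = inj₂ (proj₁ (cover x h))
    from : Fin size ⊎ B → Fin n
    from (inj₁ i) = elem i
    from (inj₂ b) = j b
    from∘to : ∀ x d → from (to x d) ≡ x
    from∘to x (yes h) = proj₂ (index x h)
    from∘to x (no h) = proj₂ (cover x h)
    to∘from : ∀ y → to (from y) (T? (p (from y))) ≡ y
    to∘from (inj₁ i) with T? (p (elem i))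
    ... | yes h = cong inj₁ (elem-injective (proj₂ (index (elem i) h)))
    ... | no h = contradiction (elem-∈ i) h
    to∘from (inj₂ b) with T? (p (j b))
    ... | yes h = contradiction h (j-∉ b)
    ... | no h = cong inj₂ (j-injective (proj₂ (cover (j b) h)))

∑-split : (i : Fin n ↔ (Fin m ⊎ A)) (j : Fin k ↔ A) (f : Fin n → ℤ) →
          ∑ f ≡ ∑ (f ∘ Inverse.from i ∘ inj₁) + ∑ (f ∘ Inverse.from i ∘ inj₂ ∘ Inverse.to j)
∑-split i j f = trans (∑-cong λ x → cong f (sym (Inverse.strictlyInverseʳ i x))) (∑-⊎ i j (f ∘ Inverse.from i))

_↾_ : Matrix n → (Fin m → Fin n) → Matrix m
(h ↾ ι) x y = h (ι x) (ι y)

module Parts (i : Fin n ↔ (Fin m ⊎ A)) (j : Fin k ↔ A) {h : Matrix n} (h-sym : ∀ x y → h x y ≡ h y x) where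

  ι : Fin m → Fin n
  ι x = Inverse.from i (inj₁ x)

  σ : Fin k → Fin n
  σ l = Inverse.from i (inj₂ (Inverse.to j l))

  cross : Sub n → ℤ
  cross Z = ∑ λ l → ∑ λ x → ⟦ h (σ l) (ι x) ⟧ * (⟦ Z (σ l) ⟧ * ⟦ Z (ι x) ⟧)

  -- The edge count splits into four blocks, of which the two mixed ones agree by symmetry. Both
  -- parts carry a constant -4 where the whole has only one, hence the `+ 4`.
  F-parts : ∀ Z → F h Z ≡ F (h ↾ ι) (Z ∘ ι) + F (h ↾ σ) (Z ∘ σ) + + 4 - + 2 * cross Z
  F-parts Z = trans (F-def h Z) (trans (cong₂ (λ s l → + 4 * s - + 4 - l) (∑-split i j λ x → ⟦ Z x ⟧) links)
      (trans (alg ∣ Z ∘ ι ∣ₛ ∣ Z ∘ σ ∣ₛ (link (h ↾ ι) (Z ∘ ι) (Z ∘ ι)) (link (h ↾ σ) (Z ∘ σ) (Z ∘ σ)) (cross Z))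
        (sym (cong₂ (λ u v → u + v + + 4 - + 2 * cross Z) (F-def (h ↾ ι) (Z ∘ ι)) (F-def (h ↾ σ) (Z ∘ σ))))))
    where
    u : Fin n → Fin n → ℤ
    u x y = ⟦ h x y ⟧ * (⟦ Z x ⟧ * ⟦ Z y ⟧)
    u-sym : ∀ x y → u x y ≡ u y x
    u-sym x y = cong₂ _*_ (cong ⟦_⟧ (h-sym x y)) (ℤ.*-comm ⟦ Z x ⟧ ⟦ Z y ⟧)
    rows : ∀ {k} (φ : Fin k → Fin n) → ∑ (λ l → ∑ (u (φ l))) ≡ ∑ (λ l → ∑ (u (φ l) ∘ ι)) + ∑ (λ l → ∑ (u (φ l) ∘ σ))
    rows φ = trans (∑-cong λ l → ∑-split i j (u (φ l))) (∑-+ (λ l → ∑ (u (φ l) ∘ ι)) (λ l → ∑ (u (φ l) ∘ σ)))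
    links : link h Z Z ≡ (link (h ↾ ι) (Z ∘ ι) (Z ∘ ι) + cross Z) + (cross Z + link (h ↾ σ) (Z ∘ σ) (Z ∘ σ))
    links = trans (∑-split i j λ x → ∑ (u x)) (cong₂ _+_
      (trans (rows ι) (cong (λ z → link (h ↾ ι) (Z ∘ ι) (Z ∘ ι) + z) (trans (∑-swap λ x l → u (ι x) (σ l)) (∑-cong λ l → ∑-cong λ x → u-sym (ι x) (σ l)))))
      (rows σ))
    alg : ∀ s t k l j → + 4 * (s + t) - + 4 - (k + j + (j + l)) ≡ (+ 4 * s - + 4 - k) + (+ 4 * t - + 4 - l) + + 4 - + 2 * j
    alg = solve-∀

  F-outside : ∀ Z → (∀ l → Z (σ l) ≡ false) → F h Z ≡ F (h ↾ ι) (Z ∘ ι)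
  F-outside Z none = trans (F-parts Z) (trans (cong₂ (λ u v → F (h ↾ ι) (Z ∘ ι) + u + + 4 - + 2 * v)
      (trans (F-cong (h ↾ σ) none) (F-∅ {a = h ↾ σ}))
      (trans (∑-cong λ l → trans (∑-cong λ x → trans (cong (λ b → ⟦ h (σ l) (ι x) ⟧ * (⟦ b ⟧ * ⟦ Z (ι x) ⟧)) (none l)) (ℤ.*-zeroʳ ⟦ h (σ l) (ι x) ⟧)) (∑-0 m)) (∑-0 k)))
    (alg (F (h ↾ ι) (Z ∘ ι))))
    where
    alg : ∀ f → f + - + 4 + + 4 - + 2 * 0ℤ ≡ f
    alg = solve-∀

module OnePair {h : Matrix n} (gr : Graphical h) (i : Fin n ↔ (Fin m ⊎ (Fin 1 × Bool))) where

  open Graphical gr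
  open Parts i (pairs↔ 1) {h} a-sym public

  new-vertex : Fin 1 × Bool → Fin n
  new-vertex b = Inverse.from i (inj₂ b)

  s s′ : Fin n
  s = new-vertex (zero , false)
  s′ = new-vertex (zero , true)

  opaque
    unfolding ∑

    ∑-two : (f : Fin 1 × Bool → ℤ) → ∑ (f ∘ Inverse.to (pairs↔ 1)) ≡ f (zero , false) + f (zero , true)
    ∑-two f = trans (∑-pairs 1 f) (cong₂ _+_ (ℤ.+-identityʳ (f (zero , false))) (ℤ.+-identityʳ (f (zero , true))))

  ∑-one : (f : Fin n → ℤ) → ∑ f ≡ ∑ (f ∘ ι) + (f s + f s′)
  ∑-one f = trans (∑-split i (pairs↔ 1) f) (cong (λ z → ∑ (f ∘ ι) + z) (∑-two (f ∘ new-vertex)))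

  row : Fin n → Sub m → ℤ
  row v X = ∑ λ x → ⟦ h v (ι x) ⟧ * ⟦ X x ⟧

  -- Each new vertex in Z brings 4 for itself and loses 2 for every neighbour in Z. With two
  -- neighbours it costs nothing; with three it costs 2, which an operation has to win back by
  -- deleting edges.
  F-pair : ¬ T (h s s′) → ∀ Z → F h Z ≡ F (h ↾ ι) (Z ∘ ι)
    + ⟦ Z s ⟧ * (+ 4 - + 2 * row s (Z ∘ ι)) + ⟦ Z s′ ⟧ * (+ 4 - + 2 * row s′ (Z ∘ ι))
  F-pair s≁s′ Z = trans (F-parts Z) (trans (cong₂ (λ u v → F (h ↾ ι) (Z ∘ ι) + u + + 4 - + 2 * v) fresh (trans (∑-two λ b → ∑ λ x → ⟦ h (new-vertex b) (ι x) ⟧ * (⟦ Z (new-vertex b) ⟧ * ⟦ Z (ι x) ⟧)) (cong₂ _+_ (rows s) (rows s′))))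
      (alg (F (h ↾ ι) (Z ∘ ι)) ⟦ Z s ⟧ ⟦ Z s′ ⟧ (row s (Z ∘ ι)) (row s′ (Z ∘ ι))))
    where
    isolated : ∀ b b′ → ¬ T (h (new-vertex b) (new-vertex b′))
    isolated (zero , false) (zero , false) = a-irr s
    isolated (zero , false) (zero , true) = s≁s′
    isolated (zero , true) (zero , false) = s≁s′ ∘ ~-sym
    isolated (zero , true) (zero , true) = a-irr s′
    fresh : F (h ↾ σ) (Z ∘ σ) ≡ + 4 * (⟦ Z s ⟧ + ⟦ Z s′ ⟧) - + 4 - 0ℤ
    fresh = trans (F-def (h ↾ σ) (Z ∘ σ)) (cong₂ (λ u v → + 4 * u - + 4 - v) (∑-two λ b → ⟦ Z (new-vertex b) ⟧)
      (trans (∑-cong λ l → trans (∑-cong λ l′ → cong (_* (⟦ Z (σ l) ⟧ * ⟦ Z (σ l′) ⟧)) (⟦⟧-false (isolated (Inverse.to (pairs↔ 1) l) (Inverse.to (pairs↔ 1) l′)))) (∑-0 2)) (∑-0 2)))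
    rows : ∀ v → ∑ (λ x → ⟦ h v (ι x) ⟧ * (⟦ Z v ⟧ * ⟦ Z (ι x) ⟧)) ≡ ⟦ Z v ⟧ * row v (Z ∘ ι)
    rows v = trans (∑-cong λ x → assoc ⟦ h v (ι x) ⟧ ⟦ Z v ⟧ ⟦ Z (ι x) ⟧) (∑-* ⟦ Z v ⟧ λ x → ⟦ h v (ι x) ⟧ * ⟦ Z (ι x) ⟧)
      where
      assoc : ∀ a b c → a * (b * c) ≡ b * (a * c)
      assoc = solve-∀
    alg : ∀ f p q d e → f + (+ 4 * (p + q) - + 4 - 0ℤ) + + 4 - + 2 * (p * d + q * e) ≡ f + p * (+ 4 - + 2 * d) + q * (+ 4 - + 2 * e)
    alg = solve-∀

-- The edges joining p to M and their images under θ.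
module Stars {n} {θ : Fin n → Fin n} (θ-inv : ∀ x → θ (θ x) ≡ x) (p : Fin n) (M : Fin n → Set) where

  Star : Fin n → Fin n → Set
  Star x y = ((x ≡ p × M y) ⊎ (y ≡ p × M x)) ⊎ ((x ≡ θ p × M (θ y)) ⊎ (y ≡ θ p × M (θ x)))

  Star-sym : ∀ {x y} → Star x y → Star y x
  Star-sym = Sum.map Sum.swap Sum.swap

  Star-θ : ∀ {x y} → Star x y → Star (θ x) (θ y)
  Star-θ = [ inj₂ ∘ Sum.map (λ (e , h) → cong θ e , M-θθ h) (λ (e , h) → cong θ e , M-θθ h)
           , inj₁ ∘ Sum.map (λ { (refl , h) → θ-inv p , h }) (λ { (refl , h) → θ-inv p , h }) ]′
    where
    M-θθ : ∀ {x} → M x → M (θ (θ x))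
    M-θθ {x} = subst M (sym (θ-inv x))

  Star-θ⁻ : ∀ {x y} → Star (θ x) (θ y) → Star x y
  Star-θ⁻ {x} {y} h = subst₂ Star (θ-inv x) (θ-inv y) (Star-θ h)

  module Adjoin {a : Matrix n} (a-sym : ∀ x y → a x y ≡ a y x) (a-θ : ∀ x y → a (θ x) (θ y) ≡ a x y) (M? : ∀ x → Dec (M x)) where

    star? : ∀ x y → Dec (Star x y)
    star? x y = (((x ≟ p) ×-dec M? y) ⊎-dec ((y ≟ p) ×-dec M? x)) ⊎-dec (((x ≟ θ p) ×-dec M? (θ y)) ⊎-dec ((y ≟ θ p) ×-dec M? (θ x)))

    b : Matrix n
    b x y = a x y ∨ does (star? x y)

    b-e : ∀ {x y} → T (b x y) → T (a x y) ⊎ Star x y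
    b-e {x} {y} h = Sum.map₂ (T-does (star? x y)) (∨-e h)

    b-i : ∀ {x y} → Star x y → T (b x y)
    b-i {x} {y} h = ∨-i₂ {a x y} (does-T (star? x y) h)

    b-sym : ∀ x y → b x y ≡ b y x
    b-sym x y = cong₂ _∨_ (a-sym x y) (T⇔≡ (does-T (star? y x) ∘ Star-sym ∘ T-does (star? x y)) (does-T (star? x y) ∘ Star-sym ∘ T-does (star? y x)))

    b-θ : ∀ x y → b (θ x) (θ y) ≡ b x y
    b-θ x y = cong₂ _∨_ (a-θ x y) (T⇔≡ (does-T (star? x y) ∘ Star-θ⁻ ∘ T-does (star? (θ x) (θ y))) (does-T (star? (θ x) (θ y)) ∘ Star-θ ∘ T-does (star? x y)))

    -- A loop among the star edges could arise only from p in `M`, and an edge joining a vertex to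
    -- its image only from `θ p` in `M`.
    module _ (M≢p : ∀ {x} → M x → x ≢ p) (θp∉M : ¬ M (θ p)) where

      b-irr : ∀ x → ¬ T (a x x) → ¬ T (b x x)
      b-irr x irr h = [ irr , irr′ ]′ (b-e h)
        where
        irr′ : ¬ Star x x
        irr′ (inj₁ (inj₁ (e , h))) = M≢p h e
        irr′ (inj₁ (inj₂ (e , h))) = M≢p h e
        irr′ (inj₂ (inj₁ (refl , h))) = M≢p h (θ-inv p)
        irr′ (inj₂ (inj₂ (refl , h))) = M≢p h (θ-inv p)

      b-opp : ∀ x → ¬ T (a x (θ x)) → ¬ T (b x (θ x))
      b-opp x opp h = [ opp , opp′ ]′ (b-e h)
        where
        opp′ : ¬ Star x (θ x)
        opp′ (inj₁ (inj₁ (refl , h))) = θp∉M h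
        opp′ (inj₁ (inj₂ (e , h))) = θp∉M (subst M (trans (sym (θ-inv x)) (cong θ e)) h)
        opp′ (inj₂ (inj₁ (refl , h))) = θp∉M (subst M (θ-inv (θ p)) h)
        opp′ (inj₂ (inj₂ (e , h))) = θp∉M (subst M e h)

-- Common to the operations that remove old edges: `M` collects the neighbours of p whose edge to p
-- disappears. It is one endpoint for a 1-extension, and the neighbours handed to new vertices when
-- p is split. `f` is the indicator of `M`.
module Moved {a : Matrix m} {θ : Fin m → Fin m} (inv : Involutive a θ) (p : Fin m) (M : Fin m → Set)
  (f : Fin m → ℤ) (f-ind : ∀ x → Ind (f x) (M x)) (M⇒~ : ∀ {x} → M x → T (a p x)) where

  open Involutive inv
  open Stars {θ = θ} θ-inv p M public

  Kept : Fin m → Fin m → Set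
  Kept x y = T (a x y) × ¬ Star x y

  Kept-sym : ∀ {x y} → Kept x y → Kept y x
  Kept-sym (e , h) = ~-sym e , h ∘ Star-sym

  Kept-θ⁻ : ∀ {x y} → Kept (θ x) (θ y) → Kept x y
  Kept-θ⁻ {x} {y} (e , h) = subst T (θ-auto x y) e , h ∘ Star-θ

  kept-away : ∀ {x y} → T (a x y) → x ≢ p × y ≢ p → x ≢ θ p × y ≢ θ p → Kept x y
  kept-away e (h , k) (h′ , k′) = e , [ [ h ∘ proj₁ , k ∘ proj₁ ]′ , [ h′ ∘ proj₁ , k′ ∘ proj₁ ]′ ]′

  kept-at : ∀ {x} → T (a p x) → ¬ M x → Kept p x
  kept-at e ∉M = e , λ
    { (inj₁ (inj₁ (_ , h))) → ∉M h ; (inj₁ (inj₂ (_ , h))) → a-irr p (M⇒~ h)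
    ; (inj₂ (inj₁ (h , _))) → θ-free p (sym h) ; (inj₂ (inj₂ (refl , _))) → ~̸θ p e }

  -- Up to reversal and θ, a kept edge either starts at p or avoids both p and `θ p`. These are the
  -- two shapes in which the splitting operations list their surviving edges.
  kept-rec : (S : Fin m → Fin m → Set) → (∀ {x y} → S x y → S y x) → (∀ {x y} → S (θ x) (θ y) → S x y) →
    (∀ {x} → T (a p x) → ¬ M x → S p x) → (∀ {x y} → T (a x y) → x ≢ p × y ≢ p → x ≢ θ p × y ≢ θ p → S x y) →
    ∀ {x y} → Kept x y → S x y
  kept-rec S S-sym S-θ at away {x} {y} (e , h) with x ≟ p | y ≟ p | x ≟ θ p | y ≟ θ p
  ... | yes refl | _ | _ | _ = at e λ m → h (inj₁ (inj₁ (refl , m)))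
  ... | no _ | yes refl | _ | _ = S-sym (at (~-sym e) λ m → h (inj₁ (inj₂ (refl , m))))
  ... | no _ | no _ | yes refl | _ = S-θ (subst (λ z → S z (θ y)) (sym (θ-inv p)) (at (subst (λ z → T (a z (θ y))) (θ-inv p) (~-θ e)) λ m → h (inj₂ (inj₁ (refl , m)))))
  ... | no _ | no _ | no _ | yes refl = S-sym (S-θ (subst (λ z → S z (θ x)) (sym (θ-inv p)) (at (subst (λ z → T (a z (θ x))) (θ-inv p) (~-θ (~-sym e))) λ m → h (inj₂ (inj₂ (refl , m))))))
  ... | no h₁ | no h₂ | no h₃ | no h₄ = away e (h₁ , h₂) (h₃ , h₄)

  star : Fin m → Fin m → ℤ
  star x y = (δ p x * f y + δ p y * f x) + (δ (θ p) x * f (θ y) + δ (θ p) y * f (θ x))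

  -- The four summands never overlap: members of `M` are neighbours of p, while p is neither
  -- adjacent to itself nor to `θ p` and is not fixed. So their sum is again 0 or 1.
  star-ind : ∀ x y → Ind (star x y) (Star x y)
  star-ind x y = ind-⊎
    (ind-⊎ (ind-× (ind-δ p x) (f-ind y)) (ind-× (ind-δ p y) (f-ind x)) λ { (refl , h) (refl , _) → a-irr _ (M⇒~ h) })
    (ind-⊎ (ind-× (ind-δ (θ p) x) (f-ind (θ y))) (ind-× (ind-δ (θ p) y) (f-ind (θ x)))
      λ { (refl , h) (refl , _) → a-irr p (subst (T ∘ a p) (θ-inv p) (M⇒~ h)) })
    λ { (inj₁ (refl , h)) (inj₁ (e , _)) → θ-free p (sym e)
      ; (inj₁ (refl , h)) (inj₂ (refl , _)) → ~̸θ p (M⇒~ h)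
      ; (inj₂ (refl , h)) (inj₁ (refl , _)) → ~̸θ p (M⇒~ h)
      ; (inj₂ (refl , h)) (inj₂ (e , _)) → θ-free p (sym e) }

  Star⇒~ : ∀ {x y} → Star x y → T (a x y)
  Star⇒~ (inj₁ (inj₁ (refl , h))) = M⇒~ h
  Star⇒~ (inj₁ (inj₂ (refl , h))) = ~-sym (M⇒~ h)
  Star⇒~ {x} {y} (inj₂ (inj₁ (refl , h))) = subst (T ∘ a x) (θ-inv y) (~-θ (M⇒~ h))
  Star⇒~ {x} {y} (inj₂ (inj₂ (refl , h))) = ~-sym (subst (T ∘ a y) (θ-inv x) (~-θ (M⇒~ h)))

  weight weight′ : Sub m → ℤ
  weight X = ∑ λ x → f x * ⟦ X x ⟧
  weight′ X = ∑ λ x → f (θ x) * ⟦ X x ⟧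

  module _ {b : Matrix m} (b⇔ : ∀ {x y} → T (b x y) ⇔ Kept x y) where

    opaque
      unfolding F

      -- A removed edge with both ends in X was counted as two ordered pairs, so its loss raises `F`
      -- by 2. The two summands belong to the star at p and to its image.
      F-star : ∀ X → F b X ≡ F a X + + 2 * (⟦ X p ⟧ * weight X) + + 2 * (⟦ X (θ p) ⟧ * weight′ X)
      F-star X = trans (alg₁ ∣ X ∣ₛ (link b X X) (link a X X) total links)
          (trans (cong (λ z → F a X + z) totals) (alg₂ (F a X) (⟦ X p ⟧ * weight X) (⟦ X (θ p) ⟧ * weight′ X)))
        where
        w : Fin m → Fin m → ℤ
        w x y = ⟦ X x ⟧ * ⟦ X y ⟧
        total : ℤ
        total = ∑ λ x → ∑ λ y → star x y * w x y
        entry : ∀ x y → ⟦ b x y ⟧ + star x y ≡ ⟦ a x y ⟧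
        entry x y = ind-unique
          (ind-⊎ (ind-map (Equivalence.to b⇔) (Equivalence.from b⇔) (ind-Bool (b x y))) (star-ind x y) (λ q g → proj₂ q g))
          (ind-map (λ e → dec e (star-ind x y)) [ proj₁ , Star⇒~ ]′ (ind-Bool (a x y)))
          where
          dec : ∀ {z} → T (a x y) → Ind z (Star x y) → (T (a x y) × ¬ Star x y) ⊎ Star x y
          dec e (inj₁ (_ , g)) = inj₂ g
          dec e (inj₂ (_ , g)) = inj₁ (e , g)
        links : link b X X + total ≡ link a X X
        links = trans (sym (trans (∑-cong λ x → ∑-+ (λ y → ⟦ b x y ⟧ * w x y) (λ y → star x y * w x y))
            (∑-+ (λ x → ∑ λ y → ⟦ b x y ⟧ * w x y) (λ x → ∑ λ y → star x y * w x y))))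
          (∑-cong λ x → ∑-cong λ y → trans (sym (ℤ.*-distribʳ-+ (w x y) ⟦ b x y ⟧ (star x y))) (cong (_* w x y) (entry x y)))
        alg₁ : ∀ s l k t → l + t ≡ k → + 4 * s - + 4 - l ≡ (+ 4 * s - + 4 - k) + t
        alg₁ s l k t refl = lem s l t
          where
          lem : ∀ s l t → + 4 * s - + 4 - l ≡ (+ 4 * s - + 4 - (l + t)) + t
          lem = solve-∀
        alg₂ : ∀ f p q → f + ((p + p) + (q + q)) ≡ f + + 2 * p + + 2 * q
        alg₂ = solve-∀
        part : ∀ q (g : Fin m → ℤ) → ∑ (λ x → ∑ λ y → δ q x * g y * w x y) ≡ ⟦ X q ⟧ * ∑ λ x → g x * ⟦ X x ⟧
        part q g = trans (∑-cong λ x → trans (∑-cong λ y → lem (δ q x) (g y) ⟦ X x ⟧ ⟦ X y ⟧) (∑-* (δ q x * ⟦ X x ⟧) λ y → g y * ⟦ X y ⟧))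
          (trans (∑-cong λ x → ℤ.*-assoc (δ q x) ⟦ X x ⟧ (∑ λ y → g y * ⟦ X y ⟧)) (∑-δ q λ x → ⟦ X x ⟧ * ∑ λ y → g y * ⟦ X y ⟧))
          where
          lem : ∀ d g u v → d * g * (u * v) ≡ d * u * (g * v)
          lem = solve-∀
        part′ : ∀ q (g : Fin m → ℤ) → ∑ (λ x → ∑ λ y → δ q y * g x * w x y) ≡ ⟦ X q ⟧ * ∑ λ x → g x * ⟦ X x ⟧
        part′ q g = trans (∑-swap λ x y → δ q y * g x * w x y)
          (trans (∑-cong λ y → ∑-cong λ x → cong (δ q y * g x *_) (ℤ.*-comm ⟦ X x ⟧ ⟦ X y ⟧)) (part q g))
        totals : total ≡ (⟦ X p ⟧ * weight X + ⟦ X p ⟧ * weight X) + (⟦ X (θ p) ⟧ * weight′ X + ⟦ X (θ p) ⟧ * weight′ X)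
        totals = trans (∑-cong λ x → trans (∑-cong λ y → expand (t₁ x y) (t₂ x y) (t₃ x y) (t₄ x y) (w x y))
              (plus4 (λ y → t₁ x y * w x y) (λ y → t₂ x y * w x y) (λ y → t₃ x y * w x y) (λ y → t₄ x y * w x y)))
            (trans (plus4 (λ x → ∑ λ y → t₁ x y * w x y) (λ x → ∑ λ y → t₂ x y * w x y)
                          (λ x → ∑ λ y → t₃ x y * w x y) (λ x → ∑ λ y → t₄ x y * w x y))
            (cong₂ _+_ (cong₂ _+_ (part p f) (part′ p f)) (cong₂ _+_ (part (θ p) (f ∘ θ)) (part′ (θ p) (f ∘ θ)))))
          where
          t₁ t₂ t₃ t₄ : Fin m → Fin m → ℤ
          t₁ x y = δ p x * f y
          t₂ x y = δ p y * f x
          t₃ x y = δ (θ p) x * f (θ y)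
          t₄ x y = δ (θ p) y * f (θ x)
          expand : ∀ p q r s w → ((p + q) + (r + s)) * w ≡ (p * w + q * w) + (r * w + s * w)
          expand = solve-∀
          plus4 : ∀ (p q r s : Fin m → ℤ) → ∑ (λ x → (p x + q x) + (r x + s x)) ≡ (∑ p + ∑ q) + (∑ r + ∑ s)
          plus4 p q r s = trans (∑-+ (λ x → p x + q x) (λ x → r x + s x)) (cong₂ _+_ (∑-+ p q) (∑-+ r s))

-- Realisations of extensions

module _ {H : ℤ₂Graph} {P : Presentation} where
  open ℤ₂Graph H
  open Presentation P renaming (τ to τ₀)

  realise-by : (i : Fin order ↔ Vertex) → (∀ p → θ (Inverse.from i p) ≡ Inverse.from i (τ₀ p)) →
    (∀ p q → Inverse.from i p ~ Inverse.from i q ⇔ Edge p q) → H Realises P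
  realise-by i θ-from ~⇔Edge = record
    { bijection = i
    ; equivariant = λ v → trans (cong (to ∘ θ) (sym (strictlyInverseʳ v))) (trans (cong to (θ-from (to v))) (strictlyInverseˡ (τ₀ (to v))))
    ; edges = λ u v → subst₂ (λ u′ v′ → u′ ~ v′ ⇔ Edge (to u) (to v)) (strictlyInverseʳ u) (strictlyInverseʳ v) (~⇔Edge (to u) (to v))
    }
    where open Inverse i

module _ (G : ℤ₂Graph) {k : ℕ} where
  open ℤ₂Graph G

  τ : Extended G k → Extended G k
  τ = Sum.map θ (map₂ not)

  τ-inv : ∀ P → τ (τ P) ≡ P
  τ-inv (inj₁ x) = cong inj₁ (θ-inv x)
  τ-inv (inj₂ (i , false)) = refl
  τ-inv (inj₂ (i , true)) = refl

module _ {G : ℤ₂Graph} {k : ℕ} {R : Extended G k → Extended G k → Set} where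

  edge-rec : (S : Extended G k → Extended G k → Set) → (∀ {P Q} → S P Q → S Q P) →
    (∀ {P Q} → S (τ G P) (τ G Q) → S P Q) → (∀ {P Q} → R P Q → S P Q) →
    ∀ {P Q} → Presentation.Edge (extend G k R) P Q → S P Q
  edge-rec S S-sym S-τ R⇒S (fwd (inj₁ r)) = R⇒S r
  edge-rec S S-sym S-τ R⇒S (fwd (inj₂ r)) = S-τ (R⇒S r)
  edge-rec S S-sym S-τ R⇒S (bwd (inj₁ r)) = S-sym (R⇒S r)
  edge-rec S S-sym S-τ R⇒S (bwd (inj₂ r)) = S-sym (S-τ (R⇒S r))

  edge-sym : ∀ {P Q} → Presentation.Edge (extend G k R) P Q → Presentation.Edge (extend G k R) Q P
  edge-sym (fwd r) = bwd r
  edge-sym (bwd r) = fwd r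

  edge-τ : ∀ {P Q} → Presentation.Edge (extend G k R) (τ G P) (τ G Q) → Presentation.Edge (extend G k R) P Q
  edge-τ (fwd (inj₁ r)) = fwd (inj₂ r)
  edge-τ {P} {Q} (fwd (inj₂ r)) = fwd (inj₁ (subst₂ R (τ-inv G P) (τ-inv G Q) r))
  edge-τ (bwd (inj₁ r)) = bwd (inj₂ r)
  edge-τ {P} {Q} (bwd (inj₂ r)) = bwd (inj₁ (subst₂ R (τ-inv G Q) (τ-inv G P) r))

module Realisation {H G : ℤ₂Graph} {k : ℕ} {R : Extended G k → Extended G k → Set}
  (r : H Realises extend G k R) where

  open _Realises_ r
  open Inverse bijection using (to; from; strictlyInverseˡ; strictlyInverseʳ)

  θ-from : ∀ P → ℤ₂Graph.θ H (from P) ≡ from (τ G P)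
  θ-from P = trans (sym (strictlyInverseʳ _)) (cong from (trans (equivariant (from P)) (cong (τ G) (strictlyInverseˡ P))))

  ~⇔Edge : ∀ P Q → T (ℤ₂Graph.adj H (from P) (from Q)) ⇔ Presentation.Edge (extend G k R) P Q
  ~⇔Edge P Q = subst₂ (λ P′ Q′ → T (ℤ₂Graph.adj H (from P) (from Q)) ⇔ Presentation.Edge (extend G k R) P′ Q′)
    (strictlyInverseˡ P) (strictlyInverseˡ Q) (edges (from P) (from Q))

  from-surjective : ∀ v → ∃ λ P → from P ≡ v
  from-surjective v = to v , strictlyInverseʳ v

  from-injective : ∀ {P Q} → from P ≡ from Q → P ≡ Q
  from-injective {P} {Q} e = trans (sym (strictlyInverseˡ P)) (trans (cong to e) (strictlyInverseˡ Q))

  realised-involutive : Involutive (ℤ₂Graph.adj G) (ℤ₂Graph.θ G) → (∀ {P} → ¬ R P (τ G P)) →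
    Involutive (ℤ₂Graph.adj H) (ℤ₂Graph.θ H)
  realised-involutive inv opp = record
    { graphical = graphical (ℤ₂Graph.graph H)
    ; θ-inv = ℤ₂Graph.θ-inv H
    ; θ-auto = ℤ₂Graph.θ-auto H
    ; θ-free = λ v e → case from-surjective v of λ { (P , refl) → τ-free P (from-injective (trans (sym (θ-from P)) e)) }
    ; ~̸θ = λ v e → case from-surjective v of λ { (P , refl) →
        no-opp (Equivalence.to (~⇔Edge P (τ G P)) (subst (λ z → T (ℤ₂Graph.adj H (from P) z)) (θ-from P) e)) refl }
    }
    where
    τ-free : ∀ P → τ G P ≢ P
    τ-free (inj₁ x) e = Involutive.θ-free inv x (inj₁-injective e)
    τ-free (inj₂ (i , false)) ()
    τ-free (inj₂ (i , true)) ()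
    no-opp : ∀ {P Q} → Presentation.Edge (extend G k R) P Q → Q ≢ τ G P
    no-opp = edge-rec {G = G} {k} {R} (λ P Q → Q ≢ τ G P)
      (λ {P} {Q} h e → h (trans (sym (τ-inv G Q)) (cong (τ G) (sym e))))
      (λ {P} {Q} h e → h (cong (τ G) e))
      (λ { r refl → opp r })

-- An extension by one pair of vertices, in terms of the surviving edges K and
-- the neighbourhood L of the new vertex.
module PairExtension (G : ℤ₂Graph) (K : Fin (ℤ₂Graph.order G) → Fin (ℤ₂Graph.order G) → Set)
  (L : Fin (ℤ₂Graph.order G) → Set) where
  open ℤ₂Graph G

  S : Extended G 1 → Extended G 1 → Set
  S (inj₁ x) (inj₁ y) = K x y
  S (inj₁ x) (inj₂ (_ , false)) = L x
  S (inj₁ x) (inj₂ (_ , true)) = L (θ x)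
  S (inj₂ (_ , false)) (inj₁ x) = L x
  S (inj₂ (_ , true)) (inj₁ x) = L (θ x)
  S (inj₂ _) (inj₂ _) = ⊥

  -- Identifies the presented edges with the explicit relation `S`. It serves both directions of the
  -- theorem: `realise` recognises a given graph as an extension, and `Forward` computes `F` in a
  -- given extension.
  record Spec (R : Extended G 1 → Extended G 1 → Set) : Set where
    field
      K-sym : ∀ {x y} → K x y → K y x
      K-θ : ∀ {x y} → K (θ x) (θ y) → K x y
      R⇒S : ∀ {P Q} → R P Q → S P Q
      K⇒Edge : ∀ {x y} → K x y → Presentation.Edge (extend G 1 R) (inj₁ x) (inj₁ y)
      L⇒R : ∀ {x} → L x → R (inj₂ (zero , false)) (inj₁ x)

    Edge⇒S : ∀ {P Q} → Presentation.Edge (extend G 1 R) P Q → S P Q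
    Edge⇒S = edge-rec {G = G} {1} {R} S (λ {P} {Q} → S-sym {P} {Q}) (λ {P} {Q} → S-τ {P} {Q}) R⇒S
      where
      S-sym : ∀ {P Q} → S P Q → S Q P
      S-sym {inj₁ x} {inj₁ y} = K-sym
      S-sym {inj₁ x} {inj₂ (_ , false)} h = h
      S-sym {inj₁ x} {inj₂ (_ , true)} h = h
      S-sym {inj₂ (_ , false)} {inj₁ y} h = h
      S-sym {inj₂ (_ , true)} {inj₁ y} h = h
      S-τ : ∀ {P Q} → S (τ G P) (τ G Q) → S P Q
      S-τ {inj₁ x} {inj₁ y} = K-θ
      S-τ {inj₁ x} {inj₂ (_ , false)} = subst L (θ-inv x)
      S-τ {inj₁ x} {inj₂ (_ , true)} h = h
      S-τ {inj₂ (_ , false)} {inj₁ y} = subst L (θ-inv y)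
      S-τ {inj₂ (_ , true)} {inj₁ y} h = h

    S⇒Edge : ∀ P Q → S P Q → Presentation.Edge (extend G 1 R) P Q
    S⇒Edge (inj₁ x) (inj₁ y) = K⇒Edge
    S⇒Edge (inj₁ x) (inj₂ (zero , false)) h = bwd (inj₁ (L⇒R h))
    S⇒Edge (inj₁ x) (inj₂ (zero , true)) h = bwd (inj₂ (L⇒R h))
    S⇒Edge (inj₂ (zero , false)) (inj₁ y) h = fwd (inj₁ (L⇒R h))
    S⇒Edge (inj₂ (zero , true)) (inj₁ y) h = fwd (inj₂ (L⇒R h))

    realise : (H : ℤ₂Graph) (i : Fin (ℤ₂Graph.order H) ↔ Extended G 1) →
      (∀ P → ℤ₂Graph.θ H (Inverse.from i P) ≡ Inverse.from i (τ G P)) →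
      (∀ x y → T (ℤ₂Graph.adj H (Inverse.from i (inj₁ x)) (Inverse.from i (inj₁ y))) ⇔ K x y) →
      (∀ x → T (ℤ₂Graph.adj H (Inverse.from i (inj₂ (zero , false))) (Inverse.from i (inj₁ x))) ⇔ L x) →
      ¬ T (ℤ₂Graph.adj H (Inverse.from i (inj₂ (zero , false))) (Inverse.from i (inj₂ (zero , true)))) →
      H Realises extend G 1 R
    realise H i θ-from KK LL s≁s′ = realise-by i θ-from λ P Q → mk⇔ (λ e → S⇒Edge P Q (⇒S P Q e)) (λ e → S⇒ P Q (Edge⇒S e))
      where
      open Inverse i using (from)
      h = ℤ₂Graph.adj H
      h-sym : ∀ {u v} → T (h u v) → T (h v u)
      h-sym {u} {v} = subst T (ℤ₂Graph.adj-sym H u v)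
      h-τ : ∀ {P Q} → T (h (from P) (from Q)) → T (h (from (τ G P)) (from (τ G Q)))
      h-τ {P} {Q} e = subst₂ (λ u v → T (h u v)) (θ-from P) (θ-from Q) (subst T (sym (ℤ₂Graph.θ-auto H (from P) (from Q))) e)
      irr : ∀ {u} → ¬ T (h u u)
      irr {u} = subst T (ℤ₂Graph.irrefl H u)
      new-old : ∀ b x → T (h (from (inj₂ (zero , b))) (from (inj₁ x))) → S (inj₂ (zero , b)) (inj₁ x)
      new-old false x e = Equivalence.to (LL x) e
      new-old true x e = Equivalence.to (LL (θ x)) (h-τ {inj₂ (zero , true)} {inj₁ x} e)
      old-new : ∀ b x → S (inj₂ (zero , b)) (inj₁ x) → T (h (from (inj₂ (zero , b))) (from (inj₁ x)))
      old-new false x l = Equivalence.from (LL x) l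
      old-new true x l = subst (λ z → T (h (from (inj₂ (zero , true))) (from (inj₁ z)))) (θ-inv x)
        (h-τ {inj₂ (zero , false)} {inj₁ (θ x)} (Equivalence.from (LL (θ x)) l))
      ⇒S : ∀ P Q → T (h (from P) (from Q)) → S P Q
      ⇒S (inj₁ x) (inj₁ y) e = Equivalence.to (KK x y) e
      ⇒S (inj₁ x) (inj₂ (zero , false)) e = new-old false x (h-sym e)
      ⇒S (inj₁ x) (inj₂ (zero , true)) e = new-old true x (h-sym e)
      ⇒S (inj₂ (zero , false)) (inj₁ y) e = new-old false y e
      ⇒S (inj₂ (zero , true)) (inj₁ y) e = new-old true y e
      ⇒S (inj₂ (zero , false)) (inj₂ (zero , false)) e = irr e
      ⇒S (inj₂ (zero , false)) (inj₂ (zero , true)) e = s≁s′ e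
      ⇒S (inj₂ (zero , true)) (inj₂ (zero , false)) e = s≁s′ (h-sym e)
      ⇒S (inj₂ (zero , true)) (inj₂ (zero , true)) e = irr e
      S⇒ : ∀ P Q → S P Q → T (h (from P) (from Q))
      S⇒ (inj₁ x) (inj₁ y) e = Equivalence.from (KK x y) e
      S⇒ (inj₁ x) (inj₂ (zero , false)) l = h-sym (old-new false x l)
      S⇒ (inj₁ x) (inj₂ (zero , true)) l = h-sym (old-new true x l)
      S⇒ (inj₂ (zero , false)) (inj₁ y) l = old-new false y l
      S⇒ (inj₂ (zero , true)) (inj₁ y) l = old-new true y l

    module Forward (c : Ci adj θ) (K⇒~ : ∀ {x y} → K x y → T (adj x y)) {H : ℤ₂Graph} (r : H Realises extend G 1 R) where
      open Realisation {H} {G} {1} {R} r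
      open _Realises_ r using (bijection)

      h = ℤ₂Graph.adj H

      H-involutive : Involutive h (ℤ₂Graph.θ H)
      H-involutive = realised-involutive (Ci.involutive c) (λ {P} r → opp P (R⇒S r))
        where
        opp : ∀ P → ¬ S P (τ G P)
        opp (inj₁ x) e = Ci.~̸θ c x (K⇒~ e)
        opp (inj₂ (_ , false)) ()
        opp (inj₂ (_ , true)) ()

      open OnePair (Involutive.graphical H-involutive) bijection public

      K⇔ : ∀ {x y} → T ((h ↾ ι) x y) ⇔ K x y
      K⇔ {x} {y} = mk⇔ (λ e → Edge⇒S (Equivalence.to (~⇔Edge (inj₁ x) (inj₁ y)) e))
        (λ e → Equivalence.from (~⇔Edge (inj₁ x) (inj₁ y)) (K⇒Edge e))

      module _ (g : Fin order → ℤ) (g-ind : ∀ x → Ind (g x) (L x)) where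

        row-s : ∀ X → row s X ≡ ∑ λ x → g x * ⟦ X x ⟧
        row-s X = ∑-cong λ x → cong (_* ⟦ X x ⟧) (ind-unique (ind-map
          (λ e → Edge⇒S {inj₂ (zero , false)} {inj₁ x} (Equivalence.to (~⇔Edge (inj₂ (zero , false)) (inj₁ x)) e))
          (λ l → Equivalence.from (~⇔Edge (inj₂ (zero , false)) (inj₁ x)) (S⇒Edge (inj₂ (zero , false)) (inj₁ x) l))
          (ind-Bool (h s (ι x)))) (g-ind x))

        row-s′ : ∀ X → row s′ X ≡ ∑ λ x → g x * ⟦ X (θ x) ⟧
        row-s′ X = trans (∑-cong λ x → cong (_* ⟦ X x ⟧) (ind-unique (ind-map
          (λ e → Edge⇒S {inj₂ (zero , true)} {inj₁ x} (Equivalence.to (~⇔Edge (inj₂ (zero , true)) (inj₁ x)) e))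
          (λ l → Equivalence.from (~⇔Edge (inj₂ (zero , true)) (inj₁ x)) (S⇒Edge (inj₂ (zero , true)) (inj₁ x) l))
          (ind-Bool (h s′ (ι x)))) (g-ind (θ x))))
          (trans (sym (Ci.∑-θ c λ x → g (θ x) * ⟦ X x ⟧)) (∑-cong λ x → cong (λ z → g z * ⟦ X (θ x) ⟧) (θ-inv x)))

        -- A set in the extension enters `F` only through its trace on the old vertices and two bits
        -- for the new ones. Sets without old vertices are settled here directly: the empty trace
        -- has `F` equal to -4, and each new vertex contributes 4. Only nonempty traces remain as an
        -- obligation.
        conclude : let value = λ X p q → F (h ↾ ι) X + ⟦ p ⟧ * (+ 4 - + 2 * ∑ (λ x → g x * ⟦ X x ⟧)) + ⟦ q ⟧ * (+ 4 - + 2 * ∑ (λ x → g x * ⟦ X (θ x) ⟧)) in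
          (∀ X {x} → T (X x) → ∀ p q → 0ℤ ≤ value X p q) → value full true true ≡ 0ℤ → CiTight H
        conclude pos zer = Ci⇒CiTight H (record { involutive = H-involutive ; sparse = sp ; tight = trans (formula full) zer })
          where
          value : Sub order → Bool → Bool → ℤ
          value X p q = F (h ↾ ι) X + ⟦ p ⟧ * (+ 4 - + 2 * ∑ (λ x → g x * ⟦ X x ⟧)) + ⟦ q ⟧ * (+ 4 - + 2 * ∑ (λ x → g x * ⟦ X (θ x) ⟧))
          formula : ∀ Z → F h Z ≡ value (Z ∘ ι) (Z s) (Z s′)
          formula Z = trans (F-pair (λ e → Edge⇒S {inj₂ (zero , false)} {inj₂ (zero , true)} (Equivalence.to (~⇔Edge _ _) e)) Z)
            (cong₂ (λ u v → F (h ↾ ι) (Z ∘ ι) + ⟦ Z s ⟧ * (+ 4 - + 2 * u) + ⟦ Z s′ ⟧ * (+ 4 - + 2 * v)) (row-s (Z ∘ ι)) (row-s′ (Z ∘ ι)))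
          nothing-old : ∀ X → (∀ x → X x ≡ false) → ∀ p q → value X p q ≡ - + 4 + ⟦ p ⟧ * + 4 + ⟦ q ⟧ * + 4
          nothing-old X e p q = cong₂ (λ u (v , w) → u + ⟦ p ⟧ * (+ 4 - + 2 * v) + ⟦ q ⟧ * (+ 4 - + 2 * w))
            (trans (F-cong (h ↾ ι) e) (F-∅ {a = h ↾ ι})) (cong₂ _,_ (null λ x → e x) (null λ x → e (θ x)))
            where
            null : {Y : Sub order} → (∀ x → Y x ≡ false) → ∑ (λ x → g x * ⟦ Y x ⟧) ≡ 0ℤ
            null e = trans (∑-cong λ x → trans (cong (λ b → g x * ⟦ b ⟧) (e x)) (ℤ.*-zeroʳ (g x))) (∑-0 order)
          small : ∀ p q → T (p ∨ q) → 0ℤ ≤ - + 4 + ⟦ p ⟧ * + 4 + ⟦ q ⟧ * + 4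
          small true true _ = +≤+ z≤n
          small true false _ = +≤+ z≤n
          small false true _ = +≤+ z≤n
          which : ∀ P (Z : Sub (ℤ₂Graph.order H)) → T (Z (Inverse.from bijection P)) → (∀ x → ¬ T (Z (ι x))) → T (Z s ∨ Z s′)
          which (inj₁ x) Z t none = contradiction t (none x)
          which (inj₂ (zero , false)) Z t none = ∨-i₁ t
          which (inj₂ (zero , true)) Z t none = ∨-i₂ {Z s} t
          sp : ∀ Z {v} → T (Z v) → 0ℤ ≤ F h Z
          sp Z {v} t with any? (λ x → T? (Z (ι x)))
          ... | yes (x , h) = subst (0ℤ ≤_) (sym (formula Z)) (pos (Z ∘ ι) h (Z s) (Z s′))
          ... | no none = subst (0ℤ ≤_) (sym (trans (formula Z) (nothing-old (Z ∘ ι) (λ x → T⇔≡ (λ t → none (x , t)) λ ()) (Z s) (Z s′))))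
            (small (Z s) (Z s′) (case from-surjective v of λ { (P , refl) → which P Z t λ x t → none (x , t) }))

-- The operations preserve tightness

opaque
  unfolding F

  F-matrix-cong : {a b : Matrix n} → (∀ x y → a x y ≡ b x y) → ∀ X → F a X ≡ F b X
  F-matrix-cong e X = cong (λ l → + 4 * ∣ X ∣ₛ - + 4 - l) (∑-cong λ x → ∑-cong λ y → cong (λ b → ⟦ b ⟧ * (⟦ X x ⟧ * ⟦ X y ⟧)) (e x y))

∑-δ₂ : (a b : Fin n) (f : Fin n → ℤ) → ∑ (λ x → (δ a x + δ b x) * f x) ≡ f a + f b
∑-δ₂ a b f = trans (∑-cong λ x → ℤ.*-distribʳ-+ (f x) (δ a x) (δ b x))
  (trans (∑-+ (λ x → δ a x * f x) (λ x → δ b x * f x)) (cong₂ _+_ (∑-δ a f) (∑-δ b f)))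

∑-δ₂+ : (a b : Fin n) (g f : Fin n → ℤ) → ∑ (λ x → (δ a x + δ b x + g x) * f x) ≡ f a + f b + ∑ λ x → g x * f x
∑-δ₂+ a b g f = trans (∑-cong λ x → ℤ.*-distribʳ-+ (f x) (δ a x + δ b x) (g x))
  (trans (∑-+ (λ x → (δ a x + δ b x) * f x) (λ x → g x * f x)) (cong (λ z → z + ∑ λ x → g x * f x) (∑-δ₂ a b f)))

module ZeroExtension (G : ℤ₂Graph) (a b : Fin (ℤ₂Graph.order G)) where
  open ℤ₂Graph G

  L : Fin order → Set
  L x = x ≡ a ⊎ x ≡ b

  open PairExtension G _~_ L public

  spec : Spec (ZeroExtR G a b)
  spec = record
    { K-sym = λ {x} {y} → subst T (adj-sym x y)
    ; K-θ = λ {x} {y} → subst T (θ-auto x y)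
    ; R⇒S = λ { (keep e) → e ; va → inj₁ refl ; vb → inj₂ refl }
    ; K⇒Edge = λ e → fwd (inj₁ (keep e))
    ; L⇒R = λ { (inj₁ refl) → va ; (inj₂ refl) → vb }
    }

  preserves : Ci adj θ → a ≢ b → {H : ℤ₂Graph} → H Realises extend G 1 (ZeroExtR G a b) → CiTight H
  preserves c a≢b {H} r = conclude g (λ x → ind-⊎ (ind-δ a x) (ind-δ b x) λ { refl refl → a≢b refl })
      (λ X {x} x∈X p q → subst (0ℤ ≤_) (sym (value X p q)) (0≤+ (0≤+ (Ci.sparse c X x∈X) (pos p (X a) (X b))) (pos q (X (θ a)) (X (θ b)))))
      (trans (value full true true) (trans (ℤ.+-identityʳ (F adj full + 0ℤ)) (trans (ℤ.+-identityʳ (F adj full)) (Ci.tight c))))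
    where
    open Spec.Forward spec c id r
    g : Fin order → ℤ
    g x = δ a x + δ b x
    pos : ∀ p x y → 0ℤ ≤ ⟦ p ⟧ * (+ 4 - + 2 * (⟦ x ⟧ + ⟦ y ⟧))
    pos = from-yes (∀Bool? λ p → ∀Bool? λ x → ∀Bool? λ y → 0ℤ ℤ.≤? ⟦ p ⟧ * (+ 4 - + 2 * (⟦ x ⟧ + ⟦ y ⟧)))
    value : ∀ X p q → F (h ↾ ι) X + ⟦ p ⟧ * (+ 4 - + 2 * ∑ (λ x → g x * ⟦ X x ⟧)) + ⟦ q ⟧ * (+ 4 - + 2 * ∑ (λ x → g x * ⟦ X (θ x) ⟧))
      ≡ F adj X + ⟦ p ⟧ * (+ 4 - + 2 * (⟦ X a ⟧ + ⟦ X b ⟧)) + ⟦ q ⟧ * (+ 4 - + 2 * (⟦ X (θ a) ⟧ + ⟦ X (θ b) ⟧))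
    value X p q = cong₂ (λ u (v , w) → u + ⟦ p ⟧ * (+ 4 - + 2 * v) + ⟦ q ⟧ * (+ 4 - + 2 * w))
      (F-matrix-cong (λ x y → T⇔≡ (Equivalence.to K⇔) (Equivalence.from K⇔)) X)
      (cong₂ _,_ (∑-δ₂ a b λ x → ⟦ X x ⟧) (∑-δ₂ a b λ x → ⟦ X (θ x) ⟧))

module OneExtension (G : ℤ₂Graph) (inv : Involutive (ℤ₂Graph.adj G) (ℤ₂Graph.θ G)) (a b c : Fin (ℤ₂Graph.order G))
  (a~b : ℤ₂Graph._~_ G a b) where
  open ℤ₂Graph G
  private
    only-b : ∀ {x} → x ≡ b → a ~ x
    only-b refl = a~b

  open Moved inv a (_≡ b) (δ b) (ind-δ b) only-b public

  L : Fin order → Set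
  L x = (x ≡ a ⊎ x ≡ b) ⊎ x ≡ c

  open PairExtension G Kept L public

  flip : ∀ {x y} → θ x ≡ y → x ≡ θ y
  flip {x} refl = sym (θ-inv x)

  Star⇒SamePair : ∀ {x y} → Star x y → SamePair x y a b ⊎ SamePair x y (θ a) (θ b)
  Star⇒SamePair (inj₁ (inj₁ h)) = inj₁ (inj₁ h)
  Star⇒SamePair (inj₁ (inj₂ (e , f))) = inj₁ (inj₂ (f , e))
  Star⇒SamePair (inj₂ (inj₁ (e , f))) = inj₂ (inj₁ (e , flip f))
  Star⇒SamePair (inj₂ (inj₂ (e , f))) = inj₂ (inj₂ (flip f , e))

  SamePair⇒Star : ∀ {x y} → SamePair x y a b ⊎ SamePair x y (θ a) (θ b) → Star x y
  SamePair⇒Star (inj₁ (inj₁ h)) = inj₁ (inj₁ h)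
  SamePair⇒Star (inj₁ (inj₂ (f , e))) = inj₁ (inj₂ (e , f))
  SamePair⇒Star (inj₂ (inj₁ (e , refl))) = inj₂ (inj₁ (e , θ-inv b))
  SamePair⇒Star (inj₂ (inj₂ (refl , e))) = inj₂ (inj₂ (e , θ-inv b))

  spec : Spec (OneExtR G a b c)
  spec = record
    { K-sym = Kept-sym
    ; K-θ = Kept-θ⁻
    ; R⇒S = λ { (keep e h h′) → e , [ h , h′ ]′ ∘ Star⇒SamePair
              ; va → inj₁ (inj₁ refl) ; vb → inj₁ (inj₂ refl) ; vc → inj₂ refl }
    ; K⇒Edge = λ (e , h) → fwd (inj₁ (keep e (h ∘ SamePair⇒Star ∘ inj₁) (h ∘ SamePair⇒Star ∘ inj₂)))
    ; L⇒R = λ { (inj₁ (inj₁ refl)) → va ; (inj₁ (inj₂ refl)) → vb ; (inj₂ refl) → vc }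
    }

  weight-at : ∀ X → weight X ≡ ⟦ X b ⟧
  weight-at X = ∑-δ b λ x → ⟦ X x ⟧

  weight′-at : ∀ X → weight′ X ≡ ⟦ X (θ b) ⟧
  weight′-at X = trans (sym (Involutive.∑-θ inv λ x → δ b (θ x) * ⟦ X x ⟧))
    (trans (∑-cong λ x → cong (λ z → δ b z * ⟦ X (θ x) ⟧) (θ-inv x)) (∑-δ b λ x → ⟦ X (θ x) ⟧))

  preserves : Ci adj θ → c ≢ a → c ≢ b → {H : ℤ₂Graph} → H Realises extend G 1 (OneExtR G a b c) → CiTight H
  preserves ci c≢a c≢b {H} r = conclude g
      (λ x → ind-⊎ (ind-⊎ (ind-δ a x) (ind-δ b x) λ { refl refl → Involutive.a-irr inv _ a~b }) (ind-δ c x)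
        λ { (inj₁ refl) refl → c≢a refl ; (inj₂ refl) refl → c≢b refl })
      (λ X {x} x∈X p q → subst (0ℤ ≤_) (sym (value X p q))
        (0≤+ (0≤+ (Ci.sparse ci X x∈X) (pos p (X a) (X b) (X c))) (pos q (X (θ a)) (X (θ b)) (X (θ c)))))
      (trans (value full true true) (trans (ℤ.+-identityʳ (F adj full + 0ℤ)) (trans (ℤ.+-identityʳ (F adj full)) (Ci.tight ci))))
    where
    open Spec.Forward spec ci proj₁ r
    g : Fin order → ℤ
    g x = δ a x + δ b x + δ c x
    -- The new vertex costs 2 only if all of a, b, c lie in the set, and then the deleted edge ab
    -- gives 2 back.
    term : Bool → Bool → Bool → Bool → ℤ
    term p x y z = + 2 * (⟦ x ⟧ * ⟦ y ⟧) + ⟦ p ⟧ * (+ 4 - + 2 * (⟦ x ⟧ + ⟦ y ⟧ + ⟦ z ⟧))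
    pos : ∀ p x y z → 0ℤ ≤ term p x y z
    pos = from-yes (∀Bool? λ p → ∀Bool? λ x → ∀Bool? λ y → ∀Bool? λ z → 0ℤ ℤ.≤? term p x y z)
    value : ∀ X p q → F (h ↾ ι) X + ⟦ p ⟧ * (+ 4 - + 2 * ∑ (λ x → g x * ⟦ X x ⟧)) + ⟦ q ⟧ * (+ 4 - + 2 * ∑ (λ x → g x * ⟦ X (θ x) ⟧))
      ≡ F adj X + term p (X a) (X b) (X c) + term q (X (θ a)) (X (θ b)) (X (θ c))
    value X p q = trans (cong₂ (λ u (v , w) → u + ⟦ p ⟧ * (+ 4 - + 2 * v) + ⟦ q ⟧ * (+ 4 - + 2 * w))
        (trans (F-star K⇔ X) (cong₂ (λ u v → F adj X + + 2 * (⟦ X a ⟧ * u) + + 2 * (⟦ X (θ a) ⟧ * v)) (weight-at X) (weight′-at X)))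
        (cong₂ _,_ (sum3 λ x → ⟦ X x ⟧) (sum3 λ x → ⟦ X (θ x) ⟧)))
      (lem (F adj X) (+ 2 * (⟦ X a ⟧ * ⟦ X b ⟧)) (+ 2 * (⟦ X (θ a) ⟧ * ⟦ X (θ b) ⟧)) _ _)
      where
      lem : ∀ f u v p q → f + u + v + p + q ≡ f + (u + p) + (v + q)
      lem = solve-∀
      sum3 : ∀ (f : Fin order → ℤ) → ∑ (λ x → g x * f x) ≡ f a + f b + f c
      sum3 f = trans (∑-δ₂+ a b (δ c) f) (cong (λ z → f a + f b + z) (∑-δ c f))

module VertexToC₄ (G : ℤ₂Graph) (inv : Involutive (ℤ₂Graph.adj G) (ℤ₂Graph.θ G)) (w v₁ v₂ : Fin (ℤ₂Graph.order G))
  (w~v₁ : ℤ₂Graph._~_ G w v₁) (w~v₂ : ℤ₂Graph._~_ G w v₂) (v₁≢v₂ : v₁ ≢ v₂) (M : Subset (ℤ₂Graph.order G))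
  (v₁∉M : v₁ Subset.∉ M) (v₂∉M : v₂ Subset.∉ M) where
  open ℤ₂Graph G
  open Involutive inv using (∑-θ; deg-θ; F-insert; θ-free; ~̸θ; ~-sym)

  N : Fin order → Set
  N x = w ~ x × x Subset.∈ M

  f : Fin order → ℤ
  f x = ⟦ adj w x ⟧ * ⟦ lookup M x ⟧

  f-ind : ∀ x → Ind (f x) (N x)
  f-ind x = ind-× (ind-Bool (adj w x)) (ind-map T⇒∈ ∈⇒T (ind-Bool (lookup M x)))

  open Moved inv w N f f-ind proj₁ public

  L : Fin order → Set
  L x = (x ≡ v₁ ⊎ x ≡ v₂) ⊎ N x

  open PairExtension G Kept L public

  Edge = Presentation.Edge (extend G 1 (ToC₄R G w v₁ v₂ M))

  spec : Spec (ToC₄R G w v₁ v₂ M)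
  spec = record
    { K-sym = Kept-sym
    ; K-θ = Kept-θ⁻
    ; R⇒S = λ { (keep e h h′) → kept-away e h h′ ; (stay e h) → kept-at e (h ∘ proj₂) ; (move e h) → inj₂ (e , h)
              ; uv₁ → inj₁ (inj₁ refl) ; uv₂ → inj₁ (inj₂ refl) }
    ; K⇒Edge = kept-rec (λ x y → Edge (inj₁ x) (inj₁ y)) (edge-sym {G} {1}) (edge-τ {G} {1})
        (λ e h → fwd (inj₁ (stay e λ m → h (e , m)))) (λ e h h′ → fwd (inj₁ (keep e h h′)))
    ; L⇒R = λ { (inj₁ (inj₁ refl)) → uv₁ ; (inj₁ (inj₂ refl)) → uv₂ ; (inj₂ (e , h)) → move e h }
    }

  g : Fin order → ℤ
  g x = δ v₁ x + δ v₂ x + f x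

  g-ind : ∀ x → Ind (g x) (L x)
  g-ind x = ind-⊎ (ind-⊎ (ind-δ v₁ x) (ind-δ v₂ x) λ { refl refl → v₁≢v₂ refl }) (f-ind x)
    λ { (inj₁ refl) h → v₁∉M (proj₂ h) ; (inj₂ refl) h → v₂∉M (proj₂ h) }

  L⇒~ : ∀ {x} → L x → w ~ x
  L⇒~ (inj₁ (inj₁ refl)) = w~v₁
  L⇒~ (inj₁ (inj₂ refl)) = w~v₂
  L⇒~ (inj₂ h) = proj₁ h

  0≤f : ∀ x → 0ℤ ≤ f x
  0≤f x = 0≤* 0≤⟦ adj w x ⟧ 0≤⟦ lookup M x ⟧

  row : Sub order → ℤ
  row X = ∑ λ x → g x * ⟦ X x ⟧

  row-split : ∀ X → row X ≡ ⟦ X v₁ ⟧ + ⟦ X v₂ ⟧ + weight X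
  row-split X = ∑-δ₂+ v₁ v₂ f λ x → ⟦ X x ⟧

  row≤deg : ∀ X → row X ≤ deg adj w X
  row≤deg X = ∑-mono λ x → ind-≤ (ind-× (g-ind x) (ind-Bool (X x))) (ind-× (ind-Bool (adj w x)) (ind-Bool (X x)))
    λ (l , h) → L⇒~ l , h

  0≤weight : ∀ X → 0ℤ ≤ weight X
  0≤weight X = 0≤∑ λ x → 0≤* (0≤f x) 0≤⟦ X x ⟧

  -- Bit `x` tells whether w is in the set, in which case the edges moved away from w return 2 each;
  -- bit `p` tells whether the new vertex is, which pays for its own row.
  change : Sub order → Bool → Bool → ℤ
  change X x p = + 2 * (⟦ x ⟧ * weight X) + ⟦ p ⟧ * (+ 4 - + 2 * row X)

  -- If the new vertex lies in the set but w does not, the new vertex plays the role of w.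
  grow : ∀ v (Z : Sub order → Sub order) → (∀ X → row (Z X) ≤ deg adj v X) → ∀ X p →
    ∃ λ Y → (∀ {x} → T (X x) → T (Y x)) × (∀ {x} → x ≢ v → Y x ≡ X x) × F adj Y ≤ F adj X + change (Z X) (X v) p
  grow v Z row≤ X p = go (X v) refl p
    where
    W = Z X
    four : ∀ a b → 0ℤ ≤ + 4 - + 2 * (⟦ a ⟧ + ⟦ b ⟧)
    four = from-yes (∀Bool? λ a → ∀Bool? λ b → 0ℤ ℤ.≤? + 4 - + 2 * (⟦ a ⟧ + ⟦ b ⟧))
    go : ∀ x → X v ≡ x → ∀ p → ∃ λ Y → (∀ {x} → T (X x) → T (Y x)) × (∀ {x} → x ≢ v → Y x ≡ X x) × F adj Y ≤ F adj X + change W x p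
    go x e false = X , id , (λ _ → refl) , ≤-by (change W x false) (0≤+ (0≤* {+ 2} (+≤+ z≤n) (0≤* 0≤⟦ x ⟧ (0≤weight W))) ≤-refl) refl
    go true e true = X , id , (λ _ → refl) , ≤-by (change W true true)
      (subst (0ℤ ≤_) (sym (trans (cong (λ r → + 2 * (1ℤ * weight W) + 1ℤ * (+ 4 - + 2 * r)) (row-split W)) (lem (weight W) ⟦ W v₁ ⟧ ⟦ W v₂ ⟧)))
        (four (W v₁) (W v₂))) refl
      where
      lem : ∀ m a b → + 2 * (1ℤ * m) + 1ℤ * (+ 4 - + 2 * (a + b + m)) ≡ + 4 - + 2 * (a + b)
      lem = solve-∀
    go false e true = X ∪ single v , ∨-i₁ , (λ {x} x≢v → trans (cong (λ b → X x ∨ b) (dec-false (v ≟ x) (x≢v ∘ sym))) (∨-identityʳ (X x))) ,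
      ≤-by _ (0≤* {+ 2} (+≤+ z≤n) (0≤- (row≤ X)))
        (trans (lem (F adj X) (row W) (deg adj v X) (weight W)) (cong (λ z → z + + 2 * (deg adj v X - row W)) (sym (F-insert X v (subst T e)))))
      where
      lem : ∀ f r d m → f + (+ 2 * (0ℤ * m) + 1ℤ * (+ 4 - + 2 * r)) ≡ (f + + 4 - + 2 * d) + + 2 * (d - r)
      lem = solve-∀

  -- Makes the enlargements at w and at `θ w` independent. The first one alters membership of w
  -- only, which is read here at position `θ w`, where the weights vanish because w and `θ w` are
  -- not adjacent.
  local : ∀ (k : Fin order → ℤ) {X Y : Sub order} → (∀ {x} → x ≢ w → Y x ≡ X x) → k (θ w) ≡ 0ℤ →
    ∑ (λ x → k x * ⟦ Y (θ x) ⟧) ≡ ∑ λ x → k x * ⟦ X (θ x) ⟧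
  local k {X} {Y} off kw = ∑-cong λ x → step x (x ≟ θ w)
    where
    step : ∀ x → Dec (x ≡ θ w) → k x * ⟦ Y (θ x) ⟧ ≡ k x * ⟦ X (θ x) ⟧
    step x (yes refl) = trans (cong (_* ⟦ Y (θ x) ⟧) kw) (sym (cong (_* ⟦ X (θ x) ⟧) kw))
    step x (no x≢) = cong (λ b → k x * ⟦ b ⟧) (off λ e → x≢ (trans (sym (θ-inv x)) (cong θ e)))

  row-θw : g (θ w) ≡ 0ℤ
  row-θw = ind-unique (g-ind (θ w)) (inj₂ (refl , λ l → ~̸θ w (L⇒~ l)))

  f-θw : f (θ w) ≡ 0ℤ
  f-θw = ind-unique (f-ind (θ w)) (inj₂ (refl , λ l → ~̸θ w (proj₁ l)))

  preserves : Ci adj θ → {H : ℤ₂Graph} → H Realises extend G 1 (ToC₄R G w v₁ v₂ M) → CiTight H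
  preserves c {H} r = conclude g g-ind
      (λ X {x} x∈X p q → subst (0ℤ ≤_) (sym (value X p q)) (bound X x∈X p q))
      (trans (value full true true) (trans (lem₀ (F adj full) (weight full) (row full) (row-split full)) (Ci.tight c)))
    where
    open Spec.Forward spec c proj₁ r hiding (row)
    value : ∀ X p q → F (h ↾ ι) X + ⟦ p ⟧ * (+ 4 - + 2 * row X) + ⟦ q ⟧ * (+ 4 - + 2 * row (X ∘ θ))
      ≡ F adj X + change X (X w) p + change (X ∘ θ) (X (θ w)) q
    value X p q = trans (cong (λ u → u + ⟦ p ⟧ * (+ 4 - + 2 * row X) + ⟦ q ⟧ * (+ 4 - + 2 * row (X ∘ θ)))
        (trans (F-star K⇔ X) (cong (λ v → F adj X + + 2 * (⟦ X w ⟧ * weight X) + + 2 * (⟦ X (θ w) ⟧ * v))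
          (trans (sym (∑-θ λ x → f (θ x) * ⟦ X x ⟧)) (∑-cong λ x → cong (λ z → f z * ⟦ X (θ x) ⟧) (θ-inv x))))))
      (lem (F adj X) (+ 2 * (⟦ X w ⟧ * weight X)) (+ 2 * (⟦ X (θ w) ⟧ * weight (X ∘ θ))) (⟦ p ⟧ * (+ 4 - + 2 * row X)) (⟦ q ⟧ * (+ 4 - + 2 * row (X ∘ θ))))
      where
      lem : ∀ f u v p q → f + u + v + p + q ≡ f + (u + p) + (v + q)
      lem = solve-∀
    lem₀ : ∀ f m r → r ≡ 1ℤ + 1ℤ + m → f + (+ 2 * (1ℤ * m) + 1ℤ * (+ 4 - + 2 * r)) + (+ 2 * (1ℤ * m) + 1ℤ * (+ 4 - + 2 * r)) ≡ f
    lem₀ f m r refl = lem f m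
      where
      lem : ∀ f m → f + (+ 2 * (1ℤ * m) + 1ℤ * (+ 4 - + 2 * (1ℤ + 1ℤ + m))) + (+ 2 * (1ℤ * m) + 1ℤ * (+ 4 - + 2 * (1ℤ + 1ℤ + m))) ≡ f
      lem = solve-∀
    bound : ∀ X {x} → T (X x) → ∀ p q → 0ℤ ≤ F adj X + change X (X w) p + change (X ∘ θ) (X (θ w)) q
    bound X x∈X p q with grow w id row≤deg X p
    ... | Y , X⊆Y , off , le with grow (θ w) (_∘ θ) (λ X → ≤-trans (row≤deg (X ∘ θ)) (≤-reflexive (sym (deg-θ w X)))) Y q
    ...   | Y′ , Y⊆Y′ , _ , le′ = ≤-trans (Ci.sparse c Y′ (Y⊆Y′ (X⊆Y x∈X))) (≤-trans le′
      (≤-trans (≤-reflexive (cong (λ z → F adj Y + z) changes)) (ℤ.+-monoˡ-≤ (change (X ∘ θ) (X (θ w)) q) le)))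
      where
      changes : change (Y ∘ θ) (Y (θ w)) q ≡ change (X ∘ θ) (X (θ w)) q
      changes = cong₂ (λ b (m , s) → + 2 * (⟦ b ⟧ * m) + ⟦ q ⟧ * (+ 4 - + 2 * s)) (off (θ-free w))
        (cong₂ _,_ (local f off f-θw) (local g off row-θw))

module _ {a : Matrix n} (gr : Graphical a) where
  open Graphical gr

  link-bound-irr : (X : Sub n) → link a X X ≤ ∣ X ∣ₛ * ∣ X ∣ₛ - ∣ X ∣ₛ
  link-bound-irr X = ≤-trans (∑-mono λ x → ∑-mono λ y → step x y) (≤-reflexive total)
    where
    w : Fin n → Fin n → ℤ
    w x y = ⟦ X x ⟧ * ⟦ X y ⟧
    sub-0 : ∀ w → w ≡ w - 0ℤ * w
    sub-0 = solve-∀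
    sub-1 : ∀ w → 0ℤ * w ≡ w - 1ℤ * w
    sub-1 = solve-∀
    below : ∀ b x y → ⟦ b ⟧ * w x y ≤ w x y
    below true x y = ≤-reflexive (ℤ.*-identityˡ (w x y))
    below false x y = 0≤* 0≤⟦ X x ⟧ 0≤⟦ X y ⟧
    step : ∀ x y → ⟦ a x y ⟧ * w x y ≤ w x y - δ x y * w x y
    step x y with x ≟ y
    ... | yes refl = ≤-reflexive (trans (cong (_* w x x) (⟦⟧-false (a-irr x))) (sub-1 (w x x)))
    ... | no _ = ≤-trans (below (a x y) x y) (≤-reflexive (sub-0 (w x y)))
    total : ∑ (λ x → ∑ λ y → w x y - δ x y * w x y) ≡ ∣ X ∣ₛ * ∣ X ∣ₛ - ∣ X ∣ₛ
    total = trans (∑-cong λ x → ∑-- (w x) (λ y → δ x y * w x y)) (trans (∑-- (λ x → ∑ (w x)) (λ x → ∑ λ y → δ x y * w x y))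
      (cong₂ _-_ (∣∣-square X) (∑-cong λ x → trans (∑-δ x (w x)) (⟦⟧-idem (X x)))))

  1≤∣_∣ₛ : (X : Sub n) {v : Fin n} → T (X v) → 1ℤ ≤ ∣ X ∣ₛ
  1≤∣ X ∣ₛ {v} h = subst (_≤ ∣ X ∣ₛ) (⟦⟧-true h) (≤∑-at v λ x → 0≤⟦ X x ⟧)

  -- A simple graph has at most s(s - 1) ordered edges on s vertices, so `F` is at least (s - 1)(4 -
  -- s).
  F-small : (X : Sub n) {v : Fin n} → T (X v) → ∣ X ∣ₛ ≤ + 4 → 0ℤ ≤ F a X
  F-small X h le = 0≤-by _ (0≤+ (0≤* (0≤- (1≤∣ X ∣ₛ h)) (0≤- le)) (0≤- (link-bound-irr X)))
    (trans (F-def a X) (lem ∣ X ∣ₛ (link a X X)))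
    where
    lem : ∀ s l → + 4 * s - + 4 - l ≡ (s - 1ℤ) * (+ 4 - s) + (s * s - s - l)
    lem = solve-∀

  -- If Z meets K, modularity and `F-small` on the intersection show that adding all of K does not
  -- raise `F`. With K a new clique, sparsity need only be verified for sets that contain the clique
  -- wholly or not at all.
  fill : (K : Sub n) → F a K ≡ 0ℤ → ∣ K ∣ₛ ≤ + 4 → ∀ Z → ∃ λ Y →
    (∀ {x} → T (Z x) → T (Y x)) × F a Y ≤ F a Z × (∀ {x} → ¬ T (K x) → Y x ≡ Z x) × (∀ {x y} → T (K x) → T (K y) → Y x ≡ Y y)
  fill K FK le Z with any? (λ x → T? (Z x ∧ K x))
  ... | no none = Z , id , ≤-refl , (λ _ → refl) , λ p q → trans (off p) (sym (off q))
    where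
    off : ∀ {x} → T (K x) → Z x ≡ false
    off {x} k = T⇔≡ (λ z → none (x , ∧-i z k)) λ ()
  ... | yes (x , h) = Z ∪ K , ∨-i₁ , le′ , (λ {x} ∉K → T⇔≡ (λ h → [ id , ⊥-elim ∘ ∉K ]′ (∨-e h)) ∨-i₁) ,
      λ {x} {y} p q → T⇔≡ (λ _ → ∨-i₂ {Z y} q) (λ _ → ∨-i₂ {Z x} p)
    where
    ∩-small : ∣ Z ∩ K ∣ₛ ≤ + 4
    ∩-small = ≤-trans (∑-mono λ x → ind-≤ (ind-Bool (Z x ∧ K x)) (ind-Bool (K x)) (∧-e₂ {Z x})) le
    lem : ∀ u i l f → u + i + + 2 * l ≡ f + 0ℤ → f ≡ u + (i + + 2 * l)
    lem u i l f h = trans (sym (ℤ.+-identityʳ f)) (trans (sym h) (ℤ.+-assoc u i (+ 2 * l)))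
    le′ : F a (Z ∪ K) ≤ F a Z
    le′ = ≤-by _ (0≤+ (F-small (Z ∩ K) h ∩-small) (0≤* {+ 2} (+≤+ z≤n) (0≤link a (Z ∖ K) (K ∖ Z))))
      (lem (F a (Z ∪ K)) (F a (Z ∩ K)) (link a (Z ∖ K) (K ∖ Z)) (F a Z) (trans (modular Z K) (cong (λ z → F a Z + z) FK)))

opaque
  unfolding ∑

  ∑-δ-suc : (c : Fin 4) → Ind (∑ λ i → δ c (suc i)) (c ≢ zero)
  ∑-δ-suc 0F = inj₂ (refl , λ h → h refl)
  ∑-δ-suc 1F = inj₁ (refl , λ ())
  ∑-δ-suc 2F = inj₁ (refl , λ ())
  ∑-δ-suc 3F = inj₁ (refl , λ ())

  ∑-K₃ : ∑ {3} (λ i → ∑ {3} λ j → ⟦ not (does (i ≟ j)) ⟧) ≡ + 6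
  ∑-K₃ = refl

module VertexToK₄ (G : ℤ₂Graph) (inv : Involutive (ℤ₂Graph.adj G) (ℤ₂Graph.θ G)) (w : Fin (ℤ₂Graph.order G))
  (d : Fin (ℤ₂Graph.order G) → Fin 4) where
  open ℤ₂Graph G
  open Involutive inv using (θ-free; ~̸θ; ~-sym; ~-θ; F-single)

  private
    R = ToK₄R G w d
    Edge = Presentation.Edge (extend G 3 R)

  M : Fin order → Set
  M x = w ~ x × d x ≢ zero

  moved : Fin order → ℤ
  moved x = ⟦ adj w x ⟧ * ∑ λ i → δ (d x) (suc i)

  open Moved inv w M moved (λ x → ind-× (ind-Bool (adj w x)) (∑-δ-suc (d x))) proj₁ public

  L : Fin 3 → Fin order → Set
  L i x = x ≡ w ⊎ (w ~ x × suc i ≡ d x)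

  S : Extended G 3 → Extended G 3 → Set
  S (inj₁ x) (inj₁ y) = Kept x y
  S (inj₁ x) (inj₂ (i , false)) = L i x
  S (inj₁ x) (inj₂ (i , true)) = L i (θ x)
  S (inj₂ (i , false)) (inj₁ x) = L i x
  S (inj₂ (i , true)) (inj₁ x) = L i (θ x)
  S (inj₂ (i , false)) (inj₂ (j , false)) = i ≢ j
  S (inj₂ (i , true)) (inj₂ (j , true)) = i ≢ j
  S (inj₂ (i , false)) (inj₂ (j , true)) = ⊥
  S (inj₂ (i , true)) (inj₂ (j , false)) = ⊥

  S-sym : ∀ {P Q} → S P Q → S Q P
  S-sym {inj₁ x} {inj₁ y} = Kept-sym
  S-sym {inj₁ x} {inj₂ (i , false)} h = h
  S-sym {inj₁ x} {inj₂ (i , true)} h = h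
  S-sym {inj₂ (i , false)} {inj₁ x} h = h
  S-sym {inj₂ (i , true)} {inj₁ x} h = h
  S-sym {inj₂ (i , false)} {inj₂ (j , false)} h = h ∘ sym
  S-sym {inj₂ (i , true)} {inj₂ (j , true)} h = h ∘ sym

  S-τ : ∀ {P Q} → S (τ G P) (τ G Q) → S P Q
  S-τ {inj₁ x} {inj₁ y} = Kept-θ⁻
  S-τ {inj₁ x} {inj₂ (i , false)} h = subst (L i) (θ-inv x) h
  S-τ {inj₁ x} {inj₂ (i , true)} h = h
  S-τ {inj₂ (i , false)} {inj₁ x} h = subst (L i) (θ-inv x) h
  S-τ {inj₂ (i , true)} {inj₁ x} h = h
  S-τ {inj₂ (i , false)} {inj₂ (j , false)} h = h
  S-τ {inj₂ (i , true)} {inj₂ (j , true)} h = h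

  w≢θw : w ≢ θ w
  w≢θw e = θ-free w (sym e)

  R⇒S : ∀ {P Q} → R P Q → S P Q
  R⇒S (keep e h h′) = kept-away e h h′
  R⇒S (clique {zero} {zero} h) = contradiction refl h
  R⇒S (clique {zero} {suc j} h) = inj₁ refl
  R⇒S (clique {suc i} {zero} h) = inj₁ refl
  R⇒S (clique {suc i} {suc j} h) = λ e → h (cong suc e)
  R⇒S (move {u} e) with d u in eq
  ... | suc i = inj₂ (e , sym eq)
  ... | zero = kept-at e λ m → proj₂ m eq

  Edge⇒S : ∀ {P Q} → Edge P Q → S P Q
  Edge⇒S = edge-rec {G = G} {3} {R} S (λ {P} {Q} → S-sym {P} {Q}) (λ {P} {Q} → S-τ {P} {Q}) R⇒S

  from-w : ∀ {y} → w ~ y → ¬ M y → R (inj₁ w) (inj₁ y)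
  from-w {y} e h with d y in eq
  ... | zero = subst (λ c → R (K₄-vertex G w c) (inj₁ y)) eq (move e)
  ... | suc i = contradiction (e , λ ()) h

  K⇒Edge : ∀ {x y} → Kept x y → Edge (inj₁ x) (inj₁ y)
  K⇒Edge = kept-rec (λ x y → Edge (inj₁ x) (inj₁ y)) (edge-sym {G} {3}) (edge-τ {G} {3}) (λ e h → fwd (inj₁ (from-w e h))) (λ e h h′ → fwd (inj₁ (keep e h h′)))

  L⇒R : ∀ {i x} → L i x → R (inj₂ (i , false)) (inj₁ x)
  L⇒R {i} (inj₁ refl) = clique {i = suc i} {zero} λ ()
  L⇒R {i} {x} (inj₂ (e , h)) = subst (λ c → R (K₄-vertex G w c) (inj₁ x)) (sym h) (move e)

  S⇒Edge : ∀ P Q → S P Q → Edge P Q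
  S⇒Edge (inj₁ x) (inj₁ y) = K⇒Edge
  S⇒Edge (inj₁ x) (inj₂ (i , false)) h = bwd (inj₁ (L⇒R h))
  S⇒Edge (inj₁ x) (inj₂ (i , true)) h = bwd (inj₂ (L⇒R h))
  S⇒Edge (inj₂ (i , false)) (inj₁ y) h = fwd (inj₁ (L⇒R h))
  S⇒Edge (inj₂ (i , true)) (inj₁ y) h = fwd (inj₂ (L⇒R h))
  S⇒Edge (inj₂ (i , false)) (inj₂ (j , false)) h = fwd (inj₁ (clique {i = suc i} {suc j} (h ∘ suc-injective)))
  S⇒Edge (inj₂ (i , true)) (inj₂ (j , true)) h = fwd (inj₂ (clique {i = suc i} {suc j} (h ∘ suc-injective)))

  π : Extended G 3 → Fin order
  π (inj₁ x) = x
  π (inj₂ (_ , false)) = w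
  π (inj₂ (_ , true)) = θ w

  module Realised {H : ℤ₂Graph} (r : H Realises extend G 3 R) where
    open Realisation {H} {G} {3} {R} r
    open _Realises_ r using (bijection)
    open Inverse bijection using (to; from; strictlyInverseˡ)

    h = ℤ₂Graph.adj H

    H-involutive : Involutive h (ℤ₂Graph.θ H)
    H-involutive = realised-involutive inv λ {P} r → opp P (R⇒S r)
      where
      opp : ∀ P → ¬ S P (τ G P)
      opp (inj₁ x) e = ~̸θ x (proj₁ e)
      opp (inj₂ (_ , false)) ()
      opp (inj₂ (_ , true)) ()

    open Parts bijection (pairs↔ 3) {h} (ℤ₂Graph.adj-sym H)

    h⇔S : ∀ P Q → T (h (from P) (from Q)) ⇔ S P Q
    h⇔S P Q = mk⇔ (λ e → Edge⇒S (Equivalence.to (~⇔Edge P Q) e)) (λ s → Equivalence.from (~⇔Edge P Q) (S⇒Edge P Q s))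

    h-ind : ∀ P Q → Ind ⟦ h (from P) (from Q) ⟧ (S P Q)
    h-ind P Q = ind-map (Equivalence.to (h⇔S P Q)) (Equivalence.from (h⇔S P Q)) (ind-Bool _)

    pull : Sub order → Sub (ℤ₂Graph.order H)
    pull X v = X (π (to v))

    pull-from : ∀ X P → pull X (from P) ≡ X (π P)
    pull-from X P = cong (X ∘ π) (strictlyInverseˡ P)

    -- Blowing a vertex up into a K₄ adds three vertices and six edges, and 4·3 - 2·6 = 0. Each
    -- redistributed edge keeps both its ends inside or outside the pulled-back set.
    F-pull : ∀ X → F h (pull X) ≡ F adj X
    F-pull X = trans (F-parts Z) (trans (cong₂ (λ u v → F (h ↾ ι) (Z ∘ ι) + u + + 4 - + 2 * v) fresh across)
        (trans (cong (λ f → f + (+ 4 * (+ 3 * p + + 3 * q) - + 4 - (+ 6 * p + + 6 * q)) + + 4 - + 2 * (p * (+ 3 * p + weight X) + q * (+ 3 * q + weight′ X)))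
            (trans (F-cong (h ↾ ι) λ x → pull-from X (inj₁ x)) (F-star (h⇔S _ _) X)))
          (alg (F adj X) p q (weight X) (weight′ X) (⟦⟧-idem (X w)) (⟦⟧-idem (X (θ w))))))
      where
      Z = pull X
      p = ⟦ X w ⟧
      q = ⟦ X (θ w) ⟧
      alg : ∀ f p q m m′ → p * p ≡ p → q * q ≡ q →
        f + + 2 * (p * m) + + 2 * (q * m′) + (+ 4 * (+ 3 * p + + 3 * q) - + 4 - (+ 6 * p + + 6 * q)) + + 4 - + 2 * (p * (+ 3 * p + m) + q * (+ 3 * q + m′)) ≡ f
      alg f p q m m′ pp qq = trans (cong₂ (λ x y → f + + 2 * (p * m) + + 2 * (q * m′) + (+ 4 * (+ 3 * p + + 3 * q) - + 4 - (+ 6 * p + + 6 * q)) + + 4 - + 2 * (x + y)) (absorb p m pp) (absorb q m′ qq))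
        (linear f p q (p * m) (q * m′))
        where
        absorb : ∀ p m → p * p ≡ p → p * (+ 3 * p + m) ≡ + 3 * p + p * m
        absorb p m e = trans (expand p m) (cong (λ z → + 3 * z + p * m) e)
          where
          expand : ∀ p m → p * (+ 3 * p + m) ≡ + 3 * (p * p) + p * m
          expand = solve-∀
        linear : ∀ f p q x y → f + + 2 * x + + 2 * y + (+ 4 * (+ 3 * p + + 3 * q) - + 4 - (+ 6 * p + + 6 * q)) + + 4 - + 2 * ((+ 3 * p + x) + (+ 3 * q + y)) ≡ f
        linear = solve-∀
      u-at : ∀ P Q → ⟦ h (from P) (from Q) ⟧ * (⟦ Z (from P) ⟧ * ⟦ Z (from Q) ⟧) ≡ ⟦ h (from P) (from Q) ⟧ * (⟦ X (π P) ⟧ * ⟦ X (π Q) ⟧)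
      u-at P Q = cong₂ (λ b c → ⟦ h (from P) (from Q) ⟧ * (⟦ b ⟧ * ⟦ c ⟧)) (pull-from X P) (pull-from X Q)
      u : Fin 3 × Bool → Fin 3 × Bool → ℤ
      u b c = ⟦ h (from (inj₂ b)) (from (inj₂ c)) ⟧ * (⟦ Z (from (inj₂ b)) ⟧ * ⟦ Z (from (inj₂ c)) ⟧)
      -- Both new cliques meet the old vertices in the same pattern, up to the involution f.
      rows : ∀ b (f : Fin order → Fin order) p → (∀ i x → Ind ⟦ h (from (inj₂ (i , b))) (ι x) ⟧ (L i (f x))) → (∀ i → π (inj₂ (i , b)) ≡ p) →
        (∀ x → δ w (f x) ≡ δ p x) →
        ∑ (λ i → ∑ λ x → ⟦ h (from (inj₂ (i , b))) (ι x) ⟧ * (⟦ Z (from (inj₂ (i , b))) ⟧ * ⟦ Z (ι x) ⟧)) ≡ ⟦ X p ⟧ * (+ 3 * ⟦ X p ⟧ + ∑ λ x → moved (f x) * ⟦ X x ⟧)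
      rows b f p ind πp δ≡ = trans (∑-swap λ i x → ⟦ h (from (inj₂ (i , b))) (ι x) ⟧ * (⟦ Z (from (inj₂ (i , b))) ⟧ * ⟦ Z (ι x) ⟧)) (trans (∑-cong col)
          (trans (∑-* ⟦ X p ⟧ λ x → (+ 3 * δ p x + moved (f x)) * ⟦ X x ⟧) (cong (⟦ X p ⟧ *_)
            (trans (∑-cong λ x → dist (δ p x) (moved (f x)) ⟦ X x ⟧) (trans (∑-+ (λ x → + 3 * (δ p x * ⟦ X x ⟧)) (λ x → moved (f x) * ⟦ X x ⟧))
              (cong (λ z → z + ∑ λ x → moved (f x) * ⟦ X x ⟧) (trans (∑-* (+ 3) λ x → δ p x * ⟦ X x ⟧) (cong (+ 3 *_) (∑-δ p λ x → ⟦ X x ⟧)))))))))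
        where
        dist : ∀ d e s → (+ 3 * d + e) * s ≡ + 3 * (d * s) + e * s
        dist = solve-∀
        assoc : ∀ a b c → a * (b * c) ≡ (b * c) * a
        assoc = solve-∀
        swap-last : ∀ a b c → a * b * c ≡ a * (c * b)
        swap-last = solve-∀
        entries : ∀ x → ∑ (λ i → ⟦ h (from (inj₂ (i , b))) (ι x) ⟧) ≡ + 3 * δ p x + moved (f x)
        entries x = trans (∑-cong λ i → ind-unique (ind i x) (ind-⊎ (ind-δ w (f x)) (ind-× (ind-Bool (adj w (f x))) (ind-δ (d (f x)) (suc i)))
            λ { e (e′ , _) → Involutive.a-irr inv w (subst (w ~_) e e′) }))
          (trans (∑-+ (λ _ → δ w (f x)) (λ i → ⟦ adj w (f x) ⟧ * δ (d (f x)) (suc i)))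
            (cong₂ _+_ (trans (∑-const 3 (δ w (f x))) (cong (+ 3 *_) (δ≡ x))) (∑-* ⟦ adj w (f x) ⟧ λ i → δ (d (f x)) (suc i))))
        col : ∀ x → ∑ (λ i → ⟦ h (from (inj₂ (i , b))) (ι x) ⟧ * (⟦ Z (from (inj₂ (i , b))) ⟧ * ⟦ Z (ι x) ⟧)) ≡ ⟦ X p ⟧ * ((+ 3 * δ p x + moved (f x)) * ⟦ X x ⟧)
        col x = trans (∑-cong λ i → trans (u-at (inj₂ (i , b)) (inj₁ x)) (trans (cong (λ z → ⟦ h (from (inj₂ (i , b))) (ι x) ⟧ * (⟦ X z ⟧ * ⟦ X x ⟧)) (πp i)) (assoc ⟦ h (from (inj₂ (i , b))) (ι x) ⟧ ⟦ X p ⟧ ⟦ X x ⟧)))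
          (trans (∑-* (⟦ X p ⟧ * ⟦ X x ⟧) λ i → ⟦ h (from (inj₂ (i , b))) (ι x) ⟧)
          (trans (cong (⟦ X p ⟧ * ⟦ X x ⟧ *_) (entries x)) (swap-last ⟦ X p ⟧ ⟦ X x ⟧ (+ 3 * δ p x + moved (f x)))))
      δ-θ : ∀ x → δ w (θ x) ≡ δ (θ w) x
      δ-θ x = ind-unique (ind-δ w (θ x)) (ind-map (λ { refl → θ-inv w }) (λ { refl → sym (θ-inv x) }) (ind-δ (θ w) x))
      across : cross Z ≡ p * (+ 3 * p + weight X) + q * (+ 3 * q + weight′ X)
      across = trans (∑-pairs 3 λ b → ∑ λ x → ⟦ h (from (inj₂ b)) (ι x) ⟧ * (⟦ Z (from (inj₂ b)) ⟧ * ⟦ Z (ι x) ⟧)) (cong₂ _+_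
        (rows false id w (λ i x → h-ind (inj₂ (i , false)) (inj₁ x)) (λ _ → refl) (λ _ → refl))
        (rows true θ (θ w) (λ i x → h-ind (inj₂ (i , true)) (inj₁ x)) (λ _ → refl) δ-θ))
      ind-≢ : ∀ (i j : Fin 3) → Ind ⟦ not (does (i ≟ j)) ⟧ (i ≢ j)
      ind-≢ i j with i ≟ j
      ... | yes e = inj₂ (refl , λ h → h e)
      ... | no h = inj₁ (refl , h)
      cliques : ∀ b p → (∀ i → π (inj₂ (i , b)) ≡ p) → (∀ i j → S (inj₂ (i , b)) (inj₂ (j , b)) ≡ (i ≢ j)) →
        ∑ (λ i → ∑ λ j → u (i , b) (j , b)) ≡ + 6 * ⟦ X p ⟧
      cliques b p πp S≡ = trans (∑-cong λ i → trans (∑-cong λ j → entry i j) (∑-* ⟦ X p ⟧ λ j → ⟦ not (does (i ≟ j)) ⟧))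
        (trans (∑-* ⟦ X p ⟧ λ i → ∑ λ j → ⟦ not (does (i ≟ j)) ⟧) (trans (cong (⟦ X p ⟧ *_) ∑-K₃) (ℤ.*-comm ⟦ X p ⟧ (+ 6))))
        where
        entry : ∀ i j → u (i , b) (j , b) ≡ ⟦ X p ⟧ * ⟦ not (does (i ≟ j)) ⟧
        entry i j = trans (u-at (inj₂ (i , b)) (inj₂ (j , b))) (trans (cong₂ (λ s t → ⟦ h (from (inj₂ (i , b))) (from (inj₂ (j , b))) ⟧ * (⟦ X s ⟧ * ⟦ X t ⟧)) (πp i) (πp j))
          (trans (cong₂ _*_ (ind-unique (subst (Ind _) (S≡ i j) (h-ind (inj₂ (i , b)) (inj₂ (j , b)))) (ind-≢ i j)) (⟦⟧-idem (X p)))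
            (ℤ.*-comm ⟦ not (does (i ≟ j)) ⟧ ⟦ X p ⟧)))
      separate : ∀ b c → (∀ i j → ¬ S (inj₂ (i , b)) (inj₂ (j , c))) → ∑ (λ i → ∑ λ j → u (i , b) (j , c)) ≡ 0ℤ
      separate b c h = trans (∑-cong λ i → trans (∑-cong λ j → cong (_* (⟦ Z (from (inj₂ (i , b))) ⟧ * ⟦ Z (from (inj₂ (j , c))) ⟧))
        (⟦⟧-false (h i j ∘ Equivalence.to (h⇔S (inj₂ (i , b)) (inj₂ (j , c)))))) (∑-0 3)) (∑-0 3)
      fresh : F (h ↾ σ) (Z ∘ σ) ≡ + 4 * (+ 3 * p + + 3 * q) - + 4 - (+ 6 * p + + 6 * q)
      fresh = trans (F-def (h ↾ σ) (Z ∘ σ)) (cong₂ (λ s l → + 4 * s - + 4 - l)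
        (trans (∑-pairs 3 λ b → ⟦ Z (from (inj₂ b)) ⟧) (cong₂ _+_
          (trans (∑-cong λ i → cong ⟦_⟧ (pull-from X (inj₂ (i , false)))) (∑-const 3 p))
          (trans (∑-cong λ i → cong ⟦_⟧ (pull-from X (inj₂ (i , true)))) (∑-const 3 q))))
        (trans (∑-pairs 3 λ b → ∑ (u b ∘ Inverse.to (pairs↔ 3))) (cong₂ _+_ (half false (+ 6 * p) 0ℤ (cliques false w (λ _ → refl) (λ _ _ → refl)) (separate false true λ _ _ h → h) (ℤ.+-identityʳ (+ 6 * p)))
          (half true 0ℤ (+ 6 * q) (separate true false λ _ _ h → h) (cliques true (θ w) (λ _ → refl) (λ _ _ → refl)) (ℤ.+-identityˡ (+ 6 * q))))))
        where
        half : ∀ b x y {z} → ∑ (λ i → ∑ λ j → u (i , b) (j , false)) ≡ x → ∑ (λ i → ∑ λ j → u (i , b) (j , true)) ≡ y → x + y ≡ z →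
          ∑ (λ i → ∑ (u (i , b) ∘ Inverse.to (pairs↔ 3))) ≡ z
        half b x y e f g = trans (∑-cong λ i → ∑-pairs 3 (u (i , b))) (trans (∑-+ (λ i → ∑ λ j → u (i , b) (j , false)) (λ i → ∑ λ j → u (i , b) (j , true)))
          (trans (cong₂ _+_ e f) g))

    ∣pull-single∣ : ∀ p → p ≡ w ⊎ p ≡ θ w → ∣ pull (single p) ∣ₛ ≤ + 4
    ∣pull-single∣ p h = ≤-reflexive (trans (∑-split bijection (pairs↔ 3) λ v → ⟦ pull (single p) v ⟧) (trans (cong₂ _+_
        (trans (∑-cong λ x → cong ⟦_⟧ (pull-from (single p) (inj₁ x))) (∣single∣ p))
        (trans (∑-pairs 3 λ b → ⟦ pull (single p) (from (inj₂ b)) ⟧) (cong₂ _+_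
          (trans (∑-cong λ i → cong ⟦_⟧ (pull-from (single p) (inj₂ (i , false)))) (∑-const 3 (δ p w)))
          (trans (∑-cong λ i → cong ⟦_⟧ (pull-from (single p) (inj₂ (i , true)))) (∑-const 3 (δ p (θ w)))))))
      (cong (λ z → 1ℤ + z) (trans (sym (ℤ.*-distribˡ-+ (+ 3) (δ p w) (δ p (θ w)))) (cong (+ 3 *_) (one h))))))
      where
      one : p ≡ w ⊎ p ≡ θ w → δ p w + δ p (θ w) ≡ 1ℤ
      one (inj₁ refl) = cong₂ _+_ (ind-unique (ind-δ w w) (inj₁ (refl , refl))) (ind-unique (ind-δ w (θ w)) (inj₂ (refl , θ-free w)))
      one (inj₂ refl) = cong₂ _+_ (ind-unique (ind-δ (θ w) w) (inj₂ (refl , w≢θw))) (ind-unique (ind-δ (θ w) (θ w)) (inj₁ (refl , refl)))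

    preserves : Ci adj θ → CiTight H
    preserves c = Ci⇒CiTight H record
      { involutive = H-involutive
      ; sparse = λ Z {v} v∈Z → sp Z v v∈Z
      ; tight = trans (F-pull full) (Ci.tight c)
      }
      where
      Hgr = Involutive.graphical H-involutive
      K₁ K₂ : Sub (ℤ₂Graph.order H)
      K₁ = pull (single w)
      K₂ = pull (single (θ w))
      module _ {Y Y′ : Sub (ℤ₂Graph.order H)} (flat : ∀ {x y} → T (K₁ x) → T (K₁ y) → Y x ≡ Y y)
        (off : ∀ {x} → ¬ T (K₂ x) → Y′ x ≡ Y x) (flat′ : ∀ {x y} → T (K₂ x) → T (K₂ y) → Y′ x ≡ Y′ y) where
        in-K : ∀ p P → π P ≡ p → T (pull (single p) (from P))
        in-K p P refl = subst T (sym (pull-from (single p) P)) (single-∈ p)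
        not-in : ∀ P → π P ≡ w → ¬ T (K₂ (from P))
        not-in P e h = w≢θw (trans (sym e) (single-∋ (θ w) (subst T (pull-from (single (θ w)) P) h)))
        at : ∀ P → Y′ (ι (π P)) ≡ Y′ (from P)
        at (inj₁ x) = refl
        at (inj₂ (i , false)) = trans (off (not-in (inj₁ w) refl)) (trans (flat (in-K w (inj₁ w) refl) (in-K w (inj₂ (i , false)) refl))
          (sym (off (not-in (inj₂ (i , false)) refl))))
        at (inj₂ (i , true)) = flat′ (in-K (θ w) (inj₁ (θ w)) refl) (in-K (θ w) (inj₂ (i , true)) refl)
        pulled : ∀ v → pull (Y′ ∘ ι) v ≡ Y′ v
        pulled v = trans (at (to v)) (cong Y′ (Inverse.strictlyInverseʳ bijection v))
        0≤F : ∀ {v} → T (Y′ v) → 0ℤ ≤ F h Y′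
        0≤F {v} t = subst (0ℤ ≤_) (trans (sym (F-pull (Y′ ∘ ι))) (F-cong h pulled)) (Ci.sparse c (Y′ ∘ ι) {π (to v)} (subst T (sym (pulled v)) t))
      -- Fill the clique at w and then the one at `θ w`. They are disjoint, so the second filling
      -- leaves the first intact; the result is the pullback of its own trace and `F-pull` applies.
      sp : ∀ Z v → T (Z v) → 0ℤ ≤ F h Z
      sp Z v v∈Z = case fill Hgr K₁ (trans (F-pull (single w)) (F-single w)) (∣pull-single∣ w (inj₁ refl)) Z of λ
        (Y , Z⊆Y , F≤ , _ , flat) → case fill Hgr K₂ (trans (F-pull (single (θ w))) (F-single (θ w))) (∣pull-single∣ (θ w) (inj₂ refl)) Y of λ
        (Y′ , Y⊆Y′ , F≤′ , off , flat′) → ≤-trans (0≤F {Y} {Y′} flat off flat′ (Y⊆Y′ (Z⊆Y v∈Z))) (≤-trans F≤′ F≤)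

module Join (G₁ G₂ : ℤ₂Graph) (c₁ : Ci (ℤ₂Graph.adj G₁) (ℤ₂Graph.θ G₁)) (c₂ : Ci (ℤ₂Graph.adj G₂) (ℤ₂Graph.θ G₂))
  (x : Fin (ℤ₂Graph.order G₁)) (y : Fin (ℤ₂Graph.order G₂)) where

  open ℤ₂Graph G₁ using () renaming (order to m₁; adj to a₁; θ to θ₁)
  open ℤ₂Graph G₂ using () renaming (order to m₂; adj to a₂; θ to θ₂)
  module C₁ = Ci c₁
  module C₂ = Ci c₂

  joint = join G₁ G₂ x y
  open Presentation joint using (Edge) renaming (τ to σ)

  Cross : Fin m₁ → Fin m₂ → Set
  Cross u v = (u ≡ x × v ≡ y) ⊎ (u ≡ θ₁ x × v ≡ θ₂ y)

  S : Fin m₁ ⊎ Fin m₂ → Fin m₁ ⊎ Fin m₂ → Set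
  S (inj₁ u) (inj₁ v) = T (a₁ u v)
  S (inj₂ u) (inj₂ v) = T (a₂ u v)
  S (inj₁ u) (inj₂ v) = Cross u v
  S (inj₂ v) (inj₁ u) = Cross u v

  Cross-θ : ∀ {u v} → Cross (θ₁ u) (θ₂ v) → Cross u v
  Cross-θ {u} {v} (inj₁ (refl , refl)) = inj₂ (sym (C₁.θ-inv u) , sym (C₂.θ-inv v))
  Cross-θ (inj₂ (e , f)) = inj₁ (C₁.θ-injective e , C₂.θ-injective f)

  S-sym : ∀ {p q} → S p q → S q p
  S-sym {inj₁ u} {inj₁ v} = C₁.~-sym
  S-sym {inj₂ u} {inj₂ v} = C₂.~-sym
  S-sym {inj₁ u} {inj₂ v} h = h
  S-sym {inj₂ u} {inj₁ v} h = h

  S-σ : ∀ {p q} → S (σ p) (σ q) → S p q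
  S-σ {inj₁ u} {inj₁ v} = subst T (C₁.θ-auto u v)
  S-σ {inj₂ u} {inj₂ v} = subst T (C₂.θ-auto u v)
  S-σ {inj₁ u} {inj₂ v} = Cross-θ
  S-σ {inj₂ u} {inj₁ v} = Cross-θ

  R⇒S : ∀ {p q} → JoinR G₁ G₂ x y p q → S p q
  R⇒S (left e) = e
  R⇒S (right e) = e
  R⇒S xy = inj₁ (refl , refl)

  Edge⇒S : ∀ {p q} → Edge p q → S p q
  Edge⇒S (fwd (inj₁ r)) = R⇒S r
  Edge⇒S {p} {q} (fwd (inj₂ r)) = S-σ {p} {q} (R⇒S r)
  Edge⇒S {p} {q} (bwd (inj₁ r)) = S-sym {q} {p} (R⇒S r)
  Edge⇒S {p} {q} (bwd (inj₂ r)) = S-sym {q} {p} (S-σ {q} {p} (R⇒S r))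

  Cross⇒R : ∀ {u v} → Cross u v → JoinR G₁ G₂ x y (inj₁ u) (inj₂ v) ⊎ JoinR G₁ G₂ x y (inj₁ (θ₁ u)) (inj₂ (θ₂ v))
  Cross⇒R (inj₁ (refl , refl)) = inj₁ xy
  Cross⇒R (inj₂ (refl , refl)) = inj₂ (subst₂ (λ u v → JoinR G₁ G₂ x y (inj₁ u) (inj₂ v)) (sym (C₁.θ-inv x)) (sym (C₂.θ-inv y)) xy)

  S⇒Edge : ∀ p q → S p q → Edge p q
  S⇒Edge (inj₁ u) (inj₁ v) e = fwd (inj₁ (left e))
  S⇒Edge (inj₂ u) (inj₂ v) e = fwd (inj₁ (right e))
  S⇒Edge (inj₁ u) (inj₂ v) h = fwd (Cross⇒R h)
  S⇒Edge (inj₂ v) (inj₁ u) h = bwd (Cross⇒R h)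

  module _ {H : ℤ₂Graph} (r : H Realises joint) where
    open _Realises_ r
    open Inverse bijection using (to; from; strictlyInverseˡ; strictlyInverseʳ)

    private
      h = ℤ₂Graph.adj H
      θ = ℤ₂Graph.θ H

    h⇔S : ∀ p q → T (h (from p) (from q)) ⇔ S p q
    h⇔S p q = mk⇔
      (λ e → Edge⇒S (subst₂ Edge (strictlyInverseˡ p) (strictlyInverseˡ q) (Equivalence.to (edges (from p) (from q)) e)))
      (λ s → Equivalence.from (edges (from p) (from q)) (subst₂ Edge (sym (strictlyInverseˡ p)) (sym (strictlyInverseˡ q)) (S⇒Edge p q s)))

    H-involutive : Involutive h θ
    H-involutive = record
      { graphical = graphical (ℤ₂Graph.graph H)
      ; θ-inv = ℤ₂Graph.θ-inv H
      ; θ-auto = ℤ₂Graph.θ-auto H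
      ; θ-free = λ v e → free (to v) (trans (sym (equivariant v)) (cong to e))
      ; ~̸θ = λ v e → opp (to v) (subst (S (to v)) (equivariant v) (Edge⇒S (Equivalence.to (edges v (θ v)) e)))
      }
      where
      free : ∀ p → σ p ≢ p
      free (inj₁ u) e = C₁.θ-free u (inj₁-injective e)
      free (inj₂ u) e = C₂.θ-free u (inj₂-injective e)
      opp : ∀ p → ¬ S p (σ p)
      opp (inj₁ u) = C₁.~̸θ u
      opp (inj₂ u) = C₂.~̸θ u

    open Involutive H-involutive using (a-sym)

    open Parts bijection (mk↔ₛ′ id id (λ _ → refl) λ _ → refl) {h} a-sym renaming (ι to ι₁; σ to ι₂)

    joined : Sub m₁ → Sub m₂ → ℤ
    joined X Y = ⟦ X x ⟧ * ⟦ Y y ⟧ + ⟦ X (θ₁ x) ⟧ * ⟦ Y (θ₂ y) ⟧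

    -- Two nonempty parts leave a surplus of 4, and at most two joining edges draw on it at 2 each.
    -- On the full vertex set both are present and the surplus is used up exactly.
    F-join : ∀ Z → F h Z ≡ F a₁ (Z ∘ ι₁) + F a₂ (Z ∘ ι₂) + + 4 - + 2 * joined (Z ∘ ι₁) (Z ∘ ι₂)
    F-join Z = trans (F-parts Z) (cong₂ (λ (f , g) c → f + g + + 4 - + 2 * c) (cong₂ _,_
        (F-matrix-cong (λ v w → T⇔≡ (Equivalence.to (h⇔S (inj₁ v) (inj₁ w))) (Equivalence.from (h⇔S (inj₁ v) (inj₁ w)))) (Z ∘ ι₁))
        (F-matrix-cong (λ v w → T⇔≡ (Equivalence.to (h⇔S (inj₂ v) (inj₂ w))) (Equivalence.from (h⇔S (inj₂ v) (inj₂ w)))) (Z ∘ ι₂))) across)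
      where
      across : cross Z ≡ joined (Z ∘ ι₁) (Z ∘ ι₂)
      across = trans (∑-cong λ w → trans (∑-cong λ v → trans (cong (_* (⟦ Z (ι₂ w) ⟧ * ⟦ Z (ι₁ v) ⟧)) (cross-δ w v))
            (dist (δ x v) (δ y w) (δ (θ₁ x) v) (δ (θ₂ y) w) ⟦ Z (ι₂ w) ⟧ ⟦ Z (ι₁ v) ⟧))
          (trans (∑-+ (λ v → δ x v * (⟦ Z (ι₁ v) ⟧ * (δ y w * ⟦ Z (ι₂ w) ⟧))) (λ v → δ (θ₁ x) v * (⟦ Z (ι₁ v) ⟧ * (δ (θ₂ y) w * ⟦ Z (ι₂ w) ⟧))))
            (cong₂ _+_ (row x y w) (row (θ₁ x) (θ₂ y) w))))
        (trans (∑-+ (λ w → ⟦ Z (ι₁ x) ⟧ * (δ y w * ⟦ Z (ι₂ w) ⟧)) (λ w → ⟦ Z (ι₁ (θ₁ x)) ⟧ * (δ (θ₂ y) w * ⟦ Z (ι₂ w) ⟧)))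
          (cong₂ _+_ (column x y) (column (θ₁ x) (θ₂ y))))
        where
        cross-δ : ∀ w v → ⟦ h (ι₂ w) (ι₁ v) ⟧ ≡ δ x v * δ y w + δ (θ₁ x) v * δ (θ₂ y) w
        cross-δ w v = ind-unique (ind-map (Equivalence.to (h⇔S (inj₂ w) (inj₁ v))) (Equivalence.from (h⇔S (inj₂ w) (inj₁ v))) (ind-Bool (h (ι₂ w) (ι₁ v))))
          (ind-⊎ (ind-× (ind-δ x v) (ind-δ y w)) (ind-× (ind-δ (θ₁ x) v) (ind-δ (θ₂ y) w))
            λ { (refl , _) (e , _) → C₁.θ-free x (sym e) })
        dist : ∀ a b c d s t → (a * b + c * d) * (s * t) ≡ a * (t * (b * s)) + c * (t * (d * s))
        dist = solve-∀
        row : ∀ p q w → ∑ (λ v → δ p v * (⟦ Z (ι₁ v) ⟧ * (δ q w * ⟦ Z (ι₂ w) ⟧))) ≡ ⟦ Z (ι₁ p) ⟧ * (δ q w * ⟦ Z (ι₂ w) ⟧)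
        row p q w = ∑-δ p λ v → ⟦ Z (ι₁ v) ⟧ * (δ q w * ⟦ Z (ι₂ w) ⟧)
        column : ∀ p q → ∑ (λ w → ⟦ Z (ι₁ p) ⟧ * (δ q w * ⟦ Z (ι₂ w) ⟧)) ≡ ⟦ Z (ι₁ p) ⟧ * ⟦ Z (ι₂ q) ⟧
        column p q = trans (∑-* ⟦ Z (ι₁ p) ⟧ λ w → δ q w * ⟦ Z (ι₂ w) ⟧) (cong (⟦ Z (ι₁ p) ⟧ *_) (∑-δ q λ w → ⟦ Z (ι₂ w) ⟧))

    preserves : CiTight H
    preserves = Ci⇒CiTight H record
      { involutive = H-involutive
      ; sparse = λ Z {v} v∈Z → sp Z v v∈Z
      ; tight = trans (F-join full) (trans (cong₂ (λ u v → u + v + + 4 - + 2 * + 2) C₁.tight C₂.tight) refl)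
      }
      where
      empty? : ∀ {n} (X : Sub n) → (∃ λ x → T (X x)) ⊎ (∀ x → X x ≡ false)
      empty? X with any? (λ x → T? (X x))
      ... | yes p = inj₁ p
      ... | no none = inj₂ λ x → T⇔≡ (λ t → none (x , t)) λ ()
      four : ∀ a b c d → 0ℤ ≤ + 4 - + 2 * (⟦ a ⟧ * ⟦ b ⟧ + ⟦ c ⟧ * ⟦ d ⟧)
      four = from-yes (∀Bool? λ a → ∀Bool? λ b → ∀Bool? λ c → ∀Bool? λ d → 0ℤ ℤ.≤? + 4 - + 2 * (⟦ a ⟧ * ⟦ b ⟧ + ⟦ c ⟧ * ⟦ d ⟧))
      F-empty : ∀ {n} (a : Matrix n) X → (∀ x → X x ≡ false) → F a X ≡ - + 4
      F-empty a X e = trans (F-cong a e) (F-∅ {a = a})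
      sp : ∀ Z v → T (Z v) → 0ℤ ≤ F h Z
      sp Z v v∈Z with empty? (Z ∘ ι₁) | empty? (Z ∘ ι₂)
      ... | inj₁ (_ , p) | inj₁ (_ , q) = 0≤-by _ (0≤+ (0≤+ (C₁.sparse (Z ∘ ι₁) p) (C₂.sparse (Z ∘ ι₂) q)) (four (Z (ι₁ x)) (Z (ι₂ y)) (Z (ι₁ (θ₁ x))) (Z (ι₂ (θ₂ y)))))
        (trans (F-join Z) (assoc (F a₁ (Z ∘ ι₁)) (F a₂ (Z ∘ ι₂)) (joined (Z ∘ ι₁) (Z ∘ ι₂))))
        where
        assoc : ∀ a b c → a + b + + 4 - + 2 * c ≡ a + b + (+ 4 - + 2 * c)
        assoc = solve-∀
      -- An empty side has `F` equal to -4, which the `+ 4` cancels, and no joining edge has both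
      -- ends in the set.
      ... | inj₁ (_ , p) | inj₂ e = 0≤-by _ (C₁.sparse (Z ∘ ι₁) p) (trans (F-join Z) (trans
          (cong₂ (λ u j → F a₁ (Z ∘ ι₁) + u + + 4 - + 2 * j) (F-empty a₂ (Z ∘ ι₂) e)
            (trans (cong₂ (λ b c → ⟦ Z (ι₁ x) ⟧ * ⟦ b ⟧ + ⟦ Z (ι₁ (θ₁ x)) ⟧ * ⟦ c ⟧) (e y) (e (θ₂ y))) (zeros ⟦ Z (ι₁ x) ⟧ ⟦ Z (ι₁ (θ₁ x)) ⟧)))
          (cancel (F a₁ (Z ∘ ι₁)))))
        where
        zeros : ∀ a b → a * 0ℤ + b * 0ℤ ≡ 0ℤ
        zeros = solve-∀
        cancel : ∀ f → f + - + 4 + + 4 - + 2 * 0ℤ ≡ f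
        cancel = solve-∀
      ... | inj₂ e | inj₁ (_ , q) = 0≤-by _ (C₂.sparse (Z ∘ ι₂) q) (trans (F-join Z) (trans
          (cong₂ (λ u j → u + F a₂ (Z ∘ ι₂) + + 4 - + 2 * j) (F-empty a₁ (Z ∘ ι₁) e)
            (cong₂ (λ b c → ⟦ b ⟧ * ⟦ Z (ι₂ y) ⟧ + ⟦ c ⟧ * ⟦ Z (ι₂ (θ₂ y)) ⟧) (e x) (e (θ₁ x))))
          (cancel (F a₂ (Z ∘ ι₂)))))
        where
        cancel : ∀ f → - + 4 + f + + 4 - + 2 * 0ℤ ≡ f
        cancel = solve-∀
      ... | inj₂ e | inj₂ e′ = ⊥-elim (none (to v) (subst (T ∘ Z) (sym (strictlyInverseʳ v)) v∈Z))
        where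
        none : ∀ p → ¬ T (Z (from p))
        none (inj₁ u) = subst T (e u)
        none (inj₂ u) = subst T (e′ u)

-- Tight sets

≤⇒≱ : ∀ {x y} → x ≤ y → ¬ (y + 1ℤ ≤ x)
≤⇒≱ {x} {y} p q = ℤ.<-irrefl refl (ℤ.suc[i]≤j⇒i<j (≤-trans (≤-reflexive (ℤ.+-comm 1ℤ y)) (≤-trans q p)))

even-gap : ∀ {x} → (∃ λ z → x ≡ + 2 * z) → 0ℤ ≤ x → x ≢ 0ℤ → + 2 ≤ x
even-gap (+ 0 , refl) _ h = contradiction refl h
even-gap (+ suc k , refl) _ _ = subst (+ 2 ≤_) (ℤ.pos-* 2 (suc k)) (+≤+ (ℕ.*-monoʳ-≤ 2 (s≤s (z≤n {k}))))
even-gap (-[1+ k ] , refl) ()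

four-gap : ∀ {x} → (∃ λ z → x ≡ + 4 * z) → 0ℤ ≤ x → x ≢ 0ℤ → + 4 ≤ x
four-gap (+ 0 , refl) _ h = contradiction refl h
four-gap (+ suc k , refl) _ _ = subst (+ 4 ≤_) (ℤ.pos-* 4 (suc k)) (+≤+ (ℕ.*-monoʳ-≤ 4 (s≤s (z≤n {k}))))
four-gap (-[1+ k ] , refl) ()

∣∖single∣ : (X : Sub n) {v : Fin n} → T (X v) → ∣ X ∣ₛ ≡ 1ℤ + ∣ X ∖ single v ∣ₛ
∣∖single∣ X {v} h = trans (trans (∑-cong split-v) (∑-+ (λ x → δ v x) (λ x → ⟦ X x ∧ not (does (v ≟ x)) ⟧)))
  (cong (λ z → z + ∣ X ∖ single v ∣ₛ) (∣single∣ v))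
  where
  split-v : ∀ x → ⟦ X x ⟧ ≡ δ v x + ⟦ X x ∧ not (does (v ≟ x)) ⟧
  split-v x with v ≟ x
  ... | yes refl = trans (⟦⟧-true h) (cong (λ b → 1ℤ + ⟦ b ⟧) (sym (∧-zeroʳ (X v))))
  ... | no _ = trans (cong ⟦_⟧ (sym (∧-identityʳ (X x)))) (sym (ℤ.+-identityˡ ⟦ X x ∧ true ⟧))

1+-injective : ∀ {x y} → 1ℤ + x ≡ 1ℤ + y → x ≡ y
1+-injective {x} {y} e = trans (lem x) (trans (cong (λ z → z - 1ℤ) e) (sym (lem y)))
  where
  lem : ∀ x → x ≡ 1ℤ + x - 1ℤ
  lem = solve-∀

pick : (X : Sub n) → ∀ k → ∣ X ∣ₛ ≡ + suc k → ∃ λ v → T (X v) × ∣ X ∖ single v ∣ₛ ≡ + k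
pick {n} X k e with any? (λ x → T? (X x))
... | yes (v , h) = v , h , 1+-injective {∣ X ∖ single v ∣ₛ} {+ k} (trans (sym (∣∖single∣ X h)) (trans e (ℤ.pos-+ 1 k)))
... | no none = case trans (sym e) (trans (∑-cong λ x → ⟦⟧-false λ h → none (x , h)) (∑-0 n)) of λ ()

none-left : (X : Sub n) → ∣ X ∣ₛ ≡ 0ℤ → ∀ x → ¬ T (X x)
none-left X e x h = ≤⇒≱ (≤-reflexive e) (≤-trans (≤-reflexive (sym (⟦⟧-true h))) (≤∑-at x λ y → 0≤⟦ X y ⟧))

∖-elim : ∀ {X Y : Sub n} {x} → T (X x) → ¬ T ((X ∖ Y) x) → T (Y x)
∖-elim {X = X} {Y} {x} h k with Y x
... | true = tt
... | false = ⊥-elim (k (∧-i h tt))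

two-elements : (X : Sub n) → ∣ X ∣ₛ ≡ + 2 → ∃ λ x → ∃ λ y → x ≢ y × T (X x) × T (X y) × (∀ z → T (X z) → z ≡ x ⊎ z ≡ y)
two-elements X e with pick X 1 e
... | x , hx , ex with pick (X ∖ single x) 0 ex
...   | y , hy , ey = x , y , (λ { refl → not-e (∧-e₂ {X x} hy) (single-∈ x) }) , hx , ∧-e₁ hy , λ z hz → rest z hz
  where
  rest : ∀ z → T (X z) → z ≡ x ⊎ z ≡ y
  rest z hz with z ≟ x
  ... | yes e = inj₁ e
  ... | no z≢x = inj₂ (single-∋ y (∖-elim {X = X ∖ single x} {single y} (∧-i hz (not-i λ h → z≢x (single-∋ x h))) (none-left _ ey z)))

three-elements : (X : Sub n) → ∣ X ∣ₛ ≡ + 3 → ∃ λ x → ∃ λ y → ∃ λ z → x ≢ y × y ≢ z × x ≢ z × T (X x) × T (X y) × T (X z) ×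
  (∀ u → T (X u) → u ≡ x ⊎ u ≡ y ⊎ u ≡ z)
three-elements X e with pick X 2 e
... | x , hx , ex with two-elements (X ∖ single x) ex
...   | y , z , y≢z , hy , hz , all = x , y , z , (λ { refl → not-e (∧-e₂ {X x} hy) (single-∈ x) }) , y≢z ,
        (λ { refl → not-e (∧-e₂ {X x} hz) (single-∈ x) }) , hx , ∧-e₁ hy , ∧-e₁ hz , rest
  where
  rest : ∀ u → T (X u) → u ≡ x ⊎ u ≡ y ⊎ u ≡ z
  rest u hu with u ≟ x
  ... | yes e = inj₁ e
  ... | no u≢x = inj₂ (all u (∧-i hu (not-i λ h → u≢x (single-∋ x h))))

deg-full : (a : Matrix n) (v : Fin n) → deg a v full ≡ ∣ a v ∣ₛ
deg-full a v = ∑-cong λ x → ℤ.*-identityʳ ⟦ a v x ⟧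

pair : Fin n → Fin n → Fin 2 → Fin n
pair x y 0F = x
pair x y 1F = y

pair-injective : {x y : Fin n} → x ≢ y → ∀ {i j} → pair x y i ≡ pair x y j → i ≡ j
pair-injective h {0F} {0F} _ = refl
pair-injective h {0F} {1F} e = contradiction e h
pair-injective h {1F} {0F} e = contradiction (sym e) h
pair-injective h {1F} {1F} _ = refl

triple : Fin n → Fin n → Fin n → Fin 3 → Fin n
triple x y z 0F = x
triple x y z 1F = y
triple x y z 2F = z

triple-injective : {x y z : Fin n} → x ≢ y → y ≢ z → x ≢ z → ∀ {i j} → triple x y z i ≡ triple x y z j → i ≡ j
triple-injective h k l {0F} {0F} _ = refl
triple-injective h k l {0F} {1F} e = contradiction e h
triple-injective h k l {0F} {2F} e = contradiction e l
triple-injective h k l {1F} {0F} e = contradiction (sym e) h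
triple-injective h k l {1F} {1F} _ = refl
triple-injective h k l {1F} {2F} e = contradiction e k
triple-injective h k l {2F} {0F} e = contradiction (sym e) l
triple-injective h k l {2F} {1F} e = contradiction (sym e) k
triple-injective h k l {2F} {2F} _ = refl

module TightSets {a : Matrix n} {θ : Fin n → Fin n} (c : Ci a θ) where
  open Ci c

  IsTight : Sub n → Set
  IsTight X = F a X ≡ 0ℤ

  F≤0⇒tight : ∀ X {v} → T (X v) → F a X ≤ 0ℤ → IsTight X
  F≤0⇒tight X h le = ℤ.≤-antisym le (sparse X h)

  private
    sum-zero : ∀ {u i l} → 0ℤ ≤ u → 0ℤ ≤ i → 0ℤ ≤ l → u + i + + 2 * l ≡ 0ℤ → u ≤ 0ℤ × i ≤ 0ℤ
    sum-zero {u} {i} {l} pu pi pl e = ≤-by _ (0≤+ pi (0≤* {+ 2} (+≤+ z≤n) pl)) (trans (sym e) (assoc u i l)) ,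
      ≤-by _ (0≤+ pu (0≤* {+ 2} (+≤+ z≤n) pl)) (trans (sym e) (assoc′ u i l))
      where
      assoc : ∀ u i l → u + i + + 2 * l ≡ u + (i + + 2 * l)
      assoc = solve-∀
      assoc′ : ∀ u i l → u + i + + 2 * l ≡ i + (u + + 2 * l)
      assoc′ = solve-∀

  -- By `modular` three nonnegative terms sum to 0. The common element z makes the intersection
  -- nonempty, so that sparsity covers it too.
  tight-lattice : ∀ {X Y z} → IsTight X → IsTight Y → T (X z) → T (Y z) → IsTight (X ∪ Y) × IsTight (X ∩ Y)
  tight-lattice {X} {Y} {z} p q x y = case sum-zero (sparse (X ∪ Y) {z} (∨-i₁ x)) (sparse (X ∩ Y) {z} (∧-i x y)) (0≤link a (X ∖ Y) (Y ∖ X))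
      (trans (modular X Y) (cong₂ _+_ p q)) of λ (u , i) → F≤0⇒tight (X ∪ Y) {z} (∨-i₁ x) u , F≤0⇒tight (X ∩ Y) {z} (∧-i x y) i

  -- The union has `F` equal to 4 minus twice the number of joining edges, so two edges bring it
  -- down to 0.
  tight-disjoint : ∀ {X Y z} → IsTight X → IsTight Y → T (X z) → (∀ x → T (X x) → ¬ T (Y x)) → + 2 ≤ link a X Y → IsTight (X ∪ Y)
  tight-disjoint {X} {Y} p q x dis le = F≤0⇒tight (X ∪ Y) (∨-i₁ x) (≤-by _ (0≤* {+ 2} (+≤+ z≤n) (0≤- le))
    (trans (lem (link a X Y)) (cong (λ z → z + + 2 * (link a X Y - + 2)) (sym (trans (F-disjoint X Y dis) (cong₂ (λ u v → u + v + + 4 - + 2 * link a X Y) p q))))))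
    where
    lem : ∀ l → 0ℤ ≡ 0ℤ + 0ℤ + + 4 - + 2 * l + + 2 * (l - + 2)
    lem = solve-∀

  tight-insert : ∀ {X v} → IsTight X → + 2 ≤ deg a v X → IsTight (X ∪ single v)
  tight-insert {X} {v} p le with T? (X v)
  ... | yes h = trans (F-cong a λ x → T⇔≡ (λ t → [ id , (λ s → subst (T ∘ X) (sym (single-∋ v s)) h) ]′ (∨-e t)) ∨-i₁) p
  ... | no h = F≤0⇒tight (X ∪ single v) {v} (∨-i₂ {X v} (single-∈ v)) (≤-by _ (0≤* {+ 2} (+≤+ z≤n) (0≤- le))
    (trans (lem (deg a v X)) (cong (λ z → z + + 2 * (deg a v X - + 2)) (sym (trans (F-insert X v h) (cong (λ z → z + + 4 - + 2 * deg a v X) p))))))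
    where
    lem : ∀ d → 0ℤ ≡ 0ℤ + + 4 - + 2 * d + + 2 * (d - + 2)
    lem = solve-∀

  -- Inserting v would give `F` at most 4 - 2·3, against sparsity. Every exclusion around a vertex
  -- of degree 3 ends in this contradiction.
  tight-deg : ∀ {X v} → IsTight X → ¬ T (X v) → ¬ (+ 3 ≤ deg a v X)
  tight-deg {X} {v} p h le = ≤⇒≱ (sparse (X ∪ single v) {v} (∨-i₂ {X v} (single-∈ v)))
    (≤-by _ (0≤+ (0≤* {+ 2} (+≤+ z≤n) (0≤- le)) (+≤+ (z≤n {1})))
      (trans (lem (deg a v X)) (cong (λ z → z + 1ℤ + (+ 2 * (deg a v X - + 3) + 1ℤ)) (sym (trans (F-insert X v h) (cong (λ z → z + + 4 - + 2 * deg a v X) p))))))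
    where
    lem : ∀ d → 0ℤ ≡ 0ℤ + + 4 - + 2 * d + 1ℤ + (+ 2 * (d - + 3) + 1ℤ)
    lem = solve-∀

  tight-θ : ∀ {X} → IsTight X → IsTight (X ∘ θ)
  tight-θ {X} p = trans (F-θ X) p

  -- Without v, the tight graph leaves a set with `F` equal to 2 deg v - 4. It is nonempty, as it
  -- contains `θ v`, so this is nonnegative.
  deg≥2 : ∀ v → + 2 ≤ deg a v full
  deg≥2 v = ℤ.*-cancelˡ-≤-pos (+ 2) (deg a v full) (+ 2) (≤-by (F a X) (sparse X {θ v} (not-i λ h → θ-free v (single-∋ v h)))
    (lem (F a X) (deg a v full) (trans (sym tight) (trans (F-cong a λ x → sym (whole (single v x))) (trans (F-insert X v λ h → not-e h (single-∈ v)) (cong (λ z → F a X + + 4 - + 2 * z) deg-X))))))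
    where
    X : Sub n
    X x = not (single v x)
    whole : ∀ b → not b ∨ b ≡ true
    whole true = refl
    whole false = refl
    deg-X : deg a v X ≡ deg a v full
    deg-X = ∑-cong λ x → ind-unique (ind-× (ind-Bool (a v x)) (ind-Bool (X x)))
      (ind-map (λ (e , _) → e , not-i λ s → a-irr v (subst (T ∘ a v) (single-∋ v s) e)) (λ (e , _) → e , tt) (ind-× (ind-Bool (a v x)) (ind-Bool true)))
    lem : ∀ f d → 0ℤ ≡ f + + 4 - + 2 * d → + 2 * d ≡ + 2 * + 2 + f
    lem f d e = trans (lem₁ f d) (trans (cong (λ z → f + + 4 - z) (sym e)) (lem₂ f))
      where
      lem₁ : ∀ f d → + 2 * d ≡ f + + 4 - (f + + 4 - + 2 * d)
      lem₁ = solve-∀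
      lem₂ : ∀ f → f + + 4 - 0ℤ ≡ + 2 * + 2 + f
      lem₂ = solve-∀

-- Inverse operations

module Restrict {n} {b : Matrix n} {θ : Fin n → Fin n} (b-sym : ∀ x y → b x y ≡ b y x) (b-irr : ∀ x → ¬ T (b x x))
  (θ-inv : ∀ x → θ (θ x) ≡ x) (b-θ : ∀ x y → b (θ x) (θ y) ≡ b x y) (p : Sub n) (p-θ : ∀ {x} → T (p x) → T (p (θ x))) where

  open Enumeration (enumerate p) public

  private
    image-index : ∀ i → ∃ λ j → elem j ≡ θ (elem i)
    image-index i = index (θ (elem i)) (p-θ (elem-∈ i))

  θ↾ : Fin size → Fin size
  θ↾ i = proj₁ (image-index i)

  elem-θ : ∀ i → elem (θ↾ i) ≡ θ (elem i)
  elem-θ i = proj₂ (image-index i)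

  restricted : ℤ₂Graph
  restricted = record
    { order = size
    ; graph = record { adj = b ↾ elem ; adj-sym = λ i j → b-sym (elem i) (elem j) ; irrefl = λ i → T-irr (b-irr (elem i)) }
    ; θ = θ↾
    ; θ-inv = λ i → elem-injective (trans (elem-θ (θ↾ i)) (trans (cong θ (elem-θ i)) (θ-inv (elem i))))
    ; θ-auto = λ i j → trans (cong₂ b (elem-θ i) (elem-θ j)) (b-θ (elem i) (elem j))
    }

  restricted-involutive : (∀ x → T (p x) → θ x ≢ x) → (∀ x → T (p x) → ¬ T (b x (θ x))) → Involutive (ℤ₂Graph.adj restricted) (ℤ₂Graph.θ restricted)
  restricted-involutive free opp = record
    { graphical = graphical (ℤ₂Graph.graph restricted)
    ; θ-inv = ℤ₂Graph.θ-inv restricted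
    ; θ-auto = ℤ₂Graph.θ-auto restricted
    ; θ-free = λ i e → free (elem i) (elem-∈ i) (trans (sym (elem-θ i)) (cong elem e))
    ; ~̸θ = λ i e → opp (elem i) (elem-∈ i) (subst (T ∘ b (elem i)) (elem-θ i) e)
    }

size-split : (i : Fin n ↔ (Fin m ⊎ A)) (j : Fin k ↔ A) → n ≡ m ℕ.+ k
size-split {n} {m} {k = k} i j = ℤ.+-injective (trans (sym (∣full∣ n)) (trans (∑-split i j λ _ → 1ℤ) (trans (cong₂ _+_ (∣full∣ m) (∣full∣ k)) (sym (ℤ.pos-+ m k)))))

smaller : n ≡ m ℕ.+ suc k → m ℕ.< n
smaller {m = m} {k} refl = ℕ.m<m+n m (s≤s z≤n)

module Delete (H : ℤ₂Graph) (c : Ci (ℤ₂Graph.adj H) (ℤ₂Graph.θ H)) (v : Fin (ℤ₂Graph.order H)) where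
  open ℤ₂Graph H
  open Ci c using (θ-free; ~̸θ; θ-injective; deg-θ; tight)

  other : Sub order
  other x = not (does (v ≟ x)) ∧ not (does (θ v ≟ x))

  other-i : ∀ {x} → x ≢ v → x ≢ θ v → T (other x)
  other-i {x} p q = ∧-i (not-i λ h → p (sym (T-does (v ≟ x) h))) (not-i λ h → q (sym (T-does (θ v ≟ x) h)))

  other-≢ : ∀ {x} → T (other x) → x ≢ v
  other-≢ {x} h e = not-e {does (v ≟ x)} (∧-e₁ h) (does-T (v ≟ x) (sym e))

  other-≢θ : ∀ {x} → T (other x) → x ≢ θ v
  other-≢θ {x} h e = not-e {does (θ v ≟ x)} (∧-e₂ {not (does (v ≟ x))} h) (does-T (θ v ≟ x) (sym e))

  other-θ : ∀ {x} → T (other x) → T (other (θ x))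
  other-θ {x} h = other-i (λ e → other-≢θ h (trans (sym (θ-inv x)) (cong θ e))) (λ e → other-≢ h (θ-injective e))

  deleted : Fin 1 × Bool → Fin order
  deleted (_ , false) = v
  deleted (_ , true) = θ v

  open Enumeration (enumerate other) public using (size; elem; elem-∈; elem-injective; index)

  iso : Fin order ↔ (Fin size ⊎ (Fin 1 × Bool))
  iso = split other deleted inj out cover
    where
    inj : ∀ {b c} → deleted b ≡ deleted c → b ≡ c
    inj {zero , false} {zero , false} _ = refl
    inj {zero , false} {zero , true} e = contradiction (sym e) (θ-free v)
    inj {zero , true} {zero , false} e = contradiction e (θ-free v)
    inj {zero , true} {zero , true} _ = refl
    out : ∀ b → ¬ T (other (deleted b))
    out (_ , false) h = other-≢ h refl
    out (_ , true) h = other-≢θ h refl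
    cover : ∀ x → ¬ T (other x) → ∃ λ b → deleted b ≡ x
    cover x h with x ≟ v
    ... | yes e = (zero , false) , sym e
    ... | no x≢v with x ≟ θ v
    ...   | yes e = (zero , true) , sym e
    ...   | no x≢θv = contradiction (other-i x≢v x≢θv) h

  order-decreases : size ℕ.< order
  order-decreases = smaller (size-split iso (pairs↔ 1))

  open OnePair (Ci.graphical c) iso using (row; ∑-one; F-pair; F-outside)

  lift : Sub size → Sub order
  lift X z = [ X , (λ _ → false) ]′ (Inverse.to iso z)

  lift-elem : ∀ X x → lift X (elem x) ≡ X x
  lift-elem X x = cong [ X , (λ _ → false) ]′ (Inverse.strictlyInverseˡ iso (inj₁ x))

  lift-deleted : ∀ X b → ¬ T (lift X (deleted b))
  lift-deleted X b = subst T (cong [ X , (λ _ → false) ]′ (Inverse.strictlyInverseˡ iso (inj₂ b)))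

  F-lift : ∀ X → F (adj ↾ elem) X ≡ F adj (lift X)
  F-lift X = sym (trans (F-outside (lift X) λ l → T-irr (lift-deleted X (Inverse.to (pairs↔ 1) l))) (F-cong (adj ↾ elem) (lift-elem X)))

  -- For degree 2 the remainder is tight. For degree 3 it has `F` equal to 4, room for exactly one
  -- added edge and its image.
  F-full : ∀ d → deg adj v full ≡ d → F (adj ↾ elem) full ≡ + 4 * d - + 8
  F-full d e = lem (F (adj ↾ elem) full) d (trans (sym tight) (trans (F-pair (~̸θ v) full)
      (cong₂ (λ r r′ → F (adj ↾ elem) full + 1ℤ * (+ 4 - + 2 * r) + 1ℤ * (+ 4 - + 2 * r′)) (trans (row-deg v (zero , false) refl) e)
        (trans (row-deg (θ v) (zero , true) refl) (trans (deg-θ v full) e)))))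
    where
    lem : ∀ f d → 0ℤ ≡ f + 1ℤ * (+ 4 - + 2 * d) + 1ℤ * (+ 4 - + 2 * d) → f ≡ + 4 * d - + 8
    lem f d h = trans (lem₁ f d) (trans (cong (λ z → z + (+ 4 * d - + 8)) (sym h)) (ℤ.+-identityˡ _))
      where
      lem₁ : ∀ f d → f ≡ (f + 1ℤ * (+ 4 - + 2 * d) + 1ℤ * (+ 4 - + 2 * d)) + (+ 4 * d - + 8)
      lem₁ = solve-∀
    isolated : ∀ b b′ → ¬ T (adj (deleted b) (deleted b′))
    isolated (_ , false) (_ , false) = Ci.a-irr c v
    isolated (_ , false) (_ , true) = ~̸θ v
    isolated (_ , true) (_ , false) = ~̸θ v ∘ Ci.~-sym c
    isolated (_ , true) (_ , true) = Ci.a-irr c (θ v)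
    row-deg : ∀ u b → deleted b ≡ u → row u full ≡ deg adj u full
    row-deg u b refl = sym (trans (∑-one λ x → ⟦ adj u x ⟧ * 1ℤ) (trans (cong₂ (λ p q → row u full + (p * 1ℤ + q * 1ℤ))
      (⟦⟧-false (isolated b (zero , false))) (⟦⟧-false (isolated b (zero , true)))) (ℤ.+-identityʳ (row u full))))

  module Replaced (b : Matrix order) (b-sym : ∀ x y → b x y ≡ b y x) (b-irr : ∀ x → ¬ T (b x x)) (b-θ : ∀ x y → b (θ x) (θ y) ≡ b x y) where
    open Restrict {b = b} b-sym b-irr θ-inv b-θ other other-θ public using (restricted; restricted-involutive; elem-θ; θ↾)

    θ-from : ∀ P → θ (Inverse.from iso P) ≡ Inverse.from iso (τ restricted P)
    θ-from (inj₁ x) = sym (elem-θ x)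
    θ-from (inj₂ (zero , false)) = refl
    θ-from (inj₂ (zero , true)) = θ-inv v

IH : ℕ → Set
IH n = (G : ℤ₂Graph) → ℤ₂Graph.order G ℕ.< n → CiTight G → Generated G

module Reduce (H : ℤ₂Graph) (c : Ci (ℤ₂Graph.adj H) (ℤ₂Graph.θ H)) (ih : IH (ℤ₂Graph.order H)) (v : Fin (ℤ₂Graph.order H)) where
  open ℤ₂Graph H
  open Ci c using (θ-free; ~̸θ; θ-injective; deg-θ; tight; a-irr; ~-sym; ~-θ)
  open TightSets c
  open Delete H c v

  neighbour-other : ∀ {x} → v ~ x → T (other x)
  neighbour-other e = other-i (λ { refl → a-irr v e }) (λ { refl → ~̸θ v e })

  inverse-0-extension : ∀ x y → x ≢ y → v ~ x → v ~ y → (∀ z → v ~ z → z ≡ x ⊎ z ≡ y) → Generated H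
  inverse-0-extension x y x≢y v~x v~y all with index x (neighbour-other v~x) | index y (neighbour-other v~y)
  ... | x̂ , refl | ŷ , refl = zeroExtension G (ih G order-decreases (Ci⇒CiTight G ciG)) x̂ ŷ (x≢y ∘ cong elem)
      (PairExtension.Spec.realise (ZeroExtension.spec G x̂ ŷ) H iso θ-from (λ _ _ → mk⇔ id id)
        (λ z → mk⇔ (λ e → Sum.map elem-injective elem-injective (all (elem z) e)) λ { (inj₁ refl) → v~x ; (inj₂ refl) → v~y })
        (~̸θ v))
    where
    open Replaced adj adj-sym a-irr θ-auto
    G = restricted
    degree : deg adj v full ≡ + 2
    degree = trans (∑-cong λ z → cong (_* 1ℤ) (ind-unique (ind-Bool (adj v z)) (ind-map (λ { (inj₁ refl) → v~x ; (inj₂ refl) → v~y }) (all z)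
      (ind-⊎ (ind-δ x z) (ind-δ y z) λ { refl e → x≢y e })))) (∑-δ₂ x y λ _ → 1ℤ)
    ciG : Ci (ℤ₂Graph.adj G) (ℤ₂Graph.θ G)
    ciG = record
      { involutive = restricted-involutive (λ x _ → θ-free x) (λ x _ → ~̸θ x)
      ; sparse = λ X {x} h → subst (0ℤ ≤_) (sym (F-lift X)) (Ci.sparse c (lift X) {elem x} (subst T (sym (lift-elem X x)) h))
      ; tight = F-full (+ 2) degree
      }

  -- Deletes v and `θ v` and adds pq with its image, which undoes two different operations. With p
  -- and q neighbours of v it undoes a 1-extension; with p the vertex that v is merged into and q
  -- the third neighbour of v, a vertex-to-C₄. The condition `q≢θp` keeps the new edge from being
  -- fixed.
  module AddEdge (deg≡3 : deg adj v full ≡ + 3) (p q : Fin order) (p∈ : T (other p)) (q∈ : T (other q)) (p≢q : p ≢ q) (p≁q : ¬ p ~ q) (q≢θp : q ≢ θ p)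
    (unblocked : ∀ X → T (X p) → T (X q) → ¬ T (X v) → ¬ T (X (θ v)) → ¬ IsTight X) where

    open Stars {θ = θ} θ-inv p (_≡ q)
    open Adjoin {a = adj} adj-sym θ-auto (_≟ q)

    q≢p : ∀ {x} → x ≡ q → x ≢ p
    q≢p refl e = p≢q (sym e)

    Star⇒≁ : ∀ {x y} → Star x y → ¬ x ~ y
    Star⇒≁ (inj₁ (inj₁ (refl , refl))) = p≁q
    Star⇒≁ (inj₁ (inj₂ (refl , refl))) = p≁q ∘ ~-sym
    Star⇒≁ {x} {y} (inj₂ (inj₁ (refl , e))) h = p≁q (subst₂ _~_ (θ-inv p) e (~-θ h))
    Star⇒≁ {x} {y} (inj₂ (inj₂ (refl , e))) h = p≁q (subst₂ _~_ (θ-inv p) e (~-θ (~-sym h)))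

    open Replaced b b-sym (λ x → b-irr q≢p (q≢θp ∘ sym) x (a-irr x)) b-θ public

    G = restricted

    G-involutive : Involutive (ℤ₂Graph.adj G) (ℤ₂Graph.θ G)
    G-involutive = restricted-involutive (λ x _ → θ-free x) (λ x _ → b-opp q≢p (q≢θp ∘ sym) x (~̸θ x))

    p̂ q̂ : Fin size
    p̂ = proj₁ (index p p∈)
    q̂ = proj₁ (index q q∈)

    elem-p̂ : elem p̂ ≡ p
    elem-p̂ = proj₂ (index p p∈)
    elem-q̂ : elem q̂ ≡ q
    elem-q̂ = proj₂ (index q q∈)

    p̂~q̂ : ℤ₂Graph._~_ G p̂ q̂
    p̂~q̂ = b-i (inj₁ (inj₁ (elem-p̂ , elem-q̂)))

    module One = OneExtension G G-involutive p̂ q̂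

    elem-θp̂ : elem (θ↾ p̂) ≡ θ p
    elem-θp̂ = trans (elem-θ p̂) (cong θ elem-p̂)
    elem-θq̂ : elem (θ↾ q̂) ≡ θ q
    elem-θq̂ = trans (elem-θ q̂) (cong θ elem-q̂)

    star-elem : ∀ {r x y} → One.Star r p̂~q̂ x y → Star (elem x) (elem y)
    star-elem = Sum.map (Sum.map near near) (Sum.map far far)
      where
      near : ∀ {x y} → x ≡ p̂ × y ≡ q̂ → elem x ≡ p × elem y ≡ q
      near (refl , refl) = elem-p̂ , elem-q̂
      far : ∀ {x y} → x ≡ θ↾ p̂ × θ↾ y ≡ q̂ → elem x ≡ θ p × θ (elem y) ≡ q
      far {y = y} (refl , e) = elem-θp̂ , trans (sym (elem-θ y)) (trans (cong elem e) elem-q̂)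

    star-elem⁻ : ∀ {r x y} → Star (elem x) (elem y) → One.Star r p̂~q̂ x y
    star-elem⁻ = Sum.map (Sum.map near near) (Sum.map far far)
      where
      near : ∀ {x y} → elem x ≡ p × elem y ≡ q → x ≡ p̂ × y ≡ q̂
      near (e , f) = elem-injective (trans e (sym elem-p̂)) , elem-injective (trans f (sym elem-q̂))
      far : ∀ {x y} → elem x ≡ θ p × θ (elem y) ≡ q → x ≡ θ↾ p̂ × θ↾ y ≡ q̂
      far {y = y} (e , f) = elem-injective (trans e (sym elem-θp̂)) , elem-injective (trans (elem-θ y) (trans f (sym elem-q̂)))

    K⇔ : ∀ {r x y} → T (adj (elem x) (elem y)) ⇔ One.Kept r p̂~q̂ x y
    K⇔ {r} = mk⇔ (λ e → ∨-i₁ e , λ g → Star⇒≁ (star-elem {r} g) e)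
      λ (e , ¬g) → [ id , (λ h → ⊥-elim (¬g (star-elem⁻ {r} h))) ]′ (b-e e)

    formula : ∀ X → F (ℤ₂Graph.adj G) X + + 2 * (⟦ X p̂ ⟧ * ⟦ X q̂ ⟧) + + 2 * (⟦ X (θ↾ p̂) ⟧ * ⟦ X (θ↾ q̂) ⟧) ≡ F (adj ↾ elem) X
    formula X = sym (trans (One.F-star p̂ p̂~q̂ (K⇔ {p̂}) X) (cong₂ (λ u w → F (ℤ₂Graph.adj G) X + + 2 * (⟦ X p̂ ⟧ * u) + + 2 * (⟦ X (θ↾ p̂) ⟧ * w))
      (One.weight-at p̂ p̂~q̂ X) (One.weight′-at p̂ p̂~q̂ X)))

    gap : ∀ Z → T (Z p) → T (Z q) → ¬ T (Z v) → ¬ T (Z (θ v)) → + 2 ≤ F adj Z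
    gap Z zp zq zv zv′ = even-gap (Ci.F-even c Z) (Ci.sparse c Z zp) (unblocked Z zp zq zv zv′)

    -- The value F Z = 2 is excluded because F is divisible by 4 on the
    -- invariant sets Z ∪ θ Z and Z ∩ θ Z, neither of which is tight.
    gap₂ : ∀ Z → T (Z p) → T (Z q) → T (Z (θ p)) → T (Z (θ q)) → ¬ T (Z v) → ¬ T (Z (θ v)) → + 4 ≤ F adj Z
    gap₂ Z zp zq zp′ zq′ zv zv′ = ℤ.*-cancelˡ-≤-pos (+ 4) (F adj Z) (+ 2)
        (≤-by _ (0≤+ (0≤+ (0≤- bigU) (0≤- bigI)) (0≤* {+ 2} (+≤+ z≤n) (0≤link adj (Z ∖ Z′) (Z′ ∖ Z))))
          (lem (F adj Z) (F adj U) (F adj I) (link adj (Z ∖ Z′) (Z′ ∖ Z)) (trans (Ci.modular c Z Z′) (cong (λ z → F adj Z + z) (Ci.F-θ c Z)))))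
      where
      Z′ = Z ∘ θ
      U = Z ∪ Z′
      I = Z ∩ Z′
      U-inv : Ci.Invariant c U
      U-inv x = trans (cong (λ z → Z (θ x) ∨ Z z) (θ-inv x)) (∨-comm (Z (θ x)) (Z x))
      I-inv : Ci.Invariant c I
      I-inv x = trans (cong (λ z → Z (θ x) ∧ Z z) (θ-inv x)) (∧-comm (Z (θ x)) (Z x))
      notθθ : ¬ T (Z (θ (θ v)))
      notθθ h = zv (subst (T ∘ Z) (θ-inv v) h)
      bigU : + 4 ≤ F adj U
      bigU = four-gap (Ci.F-invariant c U U-inv) (Ci.sparse c U {p} (∨-i₁ zp)) (unblocked U (∨-i₁ zp) (∨-i₁ zq) ([ zv , zv′ ]′ ∘ ∨-e) ([ zv′ , notθθ ]′ ∘ ∨-e))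
      bigI : + 4 ≤ F adj I
      bigI = four-gap (Ci.F-invariant c I I-inv) (Ci.sparse c I {p} (∧-i zp zp′)) (unblocked I (∧-i zp zp′) (∧-i zq zq′) (zv ∘ ∧-e₁) (zv′ ∘ ∧-e₁))
      lem : ∀ f u i l → u + i + + 2 * l ≡ f + f → + 2 * f ≡ + 2 * + 4 + ((u - + 4) + (i - + 4) + + 2 * l)
      lem f u i l h = trans (lem₁ f) (trans (sym h) (lem₂ u i l))
        where
        lem₁ : ∀ f → + 2 * f ≡ f + f
        lem₁ = solve-∀
        lem₂ : ∀ u i l → u + i + + 2 * l ≡ + 2 * + 4 + ((u - + 4) + (i - + 4) + + 2 * l)
        lem₂ = solve-∀

    ciG : Ci (ℤ₂Graph.adj G) (ℤ₂Graph.θ G)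
    ciG = record
      { involutive = G-involutive
      ; sparse = λ X {x} h → sp X x h
      ; tight = lem (F (ℤ₂Graph.adj G) full) (trans (formula full) (F-full (+ 3) deg≡3))
      }
      where
      lem : ∀ f → f + + 2 + + 2 ≡ + 4 → f ≡ 0ℤ
      lem f h = trans (lem₁ f) (cong (λ z → z - + 4) h)
        where
        lem₁ : ∀ f → f ≡ f + + 2 + + 2 - + 4
        lem₁ = solve-∀
      sp : ∀ X x → T (X x) → 0ℤ ≤ F (ℤ₂Graph.adj G) X
      sp X x h = 0≤-by _ (0≤- (bound (X p̂) (X q̂) (X (θ↾ p̂)) (X (θ↾ q̂)) refl refl refl refl))
          (lem′ (F (ℤ₂Graph.adj G) X) (⟦ X p̂ ⟧ * ⟦ X q̂ ⟧) (⟦ X (θ↾ p̂) ⟧ * ⟦ X (θ↾ q̂) ⟧) (F adj Z) (trans (formula X) (F-lift X)))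
        where
        Z = lift X
        lem′ : ∀ f s t z → f + + 2 * s + + 2 * t ≡ z → f ≡ z - (+ 2 * s + + 2 * t)
        lem′ f s t z refl = lem₁ f s t
          where
          lem₁ : ∀ f s t → f ≡ f + + 2 * s + + 2 * t - (+ 2 * s + + 2 * t)
          lem₁ = solve-∀
        at : ∀ {i w} → elem i ≡ w → X i ≡ true → T (Z w)
        at {i} refl e = subst T (sym (trans (lift-elem X i) e)) tt
        out : ¬ T (Z v)
        out = lift-deleted X (zero , false)
        out′ : ¬ T (Z (θ v))
        out′ = lift-deleted X (zero , true)
        nonneg : 0ℤ ≤ F adj Z
        nonneg = Ci.sparse c Z {elem x} (subst T (sym (lift-elem X x)) h)
        gap′ : T (Z (θ p)) → T (Z (θ q)) → + 2 ≤ F adj Z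
        gap′ zp zq = subst (+ 2 ≤_) (Ci.F-θ c Z) (gap (Z ∘ θ) zp zq out′ (out ∘ subst (T ∘ Z) (θ-inv v)))
        bound : ∀ i j k l → X p̂ ≡ i → X q̂ ≡ j → X (θ↾ p̂) ≡ k → X (θ↾ q̂) ≡ l → + 2 * (⟦ X p̂ ⟧ * ⟦ X q̂ ⟧) + + 2 * (⟦ X (θ↾ p̂) ⟧ * ⟦ X (θ↾ q̂) ⟧) ≤ F adj Z
        bound i j k l ei ej ek el = subst (_≤ F adj Z) (sym (cong₂ (λ (a , b) (c , d) → + 2 * (⟦ a ⟧ * ⟦ b ⟧) + + 2 * (⟦ c ⟧ * ⟦ d ⟧)) (cong₂ _,_ ei ej) (cong₂ _,_ ek el))) (go i j k l ei ej ek el)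
          where
          -- An added edge costs 2 only if both its ends lie in the set. One of them is paid for by
          -- `gap` or its image `gap′`, both together by `gap₂`.
          go : ∀ i j k l → X p̂ ≡ i → X q̂ ≡ j → X (θ↾ p̂) ≡ k → X (θ↾ q̂) ≡ l → + 2 * (⟦ i ⟧ * ⟦ j ⟧) + + 2 * (⟦ k ⟧ * ⟦ l ⟧) ≤ F adj Z
          go true true true true e f e′ f′ = gap₂ Z (at elem-p̂ e) (at elem-q̂ f) (at elem-θp̂ e′) (at elem-θq̂ f′) out out′
          go true true true false e f _ _ = gap Z (at elem-p̂ e) (at elem-q̂ f) out out′
          go true true false l e f _ _ = gap Z (at elem-p̂ e) (at elem-q̂ f) out out′
          go true false true true _ _ e f = gap′ (at elem-θp̂ e) (at elem-θq̂ f)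
          go true false true false _ _ _ _ = nonneg
          go true false false l _ _ _ _ = nonneg
          go false j true true _ _ e f = gap′ (at elem-θp̂ e) (at elem-θq̂ f)
          go false j true false _ _ _ _ = nonneg
          go false j false l _ _ _ _ = nonneg

    generated : Generated G
    generated = ih G order-decreases (Ci⇒CiTight G ciG)

    generated-1-extension : ∀ r → T (other r) → r ≢ p → r ≢ q → v ~ p → v ~ q → v ~ r → (∀ z → v ~ z → (z ≡ p ⊎ z ≡ q) ⊎ z ≡ r) → Generated H
    generated-1-extension r r∈ r≢p r≢q v~p v~q v~r all = oneExtension G generated p̂ q̂ r̂ p̂~q̂ not-fixed
        (λ e → r≢p (trans (sym elem-r̂) (trans (cong elem e) elem-p̂))) (λ e → r≢q (trans (sym elem-r̂) (trans (cong elem e) elem-q̂)))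
        (PairExtension.Spec.realise (One.spec r̂ p̂~q̂) H iso θ-from (λ x y → K⇔ {r̂} {x} {y})
          (λ z → mk⇔ (λ e → Sum.map (Sum.map (pull elem-p̂) (pull elem-q̂)) (pull elem-r̂) (all (elem z) e))
            λ { (inj₁ (inj₁ refl)) → subst (v ~_) (sym elem-p̂) v~p ; (inj₁ (inj₂ refl)) → subst (v ~_) (sym elem-q̂) v~q ; (inj₂ refl) → subst (v ~_) (sym elem-r̂) v~r })
          (~̸θ v))
      where
      r̂ = proj₁ (index r r∈)
      elem-r̂ : elem r̂ ≡ r
      elem-r̂ = proj₂ (index r r∈)
      pull : ∀ {z s w} → elem s ≡ w → elem z ≡ w → z ≡ s
      pull e f = elem-injective (trans f (sym e))
      not-fixed : ¬ FixedEdge G p̂ q̂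
      not-fixed (inj₁ (e , _)) = Involutive.θ-free G-involutive p̂ e
      not-fixed (inj₂ (e , _)) = q≢θp (trans (sym elem-q̂) (trans (cong elem (sym e)) elem-θp̂))

    -- Seen from the smaller graph, p is split into p and v: the common neighbours x and y stay
    -- joined to both, and only the edge pq moves to v. Hence the moved set is the singleton of
    -- `q̂`.
    generated-C₄ : ∀ x y → T (other x) → T (other y) → x ≢ y → p ~ x → p ~ y → q ≢ x → q ≢ y → v ~ x → v ~ y → v ~ q →
      (∀ z → v ~ z → (z ≡ x ⊎ z ≡ y) ⊎ z ≡ q) → Generated H
    generated-C₄ x y x∈ y∈ x≢y p~x p~y q≢x q≢y v~x v~y v~q all = vertexToC₄ G generated p̂ x̂ ŷ (Involutive.θ-free G-involutive p̂)
        p̂~x̂ p̂~ŷ (λ e → x≢y (trans (sym elem-x̂) (trans (cong elem e) elem-ŷ))) Subset.⁅ q̂ ⁆ x̂∉ ŷ∉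
        (PairExtension.Spec.realise (C₄.spec) H iso θ-from KK
          (λ z → mk⇔ (λ e → Sum.map (Sum.map (pull elem-x̂) (pull elem-ŷ)) (λ f → N-q̂ (pull elem-q̂ f)) (all (elem z) e))
            λ { (inj₁ (inj₁ refl)) → subst (v ~_) (sym elem-x̂) v~x ; (inj₁ (inj₂ refl)) → subst (v ~_) (sym elem-ŷ) v~y
              ; (inj₂ h) → subst (v ~_) (sym (trans (cong elem (x∈⁅y⁆⇒x≡y q̂ (proj₂ h))) elem-q̂)) v~q })
          (~̸θ v))
      where
      x̂ = proj₁ (index x x∈)
      ŷ = proj₁ (index y y∈)
      elem-x̂ : elem x̂ ≡ x
      elem-x̂ = proj₂ (index x x∈)
      elem-ŷ : elem ŷ ≡ y
      elem-ŷ = proj₂ (index y y∈)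
      pull : ∀ {z s w} → elem s ≡ w → elem z ≡ w → z ≡ s
      pull e f = elem-injective (trans f (sym e))
      p̂~x̂ : ℤ₂Graph._~_ G p̂ x̂
      p̂~x̂ = ∨-i₁ (subst₂ _~_ (sym elem-p̂) (sym elem-x̂) p~x)
      p̂~ŷ : ℤ₂Graph._~_ G p̂ ŷ
      p̂~ŷ = ∨-i₁ (subst₂ _~_ (sym elem-p̂) (sym elem-ŷ) p~y)
      x̂∉ : x̂ Subset.∉ Subset.⁅ q̂ ⁆
      x̂∉ h = q≢x (trans (sym elem-q̂) (trans (cong elem (sym (x∈⁅y⁆⇒x≡y q̂ h))) elem-x̂))
      ŷ∉ : ŷ Subset.∉ Subset.⁅ q̂ ⁆
      ŷ∉ h = q≢y (trans (sym elem-q̂) (trans (cong elem (sym (x∈⁅y⁆⇒x≡y q̂ h))) elem-ŷ))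
      module C₄ = VertexToC₄ G G-involutive p̂ x̂ ŷ p̂~x̂ p̂~ŷ (λ e → x≢y (trans (sym elem-x̂) (trans (cong elem e) elem-ŷ))) Subset.⁅ q̂ ⁆ x̂∉ ŷ∉
      N-q̂ : ∀ {z} → z ≡ q̂ → C₄.N z
      N-q̂ refl = p̂~q̂ , x∈⁅x⁆ q̂
      q̂-N : ∀ {z} → C₄.N z → z ≡ q̂
      q̂-N h = x∈⁅y⁆⇒x≡y q̂ (proj₂ h)
      conv : ∀ {x y} → C₄.Star x y → One.Star p̂ p̂~q̂ x y
      conv = Sum.map (Sum.map (map₂ q̂-N) (map₂ q̂-N)) (Sum.map (map₂ q̂-N) (map₂ q̂-N))
      conv⁻ : ∀ {x y} → One.Star p̂ p̂~q̂ x y → C₄.Star x y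
      conv⁻ = Sum.map (Sum.map (map₂ N-q̂) (map₂ N-q̂)) (Sum.map (map₂ N-q̂) (map₂ N-q̂))
      KK : ∀ x y → T (adj (elem x) (elem y)) ⇔ C₄.Kept x y
      KK x y = mk⇔ there back
        where
        there : T (adj (elem x) (elem y)) → C₄.Kept x y
        there e = proj₁ kept , λ g → proj₂ kept (conv {x} {y} g)
          where
          kept : One.Kept p̂ p̂~q̂ x y
          kept = Equivalence.to (K⇔ {p̂} {x} {y}) e
        back : C₄.Kept x y → T (adj (elem x) (elem y))
        back (e , ¬g) = Equivalence.from (K⇔ {p̂} {x} {y}) (e , λ g → ¬g (conv⁻ {x} {y} g))

-- `unique` prevents the contraction from merging edges, so each edge at the contracted vertex
-- remembers its clique vertex. `apart` keeps the contracted vertex from becoming adjacent to its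
-- image.
module Contract (H : ℤ₂Graph) (c : Ci (ℤ₂Graph.adj H) (ℤ₂Graph.θ H)) (ih : IH (ℤ₂Graph.order H))
  (k : Fin 4 → Fin (ℤ₂Graph.order H)) (clique~ : ∀ {i j} → i ≢ j → ℤ₂Graph._~_ H (k i) (k j))
  (apart : ∀ i j → ¬ ℤ₂Graph._~_ H (k i) (ℤ₂Graph.θ H (k j)))
  (unique : ∀ u → (∀ i → u ≢ k i) → ∀ {i j} → ℤ₂Graph._~_ H (k i) u → ℤ₂Graph._~_ H (k j) u → i ≡ j) where
  open ℤ₂Graph H
  open Ci c using (θ-free; ~̸θ; θ-injective; a-irr; ~-sym; ~-θ)

  k-injective : ∀ {i j} → k i ≡ k j → i ≡ j
  k-injective {i} {j} e with i ≟ j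
  ... | yes p = p
  ... | no h = contradiction (subst (k i ~_) (sym e) (clique~ h)) (a-irr (k i))

  k≢θk : ∀ i j → k i ≢ θ (k j)
  k≢θk i j e with i ≟ j
  ... | yes refl = θ-free (k i) (sym e)
  ... | no h = ~̸θ (k j) (subst (k j ~_) e (clique~ (h ∘ sym)))

  w : Fin order
  w = k zero

  ~-from-θ : ∀ {x y} → θ x ~ y → x ~ θ y
  ~-from-θ {x} {y} e = subst (_~ θ y) (θ-inv x) (~-θ e)

  N : Fin order → Set
  N y = (∀ i → y ≢ k i) × ∃ λ i → k i ~ y

  N? : ∀ y → Dec (N y)
  N? y = all? (λ i → ¬? (y ≟ k i)) ×-dec any? (λ i → T? (adj (k i) y))

  open Stars {θ = θ} θ-inv w N
  open Adjoin {a = adj} adj-sym θ-auto N?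

  N≢w : ∀ {x} → N x → x ≢ w
  N≢w h e = proj₁ h zero e

  ¬Nθw : ¬ N (θ w)
  ¬Nθw (_ , i , e) = apart i zero e

  removed : Fin 3 × Bool → Fin order
  removed (i , false) = k (suc i)
  removed (i , true) = θ (k (suc i))

  removed? : ∀ x → Dec (∃ λ i → k (suc i) ≡ x ⊎ θ (k (suc i)) ≡ x)
  removed? x = any? λ i → (k (suc i) ≟ x) ⊎-dec (θ (k (suc i)) ≟ x)

  other : Sub order
  other x = not (does (removed? x))

  other-i : ∀ {x} → (∀ b → x ≢ removed b) → T (other x)
  other-i {x} h = not-i λ t → case T-does (removed? x) t of λ { (i , inj₁ e) → h (i , false) (sym e) ; (i , inj₂ e) → h (i , true) (sym e) }

  other-≢ : ∀ {x} → T (other x) → ∀ b → x ≢ removed b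
  other-≢ {x} h (i , false) e = not-e h (does-T (removed? x) (i , inj₁ (sym e)))
  other-≢ {x} h (i , true) e = not-e h (does-T (removed? x) (i , inj₂ (sym e)))

  removed-θ : ∀ i s → θ (removed (i , s)) ≡ removed (i , not s)
  removed-θ i false = refl
  removed-θ i true = θ-inv (k (suc i))

  other-θ : ∀ {x} → T (other x) → T (other (θ x))
  other-θ {x} h = other-i λ { (i , s) e → other-≢ h (i , not s) (trans (sym (θ-inv x)) (trans (cong θ e) (removed-θ i s))) }

  removed-injective : ∀ {p q} → removed p ≡ removed q → p ≡ q
  removed-injective {i , false} {j , false} e = cong (_, false) (suc-injective (k-injective e))
  removed-injective {i , false} {j , true} e = contradiction e (k≢θk (suc i) (suc j))
  removed-injective {i , true} {j , false} e = contradiction (sym e) (k≢θk (suc j) (suc i))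
  removed-injective {i , true} {j , true} e = cong (_, true) (suc-injective (k-injective (θ-injective e)))

  cover : ∀ x → ¬ T (other x) → ∃ λ b → removed b ≡ x
  cover x h = case double-negation (removed? x) h of λ { (i , inj₁ e) → (i , false) , e ; (i , inj₂ e) → (i , true) , e }
    where
    double-negation : (d : Dec P) → ¬ T (not (does d)) → P
    double-negation (yes p) _ = p
    double-negation (no _) h = contradiction tt h

  open Restrict {b = b} b-sym (λ x → b-irr N≢w ¬Nθw x (a-irr x)) θ-inv b-θ other other-θ

  G = restricted

  iso : Fin order ↔ Extended G 3
  iso = split other removed removed-injective (λ b h → other-≢ h b refl) cover

  open Inverse iso using (from)

  θ-from : ∀ P → θ (from P) ≡ from (τ G P)
  θ-from (inj₁ x) = sym (elem-θ x)
  θ-from (inj₂ (i , s)) = removed-θ i s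

  G-involutive : Involutive (ℤ₂Graph.adj G) (ℤ₂Graph.θ G)
  G-involutive = restricted-involutive (λ x _ → θ-free x) (λ x _ → b-opp N≢w ¬Nθw x (~̸θ x))

  w∈ : T (other w)
  w∈ = other-i λ { (i , false) e → case k-injective e of λ () ; (i , true) e → k≢θk zero (suc i) e }

  ŵ : Fin size
  ŵ = proj₁ (index w w∈)
  elem-ŵ : elem ŵ ≡ w
  elem-ŵ = proj₂ (index w w∈)
  elem-θŵ : elem (θ↾ ŵ) ≡ θ w
  elem-θŵ = trans (elem-θ ŵ) (cong θ elem-ŵ)

  d′ : ∀ y → Dec (∃ λ i → k i ~ y) → Fin 4
  d′ y (yes (i , _)) = i
  -- A vertex without neighbours in the clique is not adjacent to the contracted vertex, so the
  -- operation never reads this value.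
  d′ y (no _) = zero

  near? : ∀ y → Dec (∃ λ i → k i ~ y)
  near? y = any? λ i → T? (adj (k i) y)

  opaque
    d : Fin size → Fin 4
    d x = d′ (elem x) (near? (elem x))

    d-near : ∀ x {i} → k i ~ elem x → k (d x) ~ elem x
    d-near x {i} e = go (near? (elem x))
      where
      go : (p : Dec (∃ λ i → k i ~ elem x)) → k (d′ (elem x) p) ~ elem x
      go (yes (_ , e)) = e
      go (no h) = contradiction (i , e) h

  d-unique : ∀ x {i} → (∀ j → elem x ≢ k j) → k i ~ elem x → d x ≡ i
  d-unique x out e = unique (elem x) out (d-near x e) e

  outside : ∀ x → elem x ≢ w → ∀ i → elem x ≢ k i
  outside x h zero = h
  outside x h (suc i) = other-≢ (elem-∈ x) (i , false)

  module C = VertexToK₄ G G-involutive ŵ d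

  M⇒ : ∀ x → C.M x → N (elem x) × ¬ w ~ elem x
  M⇒ x (e , h) = N-x , λ e′ → h (d-unique x (proj₁ N-x) e′)
    where
    w≁ : ¬ w ~ elem x
    w≁ e′ = h (d-unique x (outside x λ f → a-irr w (subst (w ~_) f e′)) e′)
    N-x : N (elem x)
    N-x = case b-e e of λ
      { (inj₁ e) → contradiction (subst (_~ elem x) elem-ŵ e) w≁
      ; (inj₂ (inj₁ (inj₁ (_ , n)))) → n
      ; (inj₂ (inj₁ (inj₂ (_ , n)))) → contradiction elem-ŵ (N≢w n)
      ; (inj₂ (inj₂ (inj₁ (f , _)))) → contradiction (trans (sym elem-ŵ) f) (k≢θk zero zero)
      ; (inj₂ (inj₂ (inj₂ (_ , n)))) → contradiction (subst N (cong θ elem-ŵ) n) ¬Nθw }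

  ⇒M : ∀ x → N (elem x) → ¬ w ~ elem x → C.M x
  ⇒M x n@(out , i , e) h = b-i (inj₁ (inj₁ (elem-ŵ , n))) , λ f → h (subst (λ j → k j ~ elem x) f (d-near x e))

  N-elem-θ : ∀ x → N (θ (elem x)) → N (elem (θ↾ x))
  N-elem-θ x = subst N (sym (elem-θ x))

  old-old : ∀ x y → elem x ~ elem y → C.Kept x y
  old-old x y e = ∨-i₁ e , λ
    { (inj₁ (inj₁ (refl , m))) → proj₂ (M⇒ y m) (subst (_~ elem y) elem-ŵ e)
    ; (inj₁ (inj₂ (refl , m))) → proj₂ (M⇒ x m) (subst (_~ elem x) elem-ŵ (~-sym e))
    ; (inj₂ (inj₁ (refl , m))) → proj₂ (M⇒ (θ↾ y) m) (subst (w ~_) (sym (elem-θ y)) (~-from-θ (subst (_~ elem y) elem-θŵ e)))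
    ; (inj₂ (inj₂ (refl , m))) → proj₂ (M⇒ (θ↾ x) m) (subst (w ~_) (sym (elem-θ x)) (~-from-θ (subst (_~ elem x) elem-θŵ (~-sym e)))) }

  to-ŵ : ∀ x → elem x ≡ w → x ≡ ŵ
  to-ŵ x e = elem-injective (trans e (sym elem-ŵ))

  to-θŵ : ∀ x → elem x ≡ θ w → x ≡ θ↾ ŵ
  to-θŵ x e = elem-injective (trans e (sym elem-θŵ))

  old-old⁻ : ∀ x y → C.Kept x y → elem x ~ elem y
  old-old⁻ x y (e , ¬g) = case b-e e of λ
    { (inj₁ e) → e
    ; (inj₂ (inj₁ (inj₁ (f , n)))) → subst (_~ elem y) (sym f) (kept y n λ m → ¬g (inj₁ (inj₁ (to-ŵ x f , m))))
    ; (inj₂ (inj₁ (inj₂ (f , n)))) → ~-sym (subst (_~ elem x) (sym f) (kept x n λ m → ¬g (inj₁ (inj₂ (to-ŵ y f , m)))))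
    ; (inj₂ (inj₂ (inj₁ (f , n)))) → subst (_~ elem y) (sym f) (flip-~ y (kept (θ↾ y) (N-elem-θ y n) λ m → ¬g (inj₂ (inj₁ (to-θŵ x f , m)))))
    ; (inj₂ (inj₂ (inj₂ (f , n)))) → ~-sym (subst (_~ elem x) (sym f) (flip-~ x (kept (θ↾ x) (N-elem-θ x n) λ m → ¬g (inj₂ (inj₂ (to-θŵ y f , m)))))) }
    where
    kept : ∀ z → N (elem z) → ¬ C.M z → w ~ elem z
    kept z n h = decide (T? (adj w (elem z)))
      where
      decide : Dec (w ~ elem z) → w ~ elem z
      decide (yes e) = e
      decide (no ¬e) = contradiction (⇒M z n ¬e) h
    flip-~ : ∀ z → w ~ elem (θ↾ z) → θ w ~ elem z
    flip-~ z e = subst (θ w ~_) (θ-inv (elem z)) (~-θ (subst (w ~_) (elem-θ z) e))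

  new-old : ∀ i x → k (suc i) ~ elem x → C.L i x
  new-old i x e = decide (elem x ≟ w)
    where
    decide : Dec (elem x ≡ w) → C.L i x
    decide (yes f) = inj₁ (to-ŵ x f)
    decide (no f) = inj₂ (b-i (inj₁ (inj₁ (elem-ŵ , outside x f , suc i , e))) , sym (d-unique x (outside x f) e))

  new-old⁻ : ∀ i x → C.L i x → k (suc i) ~ elem x
  new-old⁻ i x (inj₁ refl) = subst (k (suc i) ~_) (sym elem-ŵ) (clique~ λ ())
  new-old⁻ i x (inj₂ (e , f)) = subst (λ j → k j ~ elem x) (sym f) (d-near x (proj₂ (proj₂ (proj₁ (M⇒ x (e , λ z → case trans f z of λ ()))))))

  h : Extended G 3 → Extended G 3 → Set
  h P Q = from P ~ from Q

  h-θ : ∀ P Q → h P Q → h (τ G P) (τ G Q)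
  h-θ P Q e = subst₂ _~_ (θ-from P) (θ-from Q) (~-θ e)

  h⇒S : ∀ P Q → h P Q → C.S P Q
  h⇒S (inj₁ x) (inj₁ y) e = old-old x y e
  h⇒S (inj₁ x) (inj₂ (i , false)) e = new-old i x (~-sym e)
  h⇒S (inj₁ x) (inj₂ (i , true)) e = new-old i (θ↾ x) (h-θ (inj₂ (i , true)) (inj₁ x) (~-sym e))
  h⇒S (inj₂ (i , false)) (inj₁ x) e = new-old i x e
  h⇒S (inj₂ (i , true)) (inj₁ x) e = new-old i (θ↾ x) (h-θ (inj₂ (i , true)) (inj₁ x) e)
  h⇒S (inj₂ (i , false)) (inj₂ (j , false)) e refl = a-irr _ e
  h⇒S (inj₂ (i , true)) (inj₂ (j , true)) e refl = a-irr _ e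
  h⇒S (inj₂ (i , false)) (inj₂ (j , true)) e = apart (suc i) (suc j) e
  h⇒S (inj₂ (i , true)) (inj₂ (j , false)) e = apart (suc j) (suc i) (~-sym e)

  S⇒h : ∀ P Q → C.S P Q → h P Q
  S⇒h (inj₁ x) (inj₁ y) s = old-old⁻ x y s
  S⇒h (inj₁ x) (inj₂ (i , false)) s = ~-sym (new-old⁻ i x s)
  S⇒h (inj₁ x) (inj₂ (i , true)) s = ~-sym (subst (θ (k (suc i)) ~_) (θ-inv (elem x)) (~-θ (subst (k (suc i) ~_) (elem-θ x) (new-old⁻ i (θ↾ x) s))))
  S⇒h (inj₂ (i , false)) (inj₁ x) s = new-old⁻ i x s
  S⇒h (inj₂ (i , true)) (inj₁ x) s = subst (θ (k (suc i)) ~_) (θ-inv (elem x)) (~-θ (subst (k (suc i) ~_) (elem-θ x) (new-old⁻ i (θ↾ x) s)))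
  S⇒h (inj₂ (i , false)) (inj₂ (j , false)) s = clique~ (s ∘ suc-injective)
  S⇒h (inj₂ (i , true)) (inj₂ (j , true)) s = ~-θ (clique~ (s ∘ suc-injective))

  realises : H Realises extend G 3 (ToK₄R G ŵ d)
  realises = realise-by iso θ-from λ P Q → mk⇔ (λ e → C.S⇒Edge P Q (h⇒S P Q e)) (λ e → S⇒h P Q (C.Edge⇒S e))

  module R = C.Realised {H} realises

  -- Since H is already recognised as the blow-up of the contraction, `F-pull` can be read
  -- backwards: each set of the contraction has the `F` of its pullback in H.
  ciG : Ci (ℤ₂Graph.adj G) (ℤ₂Graph.θ G)
  ciG = record
    { involutive = G-involutive
    ; sparse = λ X {x} t → subst (0ℤ ≤_) (R.F-pull X) (Ci.sparse c (R.pull X) {elem x} (subst T (sym (R.pull-from X (inj₁ x))) t))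
    ; tight = trans (sym (R.F-pull full)) (Ci.tight c)
    }

  contraction : Generated H
  contraction = vertexToK₄ G (ih G (smaller (size-split iso (pairs↔ 3))) (Ci⇒CiTight G ciG)) ŵ (Involutive.θ-free G-involutive ŵ) d realises

-- The base graphs

-- A violating set, stated existentially so that for the base graphs it is refuted by running
-- through all 64 or 256 subsets.
SparseCheck : Matrix n → Set
SparseCheck {n} a = ∃ λ (S : Subset n) → (∃ λ x → T (lookup S x)) × ¬ (0ℤ ≤ F a (lookup S))

sparse-check? : (a : Matrix n) → Dec (SparseCheck a)
sparse-check? a = anySubset? λ S → any? (λ x → T? (lookup S x)) ×-dec ¬? (0ℤ ℤ.≤? F a (lookup S))

sparse-checked : (a : Matrix n) → ¬ SparseCheck a → ∀ X {v} → T (X v) → 0ℤ ≤ F a X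
sparse-checked a none X {v} h = decide (0ℤ ℤ.≤? F a X)
  where
  decide : Dec (0ℤ ≤ F a X) → 0ℤ ≤ F a X
  decide (yes p) = p
  decide (no ¬p) = ⊥-elim (none (tabulate X , (v , subst T (sym (lookup∘tabulate X v)) h) , λ q → ¬p (subst (0ℤ ≤_) (F-cong a (lookup∘tabulate X)) q)))

-- Replaces the inductive edge relation by a Boolean one that can be evaluated. `M-rows` and `N≤8`
-- supply the degree and size bounds for copies inside larger graphs; 8 is the order of the second
-- base graph.
record Base (P : Presentation) : Set₁ where
  open Presentation P using (Vertex; R; Edge) renaming (τ to σ)
  field
    N : ℕ
    label : Fin N ↔ Vertex
    c : Vertex → Vertex → Bool
    R⇒c : ∀ {p q} → R p q → T (c p q)
    c⇒Edge : ∀ p q → T (c p q) → Edge p q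

  open Inverse label public using () renaming (to to vertex; from to number; strictlyInverseˡ to vertex-number; strictlyInverseʳ to number-vertex)

  M : Matrix N
  M i j = c (vertex i) (vertex j)

  field
    M-sym : ∀ i j → M i j ≡ M j i
    c-τ : ∀ i j → c (σ (vertex i)) (σ (vertex j)) ≡ M i j
    τ-free : ∀ i → σ (vertex i) ≢ vertex i
    c-opp : ∀ i → ¬ T (c (vertex i) (σ (vertex i)))
    M-sparse : ¬ SparseCheck M
    M-tight : F M full ≡ 0ℤ
    M-rows : ∀ i → + 3 ≤ deg M i full
    N≤8 : + N ≤ + 8

  at-vertices : {S : Vertex → Vertex → Set} → (∀ i j → S (vertex i) (vertex j)) → ∀ p q → S p q
  at-vertices {S} h p q = subst₂ S (vertex-number p) (vertex-number q) (h (number p) (number q))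

  Edge⇒c : ∀ {p q} → Edge p q → T (c p q)
  Edge⇒c (fwd (inj₁ r)) = R⇒c r
  Edge⇒c {p} {q} (fwd (inj₂ r)) = subst T (at-vertices {λ p q → c (σ p) (σ q) ≡ c p q} c-τ p q) (R⇒c r)
  Edge⇒c {p} {q} (bwd (inj₁ r)) = subst T (at-vertices {λ p q → c p q ≡ c q p} M-sym q p) (R⇒c r)
  Edge⇒c {p} {q} (bwd (inj₂ r)) = subst T (trans (at-vertices {λ p q → c (σ p) (σ q) ≡ c p q} c-τ q p) (at-vertices {λ p q → c p q ≡ c q p} M-sym q p)) (R⇒c r)

  module _ {H : ℤ₂Graph} (r : H Realises P) where
    open _Realises_ r
    open ℤ₂Graph H using (adj; θ; order; θ-inv; θ-auto)
    open Inverse bijection using (to; from; strictlyInverseˡ; strictlyInverseʳ)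

    private
      φ : Fin N → Fin order
      φ i = from (vertex i)
      ∑-φ : (f : Fin order → ℤ) → ∑ f ≡ ∑ (f ∘ φ)
      ∑-φ f = trans (∑-cong λ x → cong f (sym (strictlyInverseʳ x))) (∑-↔ bijection label (f ∘ from))
      ~⇔c : ∀ u v → T (adj u v) ⇔ T (c (to u) (to v))
      ~⇔c u v = mk⇔ (λ e → Edge⇒c (Equivalence.to (edges u v) e)) (λ e → Equivalence.from (edges u v) (c⇒Edge (to u) (to v) e))
      entry : ∀ i j → adj (φ i) (φ j) ≡ M i j
      entry i j = trans (T⇔≡ (Equivalence.to (~⇔c (φ i) (φ j))) (Equivalence.from (~⇔c (φ i) (φ j)))) (cong₂ c (strictlyInverseˡ (vertex i)) (strictlyInverseˡ (vertex j)))

    F-base : ∀ Z → F adj Z ≡ F M (Z ∘ φ)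
    F-base Z = trans (F-def adj Z) (trans (cong₂ (λ s l → + 4 * s - + 4 - l) (∑-φ λ x → ⟦ Z x ⟧)
      (trans (∑-φ λ x → ∑ λ y → ⟦ adj x y ⟧ * (⟦ Z x ⟧ * ⟦ Z y ⟧)) (∑-cong λ i → trans (∑-φ λ y → ⟦ adj (φ i) y ⟧ * (⟦ Z (φ i) ⟧ * ⟦ Z y ⟧))
        (∑-cong λ j → cong (λ b → ⟦ b ⟧ * (⟦ Z (φ i) ⟧ * ⟦ Z (φ j) ⟧)) (entry i j)))))
      (sym (F-def M (Z ∘ φ))))

    base-tight : CiTight H
    base-tight = Ci⇒CiTight H record
      { involutive = record
        { graphical = graphical (ℤ₂Graph.graph H)
        ; θ-inv = θ-inv
        ; θ-auto = θ-auto
        ; θ-free = λ v e → at₁ {λ p → σ p ≢ p} τ-free (to v) (trans (sym (equivariant v)) (cong to e))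
        ; ~̸θ = λ v e → at₁ {λ p → ¬ T (c p (σ p))} c-opp (to v) (subst (T ∘ c (to v)) (equivariant v) (Equivalence.to (~⇔c v (θ v)) e))
        }
      ; sparse = λ Z {v} h → subst (0ℤ ≤_) (sym (F-base Z)) (sparse-checked M M-sparse (Z ∘ φ) {number (to v)}
          (subst (T ∘ Z) (sym (trans (cong from (vertex-number (to v))) (strictlyInverseʳ v))) h))
      ; tight = trans (F-base full) M-tight
      }
      where
      at₁ : {S : Vertex → Set} → (∀ i → S (vertex i)) → ∀ p → S p
      at₁ {S} h p = subst S (vertex-number p) (h (number p))

module FirstBase where

  open F₁ using (a; b; c; d; e; f; ca; cb; ce; cf; da; db; de; df; ab; ef)

  private
    vertex₁ : Fin 6 → F₁.Vertex
    vertex₁ 0F = a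
    vertex₁ 1F = b
    vertex₁ 2F = c
    vertex₁ 3F = d
    vertex₁ 4F = e
    vertex₁ 5F = f

    number₁ : F₁.Vertex → Fin 6
    number₁ a = 0F
    number₁ b = 1F
    number₁ c = 2F
    number₁ d = 3F
    number₁ e = 4F
    number₁ f = 5F

    label₁ : Fin 6 ↔ F₁.Vertex
    label₁ = mk↔ₛ′ vertex₁ number₁
      (λ { a → refl ; b → refl ; c → refl ; d → refl ; e → refl ; f → refl })
      (λ { 0F → refl ; 1F → refl ; 2F → refl ; 3F → refl ; 4F → refl ; 5F → refl })

    side : F₁.Vertex → Fin 3
    side a = 0F
    side b = 0F
    side c = 1F
    side d = 1F
    side e = 2F
    side f = 2F

    -- Two vertices on the same side are adjacent, except c and d; across sides
    -- an edge needs exactly one end in {c , d}.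
    adj₁ : F₁.Vertex → F₁.Vertex → Bool
    adj₁ x y with side x | side y
    ... | 0F | 0F = not (does (number₁ x ≟ number₁ y))
    ... | 0F | 1F = true
    ... | 0F | 2F = false
    ... | 1F | 0F = true
    ... | 1F | 1F = false
    ... | 1F | 2F = true
    ... | 2F | 0F = false
    ... | 2F | 1F = true
    ... | 2F | 2F = not (does (number₁ x ≟ number₁ y))

    Edge₁ = Presentation.Edge F₁

    adj₁⇒Edge : ∀ x y → T (adj₁ x y) → Edge₁ x y
    adj₁⇒Edge a b _ = fwd (inj₁ ab)
    adj₁⇒Edge b a _ = bwd (inj₁ ab)
    adj₁⇒Edge e f _ = fwd (inj₁ ef)
    adj₁⇒Edge f e _ = bwd (inj₁ ef)
    adj₁⇒Edge c a _ = fwd (inj₁ ca)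
    adj₁⇒Edge c b _ = fwd (inj₁ cb)
    adj₁⇒Edge c e _ = fwd (inj₁ ce)
    adj₁⇒Edge c f _ = fwd (inj₁ cf)
    adj₁⇒Edge d a _ = fwd (inj₁ da)
    adj₁⇒Edge d b _ = fwd (inj₁ db)
    adj₁⇒Edge d e _ = fwd (inj₁ de)
    adj₁⇒Edge d f _ = fwd (inj₁ df)
    adj₁⇒Edge a c _ = bwd (inj₁ ca)
    adj₁⇒Edge b c _ = bwd (inj₁ cb)
    adj₁⇒Edge e c _ = bwd (inj₁ ce)
    adj₁⇒Edge f c _ = bwd (inj₁ cf)
    adj₁⇒Edge a d _ = bwd (inj₁ da)
    adj₁⇒Edge b d _ = bwd (inj₁ db)
    adj₁⇒Edge e d _ = bwd (inj₁ de)
    adj₁⇒Edge f d _ = bwd (inj₁ df)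

    M₁ : Matrix 6
    M₁ i j = adj₁ (vertex₁ i) (vertex₁ j)

    opaque
      unfolding ∑ F

      M₁-sparse : ¬ SparseCheck M₁
      M₁-sparse = from-no (sparse-check? M₁)

      M₁-tight : F M₁ full ≡ 0ℤ
      M₁-tight = refl

      M₁-rows : ∀ i → + 3 ≤ deg M₁ i full
      M₁-rows = from-yes (all? λ i → + 3 ℤ.≤? deg M₁ i full)

  base-F₁ : Base F₁
  base-F₁ = record
    { N = 6
    ; label = label₁
    ; c = adj₁
    ; R⇒c = λ { ca → tt ; cb → tt ; ce → tt ; cf → tt ; da → tt ; db → tt ; de → tt ; df → tt ; ab → tt ; ef → tt }
    ; c⇒Edge = adj₁⇒Edge
    ; M-sym = from-yes (all? λ i → all? λ j → M₁ i j ≟ᵇ M₁ j i)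
    ; c-τ = from-yes (all? λ i → all? λ j → adj₁ (F₁.τ (vertex₁ i)) (F₁.τ (vertex₁ j)) ≟ᵇ M₁ i j)
    ; τ-free = λ { 0F () ; 1F () ; 2F () ; 3F () ; 4F () ; 5F () }
    ; c-opp = from-yes (all? λ i → ¬? (T? (adj₁ (vertex₁ i) (F₁.τ (vertex₁ i)))))
    ; M-sparse = M₁-sparse
    ; M-tight = M₁-tight
    ; M-rows = M₁-rows
    ; N≤8 = +≤+ (from-yes (6 ℕ.≤? 8))
    }

module SecondBase where

  private
    joint₂ : Fin 4 ⊎ Fin 4 → F₂.Vertex
    joint₂ (inj₁ i) = F₂.a i
    joint₂ (inj₂ i) = F₂.b i

    label₂ : Fin 8 ↔ F₂.Vertex
    label₂ = mk↔ₛ′ joint₂ (λ { (F₂.a i) → inj₁ i ; (F₂.b i) → inj₂ i })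
      (λ { (F₂.a i) → refl ; (F₂.b i) → refl }) (λ { (inj₁ i) → refl ; (inj₂ i) → refl }) ↔-∘ +↔⊎

    bridge : Fin 4 → Fin 4 → Bool
    bridge 2F 2F = true
    bridge 3F 3F = true
    bridge _ _ = false

    adj₂ : F₂.Vertex → F₂.Vertex → Bool
    adj₂ (F₂.a i) (F₂.a j) = not (does (i ≟ j))
    adj₂ (F₂.b i) (F₂.b j) = not (does (i ≟ j))
    adj₂ (F₂.a i) (F₂.b j) = bridge i j
    adj₂ (F₂.b j) (F₂.a i) = bridge i j

    vertex₂ : Fin 8 → F₂.Vertex
    vertex₂ = Inverse.to label₂

    M₂ : Matrix 8
    M₂ i j = adj₂ (vertex₂ i) (vertex₂ j)

    bridge-R : ∀ i j → T (bridge i j) → F₂.R (F₂.a i) (F₂.b j)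
    bridge-R 2F 2F _ = F₂.a₂b₂
    bridge-R 3F 3F _ = F₂.a₃b₃

    ≢-i : ∀ {i j : Fin 4} → i ≢ j → T (not (does (i ≟ j)))
    ≢-i {i} {j} h = not-i (h ∘ T-does (i ≟ j))

    ≢-e : ∀ {i j : Fin 4} → T (not (does (i ≟ j))) → i ≢ j
    ≢-e {i} {j} h e = not-e h (does-T (i ≟ j) e)

    adj₂⇒Edge : ∀ p q → T (adj₂ p q) → Presentation.Edge F₂ p q
    adj₂⇒Edge (F₂.a i) (F₂.a j) h = fwd (inj₁ (F₂.aa (≢-e h)))
    adj₂⇒Edge (F₂.b i) (F₂.b j) h = fwd (inj₁ (F₂.bb (≢-e h)))
    adj₂⇒Edge (F₂.a i) (F₂.b j) h = fwd (inj₁ (bridge-R i j h))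
    adj₂⇒Edge (F₂.b j) (F₂.a i) h = bwd (inj₁ (bridge-R i j h))

    opaque
      unfolding ∑ F

      M₂-sparse : ¬ SparseCheck M₂
      M₂-sparse = from-no (sparse-check? M₂)

      M₂-tight : F M₂ full ≡ 0ℤ
      M₂-tight = refl

      M₂-rows : ∀ i → + 3 ≤ deg M₂ i full
      M₂-rows = from-yes (all? λ i → + 3 ℤ.≤? deg M₂ i full)

  base-F₂ : Base F₂
  base-F₂ = record
    { N = 8
    ; label = label₂
    ; c = adj₂
    ; R⇒c = λ { (F₂.aa h) → ≢-i h ; (F₂.bb h) → ≢-i h ; F₂.a₂b₂ → tt ; F₂.a₃b₃ → tt }
    ; c⇒Edge = adj₂⇒Edge
    ; M-sym = from-yes (all? λ i → all? λ j → M₂ i j ≟ᵇ M₂ j i)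
    ; c-τ = from-yes (all? λ i → all? λ j → adj₂ (F₂.τ (vertex₂ i)) (F₂.τ (vertex₂ j)) ≟ᵇ M₂ i j)
    ; τ-free = λ i → free (vertex₂ i)
    ; c-opp = from-yes (all? λ i → ¬? (T? (adj₂ (vertex₂ i) (F₂.τ (vertex₂ i)))))
    ; M-sparse = M₂-sparse
    ; M-tight = M₂-tight
    ; M-rows = M₂-rows
    ; N≤8 = ≤-refl
    }
    where
    free : ∀ p → F₂.τ p ≢ p
    free (F₂.a i) ()
    free (F₂.b i) ()

generated⇒tight : ∀ {H} → Generated H → CiTight H
generated⇒tight (base₁ r) = Base.base-tight FirstBase.base-F₁ r
generated⇒tight (base₂ r) = Base.base-tight SecondBase.base-F₂ r
generated⇒tight (zeroExtension G g a b a≢b r) = ZeroExtension.preserves G a b (CiTight⇒Ci G (generated⇒tight g)) a≢b r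
generated⇒tight (oneExtension G g a b c a~b _ c≢a c≢b r) =
  OneExtension.preserves G (Ci.involutive ci) a b c a~b ci c≢a c≢b r
  where ci = CiTight⇒Ci G (generated⇒tight g)
generated⇒tight (vertexToK₄ G g w _ d r) = VertexToK₄.Realised.preserves G (Ci.involutive ci) w d r ci
  where ci = CiTight⇒Ci G (generated⇒tight g)
generated⇒tight (vertexToC₄ G g w v₁ v₂ _ w~v₁ w~v₂ v₁≢v₂ M v₁∉M v₂∉M r) =
  VertexToC₄.preserves G (Ci.involutive ci) w v₁ v₂ w~v₁ w~v₂ v₁≢v₂ M v₁∉M v₂∉M ci r
  where ci = CiTight⇒Ci G (generated⇒tight g)
generated⇒tight (joining G₁ G₂ g₁ g₂ x y r) =
  Join.preserves G₁ G₂ (CiTight⇒Ci G₁ (generated⇒tight g₁)) (CiTight⇒Ci G₂ (generated⇒tight g₂)) x y r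

-- Copies of the base graphs inside a tight graph

Injective : (A → B) → Set
Injective f = ∀ {x y} → f x ≡ f y → x ≡ y

∑-image′ : (φ : Fin k → Fin n) → Injective φ → (f : Fin n → ℤ) → ∑ (λ x → f x * ⟦ image φ x ⟧) ≡ ∑ (f ∘ φ)
∑-image′ φ inj f = trans (∑-cong λ x → ℤ.*-comm (f x) ⟦ image φ x ⟧) (∑-image φ inj f)

∣image∣ : (φ : Fin k → Fin n) → Injective φ → ∣ image φ ∣ₛ ≡ + k
∣image∣ {k} φ inj = trans (∑-cong λ x → sym (ℤ.*-identityʳ ⟦ image φ x ⟧)) (trans (∑-image φ inj λ _ → 1ℤ) (∣full∣ k))

link-image : (a : Matrix n) (φ : Fin k → Fin n) → Injective φ → link a (image φ) (image φ) ≡ link (a ↾ φ) full full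
link-image a φ inj = trans (∑-cong λ x → trans (∑-cong λ y → lem ⟦ a x y ⟧ ⟦ image φ x ⟧ ⟦ image φ y ⟧)
    (trans (∑-* ⟦ image φ x ⟧ λ y → ⟦ a x y ⟧ * ⟦ image φ y ⟧) (cong (⟦ image φ x ⟧ *_) (∑-image′ φ inj λ y → ⟦ a x y ⟧))))
  (trans (∑-image φ inj λ x → ∑ λ j → ⟦ a x (φ j) ⟧) (∑-cong λ i → ∑-cong λ j → sym (ℤ.*-identityʳ ⟦ a (φ i) (φ j) ⟧)))
  where
  lem : ∀ p q r → p * (q * r) ≡ q * (p * r)
  lem = solve-∀

F-image : (a : Matrix n) (φ : Fin k → Fin n) → Injective φ → F a (image φ) ≡ F (a ↾ φ) full
F-image a φ inj = trans (F-def a (image φ)) (trans (cong₂ (λ s l → + 4 * s - + 4 - l) (trans (∣image∣ φ inj) (sym (∣full∣ _))) (link-image a φ inj))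
  (sym (F-def (a ↾ φ) full)))

deg-image : (a : Matrix n) (v : Fin n) (φ : Fin k → Fin n) → Injective φ → deg a v (image φ) ≡ ∑ λ j → ⟦ a v (φ j) ⟧
deg-image a v φ inj = ∑-image′ φ inj λ x → ⟦ a v x ⟧

F-antitone : {a b : Matrix n} → (∀ i j → T (a i j) → T (b i j)) → F b full ≤ F a full
F-antitone {a = a} {b} h = ≤-by (link b full full - link a full full)
  (0≤- (∑-mono λ i → ∑-mono λ j → ind-≤ (ind-× (ind-Bool (a i j)) (ind-Bool true)) (ind-× (ind-Bool (b i j)) (ind-Bool true)) (λ (e , t) → h i j e , t)))
  (trans (F-def a full) (trans (lem ∣ full {n = _} ∣ₛ (link a full full) (link b full full)) (cong (λ z → z + (link b full full - link a full full)) (sym (F-def b full)))))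
  where
  lem : ∀ s l k → + 4 * s - + 4 - l ≡ (+ 4 * s - + 4 - k) + (k - l)
  lem = solve-∀

-- Nested edge sets of equal size coincide. Thus a copy of a base graph that exhausts a tight graph
-- admits no further edge and is the whole graph.
F-full-≡ : {a b : Matrix n} → (∀ i j → T (a i j) → T (b i j)) → F a full ≡ F b full → ∀ i j → T (b i j) → T (a i j)
F-full-≡ {a = a} {b} h e i j = λ t → T-from (trans (entries i j) (⟦⟧-true t))
  where
  T-from : ∀ {c} → ⟦ c ⟧ ≡ 1ℤ → T c
  T-from {true} _ = tt
  mono : ∀ i j → ⟦ a i j ⟧ * (1ℤ * 1ℤ) ≤ ⟦ b i j ⟧ * (1ℤ * 1ℤ)
  mono i j = ind-≤ (ind-× (ind-Bool (a i j)) (ind-Bool true)) (ind-× (ind-Bool (b i j)) (ind-Bool true)) (λ (e , t) → h i j e , t)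
  links : link b full full ≡ link a full full
  links = trans (lem (+ 4 * ∣ full {n = _} ∣ₛ - + 4) (link b full full)) (trans (cong (λ z → + 4 * ∣ full {n = _} ∣ₛ - + 4 - z) (trans (sym (F-def b full)) (trans (sym e) (F-def a full))))
    (sym (lem (+ 4 * ∣ full {n = _} ∣ₛ - + 4) (link a full full))))
    where
    lem : ∀ s l → l ≡ s - (s - l)
    lem = solve-∀
  rows : ∀ i → ∑ (λ j → ⟦ a i j ⟧ * 1ℤ) ≡ ∑ (λ j → ⟦ b i j ⟧ * 1ℤ)
  rows = ∑-≡⇒≡ (λ i → ∑-mono (mono i)) (≤-reflexive links)
  entries : ∀ i j → ⟦ a i j ⟧ ≡ ⟦ b i j ⟧
  entries i j = trans (sym (ℤ.*-identityʳ ⟦ a i j ⟧)) (trans (∑-≡⇒≡ (mono i) (≤-reflexive (sym (rows i))) j) (ℤ.*-identityʳ ⟦ b i j ⟧))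

module Atoms (H : ℤ₂Graph) (c : Ci (ℤ₂Graph.adj H) (ℤ₂Graph.θ H)) where
  open ℤ₂Graph H
  open Ci c using (Invariant; θ-free; ~̸θ; ~-sym; ~-θ; ~⇒≢; θ-injective)
  open TightSets c

  -- The size and degree bounds make W minimal among the invariant tight sets.
  record Atom (v : Fin order) : Set where
    field
      W : Sub order
      v∈W : T (W v)
      W-inv : Invariant W
      W-tight : IsTight W
      ∣W∣≤8 : ∣ W ∣ₛ ≤ + 8
      rows : ∀ x → T (W x) → + 3 ≤ deg adj x W
      proper : ∃ λ z → ¬ T (W z)

  orbit : (Fin k → Fin order) → Fin k × Bool → Fin order
  orbit r (i , false) = r i
  orbit r (i , true) = θ (r i)

  -- If `r i` were the image of `r j` for different indices, their adjacency would join `r j` to its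
  -- own image. So pairwise adjacent representatives lie in distinct orbits.
  orbit-injective : (r : Fin k → Fin order) → (∀ {i j} → i ≢ j → r i ~ r j) → Injective (orbit r)
  orbit-injective r joined = inj
    where
    same : ∀ {i j} → r i ≡ r j → i ≡ j
    same {i} {j} e with i ≟ j
    ... | yes p = p
    ... | no h = contradiction e (~⇒≢ (joined h))
    opposite : ∀ {i j} → r i ≢ θ (r j)
    opposite {i} {j} e with i ≟ j
    ... | yes refl = θ-free (r i) (sym e)
    ... | no h = ~̸θ (r j) (subst (r j ~_) e (joined (h ∘ sym)))
    inj : Injective (orbit r)
    inj {i , false} {j , false} e = cong (_, false) (same e)
    inj {i , true} {j , true} e = cong (_, true) (same (θ-injective e))
    inj {i , false} {j , true} e = contradiction e opposite
    inj {i , true} {j , false} e = contradiction (sym e) opposite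

  -- Only the listed edges are demanded. Additional edges inside the copy would push `F` below that
  -- of the base graph, which is 0, so sparsity makes the copy tight.
  module Copy {P : Presentation} (B : Base P) (φ : Presentation.Vertex P → Fin order) (φ-injective : Injective φ)
    (φ-τ : ∀ p → φ (Presentation.τ P p) ≡ θ (φ p)) (φ-R : ∀ {p q} → Presentation.R P p q → φ p ~ φ q) where
    open Presentation P using (Vertex; R; Edge) renaming (τ to σ)
    open Base B using (N; M; vertex; number; vertex-number; number-vertex; M-rows; M-tight; N≤8; c⇒Edge; Edge⇒c)

    φ-Edge : ∀ {p q} → Edge p q → φ p ~ φ q
    φ-Edge (fwd (inj₁ r)) = φ-R r
    φ-Edge {p} {q} (fwd (inj₂ r)) = subst T (trans (cong₂ adj (φ-τ p) (φ-τ q)) (θ-auto (φ p) (φ q))) (φ-R r)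
    φ-Edge (bwd (inj₁ r)) = ~-sym (φ-R r)
    φ-Edge {p} {q} (bwd (inj₂ r)) = ~-sym (subst T (trans (cong₂ adj (φ-τ q) (φ-τ p)) (θ-auto (φ q) (φ p))) (φ-R r))

    ψ : Fin N → Fin order
    ψ = φ ∘ vertex

    ψ-injective : Injective ψ
    ψ-injective {i} {j} e = trans (sym (number-vertex i)) (trans (cong number (φ-injective e)) (number-vertex j))

    M⇒~ : ∀ i j → T (M i j) → T ((adj ↾ ψ) i j)
    M⇒~ i j h = φ-Edge (c⇒Edge (vertex i) (vertex j) h)

    W : Sub order
    W = image ψ

    φ∈W : ∀ p → T (W (φ p))
    φ∈W p = subst (T ∘ W ∘ φ) (vertex-number p) (image-∈ ψ (number p))

    tight : Vertex → IsTight W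
    tight p = F≤0⇒tight W (φ∈W p) (≤-trans (≤-reflexive (F-image adj ψ ψ-injective)) (≤-trans (F-antitone M⇒~) (≤-reflexive M-tight)))

    W-θ : ∀ {x} → T (W x) → T (W (θ x))
    W-θ {x} h = case image-∋ ψ h of λ { (i , refl) → subst (T ∘ W) (φ-τ (vertex i)) (φ∈W (σ (vertex i))) }

    realises : (∀ x → T (W x)) → Vertex → H Realises P
    realises all p₀ = realise-by (mk↔ₛ′ to φ (λ p → φ-injective (φ-to (φ p))) φ-to) (λ p → sym (φ-τ p)) λ p q → mk⇔
        (λ e → c⇒Edge p q (subst₂ (λ p q → T (Base.c B p q)) (vertex-number p) (vertex-number q)
          (F-full-≡ M⇒~ (trans M-tight (trans (sym (tight p₀)) (F-image adj ψ ψ-injective))) (number p) (number q)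
            (subst₂ (λ p q → φ p ~ φ q) (sym (vertex-number p)) (sym (vertex-number q)) e))))
        φ-Edge
      where
      to : Fin order → Vertex
      to x = vertex (proj₁ (image-∋ ψ (all x)))
      φ-to : ∀ x → φ (to x) ≡ x
      φ-to x = proj₂ (image-∋ ψ (all x))

    realises-or-atom : ∀ p → H Realises P ⊎ Atom (φ p)
    realises-or-atom p with any? (λ z → ¬? (T? (W z)))
    ... | no none = inj₁ (realises (λ x → dec x (T? (W x))) p)
      where
      dec : ∀ x → Dec (T (W x)) → T (W x)
      dec x (yes h) = h
      dec x (no h) = contradiction (x , h) none
    ... | yes proper = inj₂ record
      { W = W
      ; v∈W = φ∈W p
      ; W-inv = λ x → T⇔≡ (λ h → subst (T ∘ W) (θ-inv x) (W-θ h)) W-θ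
      ; W-tight = tight p
      ; ∣W∣≤8 = ≤-trans (≤-reflexive (∣image∣ ψ ψ-injective)) N≤8
      ; rows = λ x h → case image-∋ ψ h of λ { (i , refl) → ≤-trans (M-rows i) (≤-trans
          (∑-mono λ j → ≤-trans (≤-reflexive (ℤ.*-identityʳ ⟦ M i j ⟧)) (ind-≤ (ind-Bool (M i j)) (ind-Bool (adj (ψ i) (ψ j))) (M⇒~ i j)))
          (≤-reflexive (sym (deg-image adj (ψ i) ψ ψ-injective)))) }
      ; proper = proper
      }

-- Vertices of degree three

quad : A → A → A → A → Fin 4 → A
quad x y z w 0F = x
quad x y z w 1F = y
quad x y z w 2F = z
quad x y z w 3F = w

-- Distinct i and j extend to a relabelling of the K₄ that puts them at positions 2 and 3, the ends
-- of the bridging edges in `F₂`.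
CompletePair : Fin 4 → Fin 4 → Set
CompletePair i j = i ≡ j ⊎ ∃ λ p → ∃ λ q → ∀ s t → s ≢ t → quad p q i j s ≢ quad p q i j t

complete-pair? : ∀ i j → Dec (CompletePair i j)
complete-pair? i j = (i ≟ j) ⊎-dec any? λ p → any? λ q → all? λ s → all? λ t → ¬? (s ≟ t) →-dec ¬? (quad p q i j s ≟ quad p q i j t)

opaque
  complete-pair : ∀ i j → CompletePair i j
  complete-pair = from-yes (all? λ i → all? λ j → complete-pair? i j)

opaque
  unfolding ∑ F

  F-K₄ : F {4} (λ i j → not (does (i ≟ j))) full ≡ 0ℤ
  F-K₄ = refl

module Local (H : ℤ₂Graph) (c : Ci (ℤ₂Graph.adj H) (ℤ₂Graph.θ H)) (ih : IH (ℤ₂Graph.order H)) (v : Fin (ℤ₂Graph.order H))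
  (deg≡3 : deg (ℤ₂Graph.adj H) v full ≡ + 3) where
  open ℤ₂Graph H
  open Ci c using (Invariant; θ-free; ~̸θ; ~-sym; ~-θ; ~⇒≢; θ-injective; a-irr)
  open TightSets c
  open Atoms H c
  open Reduce H c ih v
  open Delete H c v using (other; other-i)

  V : Set
  V = Fin order

  Result : Set
  Result = Generated H ⊎ Atom v

  ~-θˡ : ∀ {x y} → θ x ~ y → x ~ θ y
  ~-θˡ {x} {y} e = subst (_~ θ y) (θ-inv x) (~-θ e)

  record Neighbours (x y z : V) : Set where
    field
      x≢y : x ≢ y
      y≢z : y ≢ z
      x≢z : x ≢ z
      v~x : v ~ x
      v~y : v ~ y
      v~z : v ~ z
      only : ∀ u → v ~ u → (u ≡ x ⊎ u ≡ y) ⊎ u ≡ z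

  open Neighbours

  rotate : ∀ {x y z} → Neighbours x y z → Neighbours y z x
  rotate N = record
    { x≢y = N .y≢z ; y≢z = N .x≢z ∘ sym ; x≢z = N .x≢y ∘ sym ; v~x = N .v~y ; v~y = N .v~z ; v~z = N .v~x
    ; only = λ u e → [ [ inj₂ , inj₁ ∘ inj₁ ]′ , inj₁ ∘ inj₂ ]′ (N .only u e) }

  reflect : ∀ {x y z} → Neighbours x y z → Neighbours y x z
  reflect N = record
    { x≢y = N .x≢y ∘ sym ; y≢z = N .x≢z ; x≢z = N .y≢z ; v~x = N .v~y ; v~y = N .v~x ; v~z = N .v~z
    ; only = λ u e → Sum.map₁ Sum.swap (N .only u e) }

  no-tight-neighbourhood : ∀ {x y z X} → Neighbours x y z → IsTight X → T (X x) → T (X y) → T (X z) → ¬ T (X v) → ⊥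
  no-tight-neighbourhood {x} {y} {z} {X} N t hx hy hz v∉ = tight-deg {X} t v∉
    (size≤deg adj v X (triple x y z) (triple-injective (N .x≢y) (N .y≢z) (N .x≢z)) λ { 0F → N .v~x , hx ; 1F → N .v~y , hy ; 2F → N .v~z , hz })

  Blocked : V → V → Set
  Blocked x y = ∃ λ X → T (X x) × T (X y) × ¬ T (X v) × ¬ T (X (θ v)) × IsTight X

  blocked-sym : ∀ {x y} → Blocked x y → Blocked y x
  blocked-sym (X , p , q , r) = X , q , p , r

  -- Searching the finitely many vertex sets decides between performing the inverse 1-extension and
  -- having a blocking set in hand.
  blocked? : ∀ x y → Dec (Blocked x y)
  blocked? x y = map′ (λ (S , h) → lookup S , h) tabulated
    (anySubset? λ S → T? (lookup S x) ×-dec T? (lookup S y) ×-dec ¬? (T? (lookup S v)) ×-dec ¬? (T? (lookup S (θ v))) ×-dec (F adj (lookup S) ℤ.≟ 0ℤ))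
    where
    tabulated : Blocked x y → ∃ λ S → T (lookup S x) × T (lookup S y) × ¬ T (lookup S v) × ¬ T (lookup S (θ v)) × IsTight (lookup S)
    tabulated (X , p , q , r , s , t) = tabulate X , there x p , there y q , r ∘ back v , s ∘ back (θ v) , trans (F-cong adj (lookup∘tabulate X)) t
      where
      there : ∀ u → T (X u) → T (lookup (tabulate X) u)
      there u = subst T (sym (lookup∘tabulate X u))
      back : ∀ u → T (lookup (tabulate X) u) → T (X u)
      back u = subst T (lookup∘tabulate X u)

  data Status (x y : V) : Set where
    adjacent : x ~ y → Status x y
    opposite : y ≡ θ x → Status x y
    blocked : Blocked x y → Status x y

  opp-sym : ∀ {x y} → y ≡ θ x → x ≡ θ y
  opp-sym {x} refl = sym (θ-inv x)

  status : ∀ {x y z} → Neighbours x y z → Generated H ⊎ Status x y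
  status {x} {y} {z} N with T? (adj x y) | y ≟ θ x | blocked? x y
  ... | yes e | _ | _ = inj₂ (adjacent e)
  ... | no _ | yes e | _ = inj₂ (opposite e)
  ... | no _ | no _ | yes b = inj₂ (blocked b)
  ... | no x≁y | no y≢θx | no free = inj₁ (AddEdge.generated-1-extension deg≡3 x y (neighbour-other (N .v~x)) (neighbour-other (N .v~y)) (N .x≢y) x≁y y≢θx
      (λ X p q r s t → free (X , p , q , r , s , t))
      z (neighbour-other (N .v~z)) (N .x≢z ∘ sym) (N .y≢z ∘ sym) (N .v~x) (N .v~y) (N .v~z) (N .only))

  -- The blocking sets meet in y, so their union is tight; it contains all three neighbours of v but
  -- not v.
  blocked-blocked : ∀ {x y z} → Neighbours x y z → Blocked x y → Blocked y z → ⊥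
  blocked-blocked {x} {y} {z} N (X , Xx , Xy , xv , _ , tx) (Y , yy , yz , yv , _ , ty) =
    no-tight-neighbourhood {X = X ∪ Y} N (proj₁ (tight-lattice {X} {Y} {y} tx ty Xy yy)) (∨-i₁ Xx) (∨-i₁ Xy) (∨-i₂ {X z} yz) ([ xv , yv ]′ ∘ ∨-e)

  -- The blocking set contains the two neighbours x and z of y, so it absorbs y and stays tight, and
  -- then contains all neighbours of v.
  adjacent-adjacent-blocked : ∀ {x y z} → Neighbours x y z → x ~ y → y ~ z → Blocked x z → ⊥
  adjacent-adjacent-blocked {x} {y} {z} N x~y y~z (X , Xx , Xz , xv , _ , t) =
    no-tight-neighbourhood {X = X ∪ single y} N
      (tight-insert {X} {y} t (size≤deg adj y X (pair x z) (pair-injective (N .x≢z)) λ { 0F → ~-sym x~y , Xx ; 1F → y~z , Xz }))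
      (∨-i₁ Xx) (∨-i₂ {X y} (single-∈ y)) (∨-i₁ Xz) ([ xv , (λ h → ~⇒≢ (N .v~y) (single-∋ y h)) ]′ ∘ ∨-e)

  -- If X meets θ X, their union is tight; otherwise the edges xy and θx θy make it so.
  adjacent-opposite-blocked : ∀ {x y z} → Neighbours x y z → x ~ y → z ≡ θ x → Blocked y z → ⊥
  adjacent-opposite-blocked {x} {y} {z} N x~y refl (X , Xy , Xz , xv , xv′ , t) with any? (λ u → T? (X u) ×-dec T? (X (θ u)))
  ... | yes (u , p , q) = no-tight-neighbourhood {X = X ∪ (X ∘ θ)} N (proj₁ (tight-lattice {X} {X ∘ θ} {u} t (tight-θ {X} t) p q))
    (∨-i₂ {X x} Xz) (∨-i₁ Xy) (∨-i₁ Xz) ([ xv , xv′ ]′ ∘ ∨-e)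
  ... | no none = no-tight-neighbourhood {X = X ∪ (X ∘ θ)} N (tight-disjoint {X} {X ∘ θ} {y} t (tight-θ {X} t) Xy (λ u p q → none (u , p , q))
      (pairs≤link adj X (X ∘ θ) (pair y (θ x)) (pair x (θ y)) (pair-injective (N .y≢z))
        λ { 0F → ~-sym x~y , Xy , Xz ; 1F → ~-θ x~y , Xz , subst (T ∘ X) (sym (θ-inv y)) Xy }))
    (∨-i₂ {X x} Xz) (∨-i₁ Xy) (∨-i₁ Xz) ([ xv , xv′ ]′ ∘ ∨-e)

  -- Here v, y, x and z play a, b, c and d of `F₁`. Since z is `θ x`, the edges from v and y to z
  -- reflect to edges from x to `θ v` and `θ y`, which are the edges from c to f and e.
  F₁-copy : ∀ {x y z} → Neighbours x y z → x ~ y → y ~ z → z ≡ θ x → Result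
  F₁-copy {x} {y} {z} N x~y y~z refl = Sum.map₁ base₁ (Copy.realises-or-atom FirstBase.base-F₁ φ φ-injective φ-τ φ-R F₁.a)
    where
    reps : Fin 3 → V
    reps = triple v y x
    joined : ∀ {i j} → i ≢ j → reps i ~ reps j
    joined {0F} {0F} h = contradiction refl h
    joined {0F} {1F} h = N .v~y
    joined {0F} {2F} h = N .v~x
    joined {1F} {0F} h = ~-sym (N .v~y)
    joined {1F} {1F} h = contradiction refl h
    joined {1F} {2F} h = ~-sym x~y
    joined {2F} {0F} h = ~-sym (N .v~x)
    joined {2F} {1F} h = x~y
    joined {2F} {2F} h = contradiction refl h
    code : F₁.Vertex → Fin 3 × Bool
    code F₁.a = 0F , false
    code F₁.b = 1F , false
    code F₁.c = 2F , false
    code F₁.d = 2F , true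
    code F₁.e = 1F , true
    code F₁.f = 0F , true
    decode : Fin 3 × Bool → F₁.Vertex
    decode (0F , false) = F₁.a
    decode (1F , false) = F₁.b
    decode (2F , false) = F₁.c
    decode (2F , true) = F₁.d
    decode (1F , true) = F₁.e
    decode (0F , true) = F₁.f
    decode-code : ∀ p → decode (code p) ≡ p
    decode-code F₁.a = refl
    decode-code F₁.b = refl
    decode-code F₁.c = refl
    decode-code F₁.d = refl
    decode-code F₁.e = refl
    decode-code F₁.f = refl
    φ : F₁.Vertex → V
    φ p = orbit reps (code p)
    φ-injective : Injective φ
    φ-injective {p} {q} e = trans (sym (decode-code p)) (trans (cong decode (orbit-injective reps joined e)) (decode-code q))
    φ-τ : ∀ p → φ (F₁.τ p) ≡ θ (φ p)
    φ-τ F₁.a = refl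
    φ-τ F₁.b = refl
    φ-τ F₁.c = refl
    φ-τ F₁.d = sym (θ-inv x)
    φ-τ F₁.e = sym (θ-inv y)
    φ-τ F₁.f = sym (θ-inv v)
    φ-R : ∀ {p q} → F₁.R p q → φ p ~ φ q
    φ-R F₁.ca = ~-sym (N .v~x)
    φ-R F₁.cb = x~y
    φ-R F₁.ce = ~-θˡ (~-sym y~z)
    φ-R F₁.cf = ~-θˡ (~-sym (N .v~z))
    φ-R F₁.da = ~-sym (N .v~z)
    φ-R F₁.db = ~-sym y~z
    φ-R F₁.de = ~-θ x~y
    φ-R F₁.df = ~-θ (~-sym (N .v~x))
    φ-R F₁.ab = N .v~y
    φ-R F₁.ef = ~-θ (~-sym (N .v~y))

  module Clique {x y z : V} (N : Neighbours x y z) (x~y : x ~ y) (y~z : y ~ z) (x~z : x ~ z) where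

    r : Fin 4 → V
    r = quad v x y z

    joined : ∀ {i j} → i ≢ j → r i ~ r j
    joined {0F} {0F} h = contradiction refl h
    joined {0F} {1F} h = N .v~x
    joined {0F} {2F} h = N .v~y
    joined {0F} {3F} h = N .v~z
    joined {1F} {0F} h = ~-sym (N .v~x)
    joined {1F} {1F} h = contradiction refl h
    joined {1F} {2F} h = x~y
    joined {1F} {3F} h = x~z
    joined {2F} {0F} h = ~-sym (N .v~y)
    joined {2F} {1F} h = ~-sym x~y
    joined {2F} {2F} h = contradiction refl h
    joined {2F} {3F} h = y~z
    joined {3F} {0F} h = ~-sym (N .v~z)
    joined {3F} {1F} h = ~-sym x~z
    joined {3F} {2F} h = ~-sym y~z
    joined {3F} {3F} h = contradiction refl h

    r-injective : Injective r
    r-injective {i} {j} e with i ≟ j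
    ... | yes p = p
    ... | no h = contradiction e (~⇒≢ (joined h))

    -- The indices differ, since no vertex is adjacent to its image. The edge from `r i` to
    -- `θ (r j)` then comes with its reflection from `r j` to `θ (r i)`, and these two are the
    -- bridges of `F₂`.
    F₂-copy : ∀ i j → r i ~ θ (r j) → Result
    F₂-copy i j i~θj with complete-pair i j
    ... | inj₁ refl = ⊥-elim (~̸θ (r i) i~θj)
    ... | inj₂ (p , q , distinct) = Sum.map base₂ atom-at-v (Copy.realises-or-atom SecondBase.base-F₂ φ φ-injective φ-τ φ-R p₀)
      where
      π : Fin 4 → Fin 4
      π = quad p q i j
      π-injective : Injective π
      π-injective {s} {t} e with s ≟ t
      ... | yes h = h
      ... | no h = contradiction e (distinct s t h)
      reps : Fin 4 → V
      reps = r ∘ π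
      reps-joined : ∀ {s t} → s ≢ t → reps s ~ reps t
      reps-joined h = joined (h ∘ π-injective)
      code : F₂.Vertex → Fin 4 × Bool
      code (F₂.a s) = s , false
      -- The involution of `F₂` crosses the last two labels, so the vertex b with label s is the
      -- image of the vertex a with the swapped label.
      code (F₂.b s) = F₂.swap₂₃ s , true
      swap-swap : ∀ s → F₂.swap₂₃ (F₂.swap₂₃ s) ≡ s
      swap-swap 0F = refl
      swap-swap 1F = refl
      swap-swap 2F = refl
      swap-swap 3F = refl
      swap-injective : ∀ {s t} → F₂.swap₂₃ s ≡ F₂.swap₂₃ t → s ≡ t
      swap-injective {s} {t} e = trans (sym (swap-swap s)) (trans (cong F₂.swap₂₃ e) (swap-swap t))
      decode : Fin 4 × Bool → F₂.Vertex
      decode (s , false) = F₂.a s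
      decode (s , true) = F₂.b (F₂.swap₂₃ s)
      decode-code : ∀ p → decode (code p) ≡ p
      decode-code (F₂.a s) = refl
      decode-code (F₂.b s) = cong F₂.b (swap-swap s)
      φ : F₂.Vertex → V
      φ p = orbit reps (code p)
      φ-injective : Injective φ
      φ-injective {p} {q} e = trans (sym (decode-code p)) (trans (cong decode (orbit-injective reps reps-joined e)) (decode-code q))
      φ-τ : ∀ p → φ (F₂.τ p) ≡ θ (φ p)
      φ-τ (F₂.a s) = cong (θ ∘ reps) (swap-swap s)
      φ-τ (F₂.b s) = sym (θ-inv (reps (F₂.swap₂₃ s)))
      φ-R : ∀ {p q} → F₂.R p q → φ p ~ φ q
      φ-R (F₂.aa h) = reps-joined h
      φ-R (F₂.bb h) = ~-θ (reps-joined (h ∘ swap-injective))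
      φ-R F₂.a₂b₂ = i~θj
      φ-R F₂.a₃b₃ = ~-θˡ (~-sym i~θj)
      π-surjective : ∃ λ s → π s ≡ 0F
      π-surjective = find (any? λ s → π s ≟ 0F)
        where
        find : Dec (∃ λ s → π s ≡ 0F) → ∃ λ s → π s ≡ 0F
        find (yes h) = h
        find (no none) = ⊥-elim (no-injection (λ s → pred (π s) (λ e → none (s , e))) λ {s} {t} e → π-injective (pred-injective (π s) (π t) e))
          where
          pred : (i : Fin 4) → i ≢ 0F → Fin 3
          pred 0F h = contradiction refl h
          pred (suc i) _ = i
          pred-injective : ∀ i j {p q} → pred i p ≡ pred j q → i ≡ j
          pred-injective 0F _ {p} e = contradiction refl p
          pred-injective (suc i) 0F {p} {q} e = contradiction refl q
          pred-injective (suc i) (suc j) e = cong suc e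
          no-injection : (f : Fin 4 → Fin 3) → ¬ Injective f
          no-injection f inj = case pigeonhole (from-yes (3 ℕ.<? 4)) f of λ { (s , t , s<t , e) → <-irrefl (inj e) s<t }
      p₀ : F₂.Vertex
      p₀ = F₂.a (proj₁ π-surjective)
      atom-at-v : Atom (φ p₀) → Atom v
      atom-at-v = subst Atom (cong r (proj₂ π-surjective))

    module _ (apart : ∀ i j → ¬ r i ~ θ (r j)) where

      K-tight : IsTight (image r)
      K-tight = F≤0⇒tight (image r) (image-∈ r 0F) (≤-trans (≤-reflexive (F-image adj r r-injective))
          (≤-trans (F-antitone {a = λ i j → not (does (i ≟ j))} (λ i j h → joined λ e → not-e h (does-T (i ≟ j) e))) (≤-reflexive F-K₄)))

      module _ {p q s : V} (Ns : Neighbours p q s) (p~q : p ~ q) (q~s : q ~ s) (p~s : p ~ s) (rp : ∃ λ i → r i ≡ p) (rq : ∃ λ i → r i ≡ q) (rs : ∃ λ i → r i ≡ s)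
        {u : V} (u∉ : ∀ i → u ≢ r i) (p~u : p ~ u) (q~u : q ~ u) where

        -- Merging v into u in the 4-cycle v p u q amounts to deleting v and adding the edge us.
        C₄-reduction : Generated H
        C₄-reduction = AddEdge.generated-C₄ deg≡3 u s (other-i (u∉ 0F) u≢θv) (neighbour-other (Ns .v~z)) u≢s u≁s s≢θu unblocked
            p q (neighbour-other (Ns .v~x)) (neighbour-other (Ns .v~y)) (Ns .x≢y) (~-sym p~u) (~-sym q~u) (Ns .x≢z ∘ sym) (Ns .y≢z ∘ sym)
            (Ns .v~x) (Ns .v~y) (Ns .v~z) (Ns .only)
          where
          member : ∀ {w} → (∃ λ i → r i ≡ w) → T (image r w)
          member (i , refl) = image-∈ r i
          u≢s : u ≢ s
          u≢s e = u∉ (proj₁ rs) (trans e (sym (proj₂ rs)))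
          p≁θ : ∀ j → ¬ p ~ θ (r j)
          p≁θ j e = apart (proj₁ rp) j (subst (_~ θ (r j)) (sym (proj₂ rp)) e)
          u≢θv : u ≢ θ v
          u≢θv e = p≁θ 0F (subst (p ~_) e p~u)
          s≢θu : s ≢ θ u
          s≢θu e = p≁θ (proj₁ rs) (subst (p ~_) (trans (opp-sym e) (cong θ (sym (proj₂ rs)))) p~u)
          -- Otherwise u would have three neighbours in the tight clique without belonging to it.
          u≁s : ¬ u ~ s
          u≁s e = tight-deg {image r} {u} K-tight (λ h → case image-∋ r h of λ (i , e) → u∉ i (sym e))
            (size≤deg adj u (image r) (triple p q s) (triple-injective (Ns .x≢y) (Ns .y≢z) (Ns .x≢z))
              λ { 0F → ~-sym p~u , member rp ; 1F → ~-sym q~u , member rq ; 2F → e , member rs })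
          -- A tight set with u and s absorbs p and then q, each adjacent to both u and s. It would
          -- then contain every neighbour of v but not v.
          unblocked : ∀ X → T (X u) → T (X s) → ¬ T (X v) → ¬ T (X (θ v)) → ¬ IsTight X
          unblocked X xu xs xv _ t = no-tight-neighbourhood {X = X ∪ single p ∪ single q} Ns
              (tight-insert {X ∪ single p} {q} (tight-insert {X} {p} t (two p X p~u p~s xu xs)) (two q (X ∪ single p) q~u q~s (∨-i₁ xu) (∨-i₁ xs)))
              (∨-i₁ (∨-i₂ {X p} (single-∈ p))) (∨-i₂ {X q ∨ single p q} (single-∈ q)) (∨-i₁ (∨-i₁ xs))
              ([ [ xv , (λ h → ~⇒≢ (Ns .v~x) (single-∋ p h)) ]′ ∘ ∨-e , (λ h → ~⇒≢ (Ns .v~y) (single-∋ q h)) ]′ ∘ ∨-e)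
            where
            two : ∀ w Y → w ~ u → w ~ s → T (Y u) → T (Y s) → + 2 ≤ deg adj w Y
            two w Y wu ws yu ys = size≤deg adj w Y (pair u s) (pair-injective u≢s) λ { 0F → wu , yu ; 1F → ws , ys }

      -- All neighbours of v lie in the clique, so the two clique vertices adjacent to u are among
      -- x, y, z, and the symmetries of the triple cover the three possible pairs.
      shared : ∀ u → (∀ i → u ≢ r i) → ∀ i j → i ≢ j → r i ~ u → r j ~ u → Generated H
      shared u u∉ i j i≢j = go i j i≢j
        where
        not-v : ¬ v ~ u
        not-v e = case N .only u e of λ { (inj₁ (inj₁ e)) → u∉ 1F e ; (inj₁ (inj₂ e)) → u∉ 2F e ; (inj₂ e) → u∉ 3F e }
        xyz = C₄-reduction N x~y y~z x~z (1F , refl) (2F , refl) (3F , refl) {u} u∉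
        yzx = C₄-reduction (rotate N) y~z (~-sym x~z) (~-sym x~y) (2F , refl) (3F , refl) (1F , refl) {u} u∉
        xzy = C₄-reduction (reflect (rotate (rotate N))) x~z (~-sym y~z) x~y (1F , refl) (3F , refl) (2F , refl) {u} u∉
        go : ∀ i j → i ≢ j → r i ~ u → r j ~ u → Generated H
        go 0F _ _ e _ = contradiction e not-v
        go (suc _) 0F _ _ f = contradiction f not-v
        go 1F 1F h _ _ = contradiction refl h
        go 1F 2F _ e f = xyz e f
        go 1F 3F _ e f = xzy e f
        go 2F 1F _ e f = xyz f e
        go 2F 2F h _ _ = contradiction refl h
        go 2F 3F _ e f = yzx e f
        go 3F 1F _ e f = xzy f e
        go 3F 2F _ e f = yzx f e
        go 3F 3F h _ _ = contradiction refl h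

      clique-reduction : Generated H
      clique-reduction = decide (any? λ u → all? (λ i → ¬? (u ≟ r i)) ×-dec any? λ i → any? λ j → ¬? (i ≟ j) ×-dec T? (adj (r i) u) ×-dec T? (adj (r j) u))
        where
        decide : Dec (∃ λ u → (∀ i → u ≢ r i) × ∃ λ i → ∃ λ j → i ≢ j × r i ~ u × r j ~ u) → Generated H
        decide (yes (u , u∉ , i , j , i≢j , e , f)) = shared u u∉ i j i≢j e f
        decide (no none) = Contract.contraction H c ih r joined apart λ u u∉ {i} {j} e f → equal u u∉ i j e f (i ≟ j)
          where
          equal : ∀ u → (∀ i → u ≢ r i) → ∀ i j → r i ~ u → r j ~ u → Dec (i ≡ j) → i ≡ j
          equal u u∉ i j e f (yes p) = p
          equal u u∉ i j e f (no h) = contradiction (u , u∉ , i , j , h , e , f) none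

    clique-result : Result
    clique-result = decide (any? λ i → any? λ j → T? (adj (r i) (θ (r j))))
      where
      decide : Dec (∃ λ i → ∃ λ j → r i ~ θ (r j)) → Result
      decide (yes (i , j , e)) = F₂-copy i j e
      decide (no none) = inj₁ (clique-reduction λ i j e → none (i , j , e))

  -- At most one pair is blocked, and at most one is opposite since θ is injective. Hence some pair
  -- is adjacent. Without a blocked pair, three adjacent pairs give the clique and two with an
  -- opposite one give a copy of `F₁`; a single blocked pair is excluded by its company.
  combine : ∀ {x y z} → Neighbours x y z → Status x y → Status y z → Status z x → Result
  combine N (adjacent a) (adjacent b) (adjacent c) = Clique.clique-result N a b (~-sym c)
  combine N (adjacent a) (adjacent b) (opposite c) = F₁-copy N a b (opp-sym c)
  combine N (adjacent a) (opposite b) (adjacent c) = F₁-copy (rotate (rotate N)) c a (opp-sym b)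
  combine N (opposite a) (adjacent b) (adjacent c) = F₁-copy (rotate N) b c (opp-sym a)
  combine N (adjacent a) (adjacent b) (blocked c) = ⊥-elim (adjacent-adjacent-blocked N a b (blocked-sym c))
  combine N (adjacent a) (blocked b) (adjacent c) = ⊥-elim (adjacent-adjacent-blocked (rotate (rotate N)) c a (blocked-sym b))
  combine N (blocked a) (adjacent b) (adjacent c) = ⊥-elim (adjacent-adjacent-blocked (rotate N) b c (blocked-sym a))
  combine N (adjacent a) (blocked b) (opposite c) = ⊥-elim (adjacent-opposite-blocked N a (opp-sym c) b)
  combine N (adjacent a) (opposite b) (blocked c) = ⊥-elim (adjacent-opposite-blocked (reflect N) (~-sym a) b (blocked-sym c))
  combine N (opposite a) (adjacent b) (blocked c) = ⊥-elim (adjacent-opposite-blocked (rotate N) b (opp-sym a) c)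
  combine N (blocked a) (adjacent b) (opposite c) = ⊥-elim (adjacent-opposite-blocked (reflect (rotate N)) (~-sym b) c (blocked-sym a))
  combine N (opposite a) (blocked b) (adjacent c) = ⊥-elim (adjacent-opposite-blocked (reflect (rotate (rotate N))) (~-sym c) a (blocked-sym b))
  combine N (blocked a) (opposite b) (adjacent c) = ⊥-elim (adjacent-opposite-blocked (rotate (rotate N)) c (opp-sym b) a)
  combine N (blocked a) (blocked b) _ = ⊥-elim (blocked-blocked N a b)
  combine N (blocked a) _ (blocked c) = ⊥-elim (blocked-blocked (rotate (rotate N)) c a)
  combine N _ (blocked b) (blocked c) = ⊥-elim (blocked-blocked (rotate N) b c)
  combine N (opposite a) (opposite b) _ = contradiction (trans (opp-sym a) (sym b)) (N .x≢z)
  combine N (opposite a) _ (opposite c) = contradiction (trans a (sym (opp-sym c))) (N .y≢z)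
  combine N _ (opposite b) (opposite c) = contradiction (trans c (sym (opp-sym b))) (N .x≢y)

  degree-3 : Result
  degree-3 = case three-elements (adj v) (trans (sym (deg-full adj v)) deg≡3) of λ
    { (x , y , z , x≢y , y≢z , x≢z , v~x , v~y , v~z , only) →
      let N = record { x≢y = x≢y ; y≢z = y≢z ; x≢z = x≢z ; v~x = v~x ; v~y = v~y ; v~z = v~z
                     ; only = λ u e → [ inj₁ ∘ inj₁ , [ inj₁ ∘ inj₂ , inj₂ ]′ ]′ (only u e) }
      in [ inj₁ , (λ a → [ inj₁ , (λ b → [ inj₁ , combine N a b ]′ (status (rotate (rotate N)))) ]′ (status (rotate N))) ]′ (status N) }

-- Splitting along two edges

complement : Sub n → Sub n
complement X x = not (X x)

module Part (H : ℤ₂Graph) (c : Ci (ℤ₂Graph.adj H) (ℤ₂Graph.θ H)) (W : Sub (ℤ₂Graph.order H))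
  (W-inv : Ci.Invariant c W) (W-tight : F (ℤ₂Graph.adj H) W ≡ 0ℤ) where
  open ℤ₂Graph H
  open Ci c using (θ-free; ~̸θ; a-irr)

  open Restrict {b = adj} adj-sym a-irr θ-inv θ-auto W (λ {x} → subst T (sym (W-inv x))) public

  module Rest = Enumeration (enumerate (complement W))

  iso : Fin order ↔ (Fin size ⊎ Fin Rest.size)
  iso = split W Rest.elem Rest.elem-injective (λ b → not-e (Rest.elem-∈ b)) λ x h → Rest.index x (not-i h)

  private
    lift : Sub size → Sub order
    lift X = [ X , (λ _ → false) ]′ ∘ Inverse.to iso
    lift-elem : ∀ X x → lift X (elem x) ≡ X x
    lift-elem X x = cong [ X , (λ _ → false) ]′ (Inverse.strictlyInverseˡ iso (inj₁ x))
    F-lift : ∀ X → F (adj ↾ elem) X ≡ F adj (lift X)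
    F-lift X = sym (trans (Parts.F-outside iso (mk↔ₛ′ id id (λ _ → refl) (λ _ → refl)) {adj} adj-sym (lift X)
      λ l → cong [ X , (λ _ → false) ]′ (Inverse.strictlyInverseˡ iso (inj₂ l))) (F-cong (adj ↾ elem) (lift-elem X)))
    lift-full : ∀ z → lift full z ≡ W z
    lift-full z = trans (at (Inverse.to iso z)) (cong W (Inverse.strictlyInverseʳ iso z))
      where
      at : ∀ p → [ full , (λ _ → false) ]′ p ≡ W (Inverse.from iso p)
      at (inj₁ i) = T⇔≡ (λ _ → elem-∈ i) (λ _ → tt)
      at (inj₂ i) = T⇔≡ (λ ()) (λ t → not-e (Rest.elem-∈ i) t)

  ciG : Ci (ℤ₂Graph.adj restricted) (ℤ₂Graph.θ restricted)
  ciG = record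
    { involutive = restricted-involutive (λ x _ → θ-free x) (λ x _ → ~̸θ x)
    ; sparse = λ X {x} h → subst (0ℤ ≤_) (sym (F-lift X)) (Ci.sparse c (lift X) {elem x} (subst T (sym (lift-elem X x)) h))
    ; tight = trans (F-lift full) (trans (F-cong adj lift-full) W-tight)
    }

Fin⇒0< : Fin k → 0 ℕ.< k
Fin⇒0< zero = s≤s z≤n
Fin⇒0< (suc _) = s≤s z≤n

module Split (H : ℤ₂Graph) (c : Ci (ℤ₂Graph.adj H) (ℤ₂Graph.θ H)) (ih : IH (ℤ₂Graph.order H)) (W : Sub (ℤ₂Graph.order H))
  (W-inv : Ci.Invariant c W) (W-tight : F (ℤ₂Graph.adj H) W ≡ 0ℤ) (rest-tight : F (ℤ₂Graph.adj H) (complement W) ≡ 0ℤ) where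
  open ℤ₂Graph H
  open Ci c using (θ-free; ~̸θ; ~-sym; ~-θ; F-disjoint; tight)

  module P₁ = Part H c W W-inv W-tight
  module P₂ = Part H c (complement W) (λ x → cong not (W-inv x)) rest-tight

  cut : ℤ
  cut = link adj W (complement W)

  whole : ∀ b → true ≡ b ∨ not b
  whole true = refl
  whole false = refl

  -- The tight whole is the disjoint union of two tight sets, so 0 = 4 - 2·`cut`. Each crossing edge
  -- counts once, from W outwards.
  cut≡2 : cut ≡ + 2
  cut≡2 = ℤ.*-cancelˡ-≡ (+ 2) cut (+ 2) (lem cut (trans (sym tight) (trans (F-cong adj λ x → whole (W x))
    (trans (F-disjoint W (complement W) λ x p q → not-e q p) (cong₂ (λ u v → u + v + + 4 - + 2 * cut) W-tight rest-tight)))))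
    where
    lem : ∀ l → 0ℤ ≡ 0ℤ + 0ℤ + + 4 - + 2 * l → + 2 * l ≡ + 2 * + 2
    lem l e = trans (lem₁ l) (cong (λ z → + 4 - z) (sym e))
      where
      lem₁ : ∀ l → + 2 * l ≡ + 4 - (0ℤ + 0ℤ + + 4 - + 2 * l)
      lem₁ = solve-∀

  Crossing : Fin order → Fin order → Set
  Crossing x y = T (W x) × ¬ T (W y) × x ~ y

  crossing? : Dec (∃ λ x → ∃ λ y → Crossing x y)
  crossing? = any? λ x → any? λ y → T? (W x) ×-dec ¬? (T? (W y)) ×-dec T? (adj x y)

  crossing : ∃ λ x → ∃ λ y → Crossing x y
  crossing = decide crossing?
    where
    decide : Dec (∃ λ x → ∃ λ y → Crossing x y) → ∃ λ x → ∃ λ y → Crossing x y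
    decide (yes p) = p
    decide (no none) = case trans (sym cut≡2) (trans (∑-cong λ x → trans (∑-cong λ y → ind-unique
      (ind-× (ind-Bool (adj x y)) (ind-× (ind-Bool (W x)) (ind-Bool (not (W y)))))
      (inj₂ (refl , λ (e , p , q) → none (x , y , p , not-e q , e)))) (∑-0 order)) (∑-0 order)) of λ ()

  x y : Fin order
  x = proj₁ crossing
  y = proj₁ (proj₂ crossing)
  x∈ : T (W x)
  x∈ = proj₁ (proj₂ (proj₂ crossing))
  y∉ : ¬ T (W y)
  y∉ = proj₁ (proj₂ (proj₂ (proj₂ crossing)))
  x~y : x ~ y
  x~y = proj₂ (proj₂ (proj₂ (proj₂ crossing)))

  Pair : Fin order → Fin order → Set
  Pair u v = (u ≡ x × v ≡ y) ⊎ (u ≡ θ x × v ≡ θ y)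

  pair-indicator : Fin order → Fin order → ℤ
  pair-indicator u v = δ x u * δ y v + δ (θ x) u * δ (θ y) v

  pair-ind : ∀ u v → Ind (pair-indicator u v) (Pair u v)
  pair-ind u v = ind-⊎ (ind-× (ind-δ x u) (ind-δ y v)) (ind-× (ind-δ (θ x) u) (ind-δ (θ y) v)) λ { (refl , _) (e , _) → θ-free x (sym e) }

  Pair⇒Crossing : ∀ {u v} → Pair u v → Crossing u v
  Pair⇒Crossing (inj₁ (refl , refl)) = x∈ , y∉ , x~y
  Pair⇒Crossing (inj₂ (refl , refl)) = subst T (sym (W-inv x)) x∈ , y∉ ∘ subst T (W-inv y) , ~-θ x~y

  entry-ind : ∀ u v → Ind (⟦ adj u v ⟧ * (⟦ W u ⟧ * ⟦ not (W v) ⟧)) (Crossing u v)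
  entry-ind u v = ind-map (λ (e , p , q) → p , not-e q , e) (λ (p , q , e) → e , p , not-i q)
    (ind-× (ind-Bool (adj u v)) (ind-× (ind-Bool (W u)) (ind-Bool (not (W v)))))

  total : ∑ (λ u → ∑ λ v → pair-indicator u v) ≡ + 2
  total = trans (∑-cong λ u → trans (∑-+ (λ v → δ x u * δ y v) (λ v → δ (θ x) u * δ (θ y) v)) (cong₂ _+_ (row x y u) (row (θ x) (θ y) u)))
      (trans (∑-+ (δ x) (δ (θ x))) (cong₂ _+_ (∣single∣ x) (∣single∣ (θ x))))
    where
    row : ∀ p q u → ∑ (λ v → δ p u * δ q v) ≡ δ p u
    row p q u = trans (∑-* (δ p u) (δ q)) (trans (cong (δ p u *_) (∣single∣ q)) (ℤ.*-identityʳ (δ p u)))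

  -- One crossing edge and its image already account for the cut of 2. Comparing rows and then
  -- entries leaves no place for another crossing edge.
  pointwise : ∀ u v → pair-indicator u v ≡ ⟦ adj u v ⟧ * (⟦ W u ⟧ * ⟦ not (W v) ⟧)
  pointwise u = ∑-≡⇒≡ (λ v → ind-≤ (pair-ind u v) (entry-ind u v) Pair⇒Crossing) (≤-reflexive (sym (rows u)))
    where
    rows : ∀ u → ∑ (pair-indicator u) ≡ ∑ λ v → ⟦ adj u v ⟧ * (⟦ W u ⟧ * ⟦ not (W v) ⟧)
    rows = ∑-≡⇒≡ (λ u → ∑-mono λ v → ind-≤ (pair-ind u v) (entry-ind u v) Pair⇒Crossing) (≤-reflexive (trans cut≡2 (sym total)))

  Crossing⇒Pair : ∀ {u v} → Crossing u v → Pair u v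
  Crossing⇒Pair {u} {v} h = read (pair-ind u v) (entry-ind u v)
    where
    read : ∀ {w} → Ind (pair-indicator u v) (Pair u v) → Ind w (Crossing u v) → Pair u v
    read (inj₁ (_ , p)) _ = p
    read (inj₂ (e , _)) _ = case trans (sym (ind-unique (entry-ind u v) (inj₁ (refl , h)))) (trans (sym (pointwise u v)) e) of λ ()

  G₁ = P₁.restricted
  G₂ = P₂.restricted

  iso : Fin order ↔ (Fin P₁.size ⊎ Fin P₂.size)
  iso = P₁.iso

  open Inverse iso using (from)

  x̂ : Fin P₁.size
  x̂ = proj₁ (P₁.index x x∈)
  elem-x̂ : P₁.elem x̂ ≡ x
  elem-x̂ = proj₂ (P₁.index x x∈)
  ŷ : Fin P₂.size
  ŷ = proj₁ (P₂.index y (not-i y∉))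
  elem-ŷ : P₂.elem ŷ ≡ y
  elem-ŷ = proj₂ (P₂.index y (not-i y∉))

  module J₀ = Join G₁ G₂ P₁.ciG P₂.ciG x̂ ŷ

  elem-θx̂ : P₁.elem (P₁.θ↾ x̂) ≡ θ x
  elem-θx̂ = trans (P₁.elem-θ x̂) (cong θ elem-x̂)
  elem-θŷ : P₂.elem (P₂.θ↾ ŷ) ≡ θ y
  elem-θŷ = trans (P₂.elem-θ ŷ) (cong θ elem-ŷ)

  cross : ∀ u v → P₁.elem u ~ P₂.elem v → J₀.Cross u v
  cross u v e = Sum.map (λ (p , q) → P₁.elem-injective (trans p (sym elem-x̂)) , P₂.elem-injective (trans q (sym elem-ŷ)))
    (λ (p , q) → P₁.elem-injective (trans p (sym elem-θx̂)) , P₂.elem-injective (trans q (sym elem-θŷ)))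
    (Crossing⇒Pair (P₁.elem-∈ u , not-e (P₂.elem-∈ v) , e))

  cross⁻ : ∀ u v → J₀.Cross u v → P₁.elem u ~ P₂.elem v
  cross⁻ u v (inj₁ (refl , refl)) = subst₂ _~_ (sym elem-x̂) (sym elem-ŷ) x~y
  cross⁻ u v (inj₂ (refl , refl)) = subst₂ _~_ (sym elem-θx̂) (sym elem-θŷ) (~-θ x~y)

  ⇒S : ∀ p q → from p ~ from q → J₀.S p q
  ⇒S (inj₁ u) (inj₁ v) e = e
  ⇒S (inj₂ u) (inj₂ v) e = e
  ⇒S (inj₁ u) (inj₂ v) e = cross u v e
  ⇒S (inj₂ v) (inj₁ u) e = cross u v (~-sym e)

  S⇒ : ∀ p q → J₀.S p q → from p ~ from q
  S⇒ (inj₁ u) (inj₁ v) e = e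
  S⇒ (inj₂ u) (inj₂ v) e = e
  S⇒ (inj₁ u) (inj₂ v) h = cross⁻ u v h
  S⇒ (inj₂ v) (inj₁ u) h = ~-sym (cross⁻ u v h)

  θ-from : ∀ p → θ (from p) ≡ from (Sum.map (ℤ₂Graph.θ G₁) (ℤ₂Graph.θ G₂) p)
  θ-from (inj₁ u) = sym (P₁.elem-θ u)
  θ-from (inj₂ u) = sym (P₂.elem-θ u)

  joined : Generated H
  joined = joining G₁ G₂ (ih G₁ smaller₁ (Ci⇒CiTight G₁ P₁.ciG)) (ih G₂ smaller₂ (Ci⇒CiTight G₂ P₂.ciG)) x̂ ŷ
      (realise-by iso θ-from λ p q → mk⇔ (λ e → J₀.S⇒Edge p q (⇒S p q e)) (λ e → S⇒ p q (J₀.Edge⇒S e)))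
    where
    sizes : order ≡ P₁.size ℕ.+ P₂.size
    sizes = size-split iso (mk↔ₛ′ id id (λ _ → refl) (λ _ → refl))
    smaller₁ : P₁.size ℕ.< order
    smaller₁ = subst (P₁.size ℕ.<_) (sym sizes) (ℕ.m<m+n P₁.size (Fin⇒0< ŷ))
    smaller₂ : P₂.size ℕ.< order
    smaller₂ = subst (P₂.size ℕ.<_) (sym sizes) (ℕ.m<n+m P₂.size (Fin⇒0< x̂))

-- The counting argument

choose : {A : Set} {B : Fin n → Set} → (∀ i → A ⊎ B i) → A ⊎ (∀ i → B i)
choose {zero} f = inj₂ λ ()
choose {suc n} f with f zero | choose (f ∘ suc)
... | inj₁ a | _ = inj₁ a
... | inj₂ _ | inj₁ a = inj₁ a
... | inj₂ b | inj₂ g = inj₂ λ { zero → b ; (suc i) → g i }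

module Discharge (H : ℤ₂Graph) (c : Ci (ℤ₂Graph.adj H) (ℤ₂Graph.θ H)) (ih : IH (ℤ₂Graph.order H)) where
  open ℤ₂Graph H
  open Ci c using (Invariant; θ-free; ~̸θ; a-irr; F-disjoint; F-invariant; tight; sparse; link-sym)
  open TightSets c
  open Atoms H c

  invariant-bound : ∀ X → Invariant X → link adj X X ≤ ∣ X ∣ₛ * ∣ X ∣ₛ - + 2 * ∣ X ∣ₛ
  invariant-bound X inv = link-bound {a = adj} X θ inv ~̸θ a-irr θ-free

  -- For an invariant set of s vertices, missing loops and missing edges from x to `θ x` give that
  -- `F` is at least (s - 1)(5 - s) + 1, which is positive for s from 1 to 5.
  six : ∀ {X v} → Invariant X → IsTight X → T (X v) → ¬ (∣ X ∣ₛ ≤ + 5)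
  six {X} inv t h le = ≤⇒≱ {1ℤ} {0ℤ} (ℤ.0≤i-j⇒j≤i (0≤-by _ (0≤+ (0≤* (0≤- (1≤∣_∣ₛ (Ci.graphical c) X h)) (0≤- le)) (0≤- (invariant-bound X inv)))
      (lem ∣ X ∣ₛ (link adj X X) (trans (sym (F-def adj X)) t)))) (≤-reflexive refl)
    where
    lem : ∀ s l → + 4 * s - + 4 - l ≡ 0ℤ → 0ℤ - 1ℤ ≡ (s - 1ℤ) * (+ 5 - s) + (s * s - + 2 * s - l)
    lem s l e = trans (cong (λ z → z - 1ℤ) (sym e)) (lem₁ s l)
      where
      lem₁ : ∀ s l → + 4 * s - + 4 - l - 1ℤ ≡ (s - 1ℤ) * (+ 5 - s) + (s * s - + 2 * s - l)
      lem₁ = solve-∀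

  link-deg : ∀ Y W → link adj Y W ≡ ∑ λ x → ⟦ Y x ⟧ * deg adj x W
  link-deg Y W = ∑-cong λ x → trans (∑-cong λ y → lem ⟦ adj x y ⟧ ⟦ Y x ⟧ ⟦ W y ⟧) (∑-* ⟦ Y x ⟧ λ y → ⟦ adj x y ⟧ * ⟦ W y ⟧)
    where
    lem : ∀ p q r → p * (q * r) ≡ q * (p * r)
    lem = solve-∀

  link-∪ : ∀ Z {X Y W : Sub order} → (∀ x → ⟦ W x ⟧ ≡ ⟦ X x ⟧ + ⟦ Y x ⟧) → link adj Z W ≡ link adj Z X + link adj Z Y
  link-∪ Z {X} {Y} e = trans (E-cong adj λ x y → trans (cong (⟦ Z x ⟧ *_) (e y)) (ℤ.*-distribˡ-+ ⟦ Z x ⟧ ⟦ X y ⟧ ⟦ Y y ⟧))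
    (E-+ adj (λ x y → ⟦ Z x ⟧ * ⟦ X y ⟧) (λ x y → ⟦ Z x ⟧ * ⟦ Y y ⟧))

  module _ {v : Fin order} (A : Atom v) where
    open Atom A

    -- A nonempty complement Y of X in W would have at most two vertices, each
    -- with three neighbours in W, which is too many edges for F X = 0.
    minimal : ∀ {X z} → Invariant X → IsTight X → T (X z) → (∀ {x} → T (X x) → T (W x)) → ∀ {x} → T (W x) → T (X x)
    minimal {X} {z} inv t hz X⊆W {x} hx = decide (T? (X x))
      where
      Y : Sub order
      Y = W ∖ X
      Y-inv : Invariant Y
      Y-inv x = cong₂ (λ b c → b ∧ not c) (W-inv x) (inv x)
      s u L ℓ : ℤ
      s = ∣ X ∣ₛ
      u = ∣ Y ∣ₛ
      L = link adj Y X
      ℓ = link adj Y Y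
      parts : ∀ x → ⟦ W x ⟧ ≡ ⟦ Y x ⟧ + ⟦ X x ⟧
      parts x = bits (W x) (X x) X⊆W
        where
        bits : ∀ w x → (T x → T w) → ⟦ w ⟧ ≡ ⟦ w ∧ not x ⟧ + ⟦ x ⟧
        bits true true _ = refl
        bits true false _ = refl
        bits false true h = ⊥-elim (h tt)
        bits false false _ = refl
      cover : ∀ x → W x ≡ (Y ∪ X) x
      cover x = bits (W x) (X x) X⊆W
        where
        bits : ∀ w x → (T x → T w) → w ≡ (w ∧ not x) ∨ x
        bits true true _ = refl
        bits true false _ = refl
        bits false true h = ⊥-elim (h tt)
        bits false false _ = refl
      relation : + 2 * L ≡ + 4 * u - ℓ
      relation = lem (F adj Y) L (+ 4 * u) ℓ (trans (sym W-tight) (trans (F-cong adj cover)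
          (trans (F-disjoint Y X λ x p q → not-e (∧-e₂ {W x} p) q) (cong (λ z → F adj Y + z + + 4 - + 2 * L) t)))) (F-def adj Y)
        where
        lem : ∀ f l u k → 0ℤ ≡ f + 0ℤ + + 4 - + 2 * l → f ≡ u - + 4 - k → + 2 * l ≡ u - k
        lem f l u k e refl = trans (lem₁ u k l) (trans (cong (λ z → u - k - z) (sym e)) (ℤ.+-identityʳ (u - k)))
          where
          lem₁ : ∀ u k l → + 2 * l ≡ u - k - (u - + 4 - k + 0ℤ + + 4 - + 2 * l)
          lem₁ = solve-∀
      degrees : + 3 * u ≤ ℓ + L
      degrees = ≤-trans (≤-reflexive (sym (∑-* (+ 3) λ x → ⟦ Y x ⟧))) (≤-trans (∑-mono λ x → pointwise x (Y x) refl)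
          (≤-reflexive (trans (sym (link-deg Y W)) (link-∪ Y {Y} {X} {W} parts))))
        where
        pointwise : ∀ x b → Y x ≡ b → + 3 * ⟦ Y x ⟧ ≤ ⟦ Y x ⟧ * deg adj x W
        pointwise x true e = subst (λ b → + 3 * ⟦ b ⟧ ≤ ⟦ b ⟧ * deg adj x W) (sym e)
          (≤-trans (rows x (∧-e₁ {W x} (subst T (sym e) tt))) (≤-reflexive (sym (ℤ.*-identityˡ (deg adj x W)))))
        pointwise x false e = subst (λ b → + 3 * ⟦ b ⟧ ≤ ⟦ b ⟧ * deg adj x W) (sym e) ≤-refl
      sizes : ∣ W ∣ₛ ≡ u + s
      sizes = trans (∑-cong parts) (∑-+ (λ x → ⟦ Y x ⟧) (λ x → ⟦ X x ⟧))
      -- The atom has at most eight vertices, of which X takes at least six.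
      u≤2 : u ≤ + 2
      u≤2 = ≤-by _ (0≤+ (0≤- ∣W∣≤8) (0≤- 6≤s)) (trans (lem u s) (cong (λ z → u + (+ 8 - z + (s - + 6))) (sym sizes)))
        where
        6≤s : + 6 ≤ s
        6≤s = ℤ.i<j⇒suc[i]≤j (ℤ.≰⇒> (six {X} inv t hz))
        lem : ∀ u s → + 2 ≡ u + (+ 8 - (u + s) + (s - + 6))
        lem = solve-∀
      -- Doubling `degrees` and inserting `relation` gives 6u ≤ ℓ + 4u, so ℓ ≥ 2u. But Y is
      -- invariant, so ℓ ≤ u² - 2u, and this is at most 0 for u equal to 1 or 2.
      none-left-over : ¬ (1ℤ ≤ u)
      none-left-over 1≤u = case subst (0ℤ ≤_) (lem u L ℓ relation) (0≤+ (0≤+ (0≤+ (0≤* {+ 2} (+≤+ z≤n) (0≤- degrees)) (0≤- (invariant-bound Y Y-inv)))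
          (0≤* (0≤- 1≤u) (0≤- u≤2))) (0≤- 1≤u)) of λ ()
        where
        lem : ∀ u L ℓ → + 2 * L ≡ + 4 * u - ℓ → + 2 * (ℓ + L - + 3 * u) + (u * u - + 2 * u - ℓ) + (u - 1ℤ) * (+ 2 - u) + (u - 1ℤ) ≡ - + 3
        lem u L ℓ e = trans (lem₁ u L ℓ) (trans (cong (λ z → + 2 * ℓ + z - + 6 * u + (u * u - + 2 * u - ℓ) + (u - 1ℤ) * (+ 2 - u) + (u - 1ℤ)) e) (lem₂ u ℓ))
          where
          lem₁ : ∀ u L ℓ → + 2 * (ℓ + L - + 3 * u) + (u * u - + 2 * u - ℓ) + (u - 1ℤ) * (+ 2 - u) + (u - 1ℤ)
            ≡ + 2 * ℓ + + 2 * L - + 6 * u + (u * u - + 2 * u - ℓ) + (u - 1ℤ) * (+ 2 - u) + (u - 1ℤ)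
          lem₁ = solve-∀
          lem₂ : ∀ u ℓ → + 2 * ℓ + (+ 4 * u - ℓ) - + 6 * u + (u * u - + 2 * u - ℓ) + (u - 1ℤ) * (+ 2 - u) + (u - 1ℤ) ≡ - + 3
          lem₂ = solve-∀
      decide : Dec (T (X x)) → T (X x)
      decide (yes h) = h
      decide (no h) = ⊥-elim (none-left-over (1≤∣_∣ₛ (Ci.graphical c) Y {x} (∧-i hx (not-i h))))

  -- The intersection is nonempty, invariant and tight, so minimality of A makes it all of A.
  -- Exchanging the roles of A and B shows that atoms that meet coincide.
  nested : ∀ {v w} (A : Atom v) (B : Atom w) {z} → T (Atom.W A z) → T (Atom.W B z) → ∀ {x} → T (Atom.W A x) → T (Atom.W B x)
  nested A B {z} a b h = ∧-e₂ {Atom.W A _} (minimal A {Atom.W A ∩ Atom.W B} {z}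
    (λ x → cong₂ _∧_ (Atom.W-inv A x) (Atom.W-inv B x)) (proj₂ (tight-lattice {Atom.W A} {Atom.W B} {z} (Atom.W-tight A) (Atom.W-tight B) a b))
    (∧-i a b) ∧-e₁ h)

  excess : Fin order → ℤ
  excess x = deg adj x full - + 4

  total-excess : Sub order → ℤ
  total-excess U = ∑ λ x → ⟦ U x ⟧ * excess x

  total-excess-link : ∀ U → total-excess U ≡ link adj U full - + 4 * ∣ U ∣ₛ
  total-excess-link U = trans (∑-cong λ x → lem ⟦ U x ⟧ (deg adj x full))
    (trans (∑-- (λ x → ⟦ U x ⟧ * deg adj x full) (λ x → + 4 * ⟦ U x ⟧)) (cong₂ _-_ (sym (link-deg U full)) (∑-* (+ 4) λ x → ⟦ U x ⟧)))
    where
    lem : ∀ u d → u * (d - + 4) ≡ u * d - + 4 * u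
    lem = solve-∀

  full-excess : total-excess full ≡ - + 4
  full-excess = trans (total-excess-link full) (lem (link adj full full) (+ 4 * ∣ full {order} ∣ₛ) (trans (sym tight) (F-def adj full)))
    where
    lem : ∀ l s → 0ℤ ≡ s - + 4 - l → l - s ≡ - + 4
    lem l s e = trans (lem₁ l s) (trans (cong (λ z → - z - + 4) (sym e)) refl)
      where
      lem₁ : ∀ l s → l - s ≡ - (s - + 4 - l) - + 4
      lem₁ = solve-∀

  -- Unless W splits off along two edges, at least four edges leave the atom W.
  atom-excess : ∀ {v} (A : Atom v) → F adj (complement (Atom.W A)) ≢ 0ℤ → 0ℤ ≤ total-excess (Atom.W A)
  atom-excess A F≢0 = 0≤-by (L - + 4) four≤ excess≡
    where
    open Atom A
    Wᶜ = complement W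
    L : ℤ
    L = link adj W Wᶜ
    Wᶜ-inv : Invariant Wᶜ
    Wᶜ-inv x = cong not (W-inv x)
    relation : F adj Wᶜ ≡ + 2 * L - + 4
    relation = lem (F adj Wᶜ) L (trans (sym tight) (trans (F-cong adj λ x → whole (W x))
      (trans (F-disjoint W Wᶜ λ x p q → not-e q p) (cong (λ z → z + F adj Wᶜ + + 4 - + 2 * L) W-tight))))
      where
      whole : ∀ b → true ≡ b ∨ not b
      whole true = refl
      whole false = refl
      lem : ∀ f l → 0ℤ ≡ 0ℤ + f + + 4 - + 2 * l → f ≡ + 2 * l - + 4
      lem f l e = trans (lem₁ f l) (trans (cong (λ z → z + + 2 * l - + 4) (sym e)) (lem₂ l))
        where
        lem₁ : ∀ f l → f ≡ 0ℤ + f + + 4 - + 2 * l + + 2 * l - + 4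
        lem₁ = solve-∀
        lem₂ : ∀ l → 0ℤ + + 2 * l - + 4 ≡ + 2 * l - + 4
        lem₂ = solve-∀
    four≤ : 0ℤ ≤ L - + 4
    four≤ = 0≤- (ℤ.*-cancelˡ-≤-pos (+ 4) L (+ 2) (≤-by _ (0≤- (four-gap (F-invariant Wᶜ Wᶜ-inv)
      (sparse Wᶜ {proj₁ proper} (not-i (proj₂ proper))) F≢0)) (trans (lem L) (cong (λ z → + 2 * + 4 + (z - + 4)) (sym relation)))))
      where
      lem : ∀ l → + 2 * l ≡ + 2 * + 4 + (+ 2 * l - + 4 - + 4)
      lem = solve-∀
    excess≡ : total-excess W ≡ L - + 4
    excess≡ = trans (total-excess-link W) (trans (cong (λ z → z - + 4 * ∣ W ∣ₛ) (link-∪ W {W} {Wᶜ} {full} λ x → bits (W x)))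
      (lem (link adj W W) L (+ 4 * ∣ W ∣ₛ) (trans (sym W-tight) (F-def adj W))))
      where
      bits : ∀ b → 1ℤ ≡ ⟦ b ⟧ + ⟦ not b ⟧
      bits true = refl
      bits false = refl
      lem : ∀ k l s → 0ℤ ≡ s - + 4 - k → k + l - s ≡ l - + 4
      lem k l s e = trans (lem₁ k l s) (trans (cong (λ z → l - + 4 - z) (sym e)) (ℤ.+-identityʳ (l - + 4)))
        where
        lem₁ : ∀ k l s → k + l - s ≡ l - + 4 - (s - + 4 - k)
        lem₁ = solve-∀

  Settled : Fin order → Set
  Settled v = 0ℤ ≤ excess v ⊎ ∃ λ (A : Atom v) → F adj (complement (Atom.W A)) ≢ 0ℤ

  -- Invariant of the greedy union: no atom is cut by U. An atom around a vertex outside U is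
  -- therefore disjoint from U, and its excess can simply be added.
  Closed : Sub order → Set
  Closed U = ∀ {v} (A : Atom v) → (∀ x → T (Atom.W A x) → T (U x)) ⊎ (∀ x → T (Atom.W A x) → ¬ T (U x))

  module _ (settled : ∀ v → Settled v) where

    -- Stands for a disjoint family of atoms: only their union and its total excess are recorded,
    -- together with the fact that each listed vertex is in the union or has degree at least 4.
    record Cover {k : ℕ} (vs : Fin k → Fin order) : Set where
      field
        U : Sub order
        closed : Closed U
        nonneg : 0ℤ ≤ total-excess U
        covers : ∀ i → T (U (vs i)) ⊎ 0ℤ ≤ excess (vs i)

    cover : ∀ {k} (vs : Fin k → Fin order) → Cover vs
    cover {zero} vs = record { U = ∅ ; closed = λ A → inj₂ λ _ _ () ; nonneg = 0≤∑ (λ x → ≤-refl) ; covers = λ () }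
    cover {suc k} vs = extend-by (T? (U v)) (settled v)
      where
      v = vs zero
      open Cover (cover (vs ∘ suc))
      extend-by : Dec (T (U v)) → Settled v → Cover vs
      extend-by (yes h) _ = record { U = U ; closed = closed ; nonneg = nonneg ; covers = λ { zero → inj₁ h ; (suc i) → covers i } }
      extend-by (no _) (inj₁ e) = record { U = U ; closed = closed ; nonneg = nonneg ; covers = λ { zero → inj₂ e ; (suc i) → covers i } }
      extend-by (no v∉U) (inj₂ (A , F≢0)) = record
        { U = U ∪ W
        ; closed = closed′
        ; nonneg = 0≤-by _ (0≤+ nonneg (atom-excess A F≢0)) (trans (∑-cong λ x → trans (cong (_* excess x) (bits (U x) (W x) (apart x)))
            (ℤ.*-distribʳ-+ (excess x) ⟦ U x ⟧ ⟦ W x ⟧)) (∑-+ (λ x → ⟦ U x ⟧ * excess x) (λ x → ⟦ W x ⟧ * excess x)))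
        ; covers = λ { zero → inj₁ (∨-i₂ {U v} v∈W) ; (suc i) → Sum.map₁ ∨-i₁ (covers i) }
        }
        where
        open Atom A
        apart : ∀ x → T (W x) → ¬ T (U x)
        apart = [ (λ W⊆U → ⊥-elim (v∉U (W⊆U v v∈W))) , id ]′ (closed A)
        bits : ∀ u w → (T w → ¬ T u) → ⟦ u ∨ w ⟧ ≡ ⟦ u ⟧ + ⟦ w ⟧
        bits true true h = ⊥-elim (h tt tt)
        bits true false _ = refl
        bits false true _ = refl
        bits false false _ = refl
        closed′ : Closed (U ∪ W)
        closed′ B = [ (λ B⊆U → inj₁ λ x b → ∨-i₁ {U x} (B⊆U x b)) , (λ B∩U → meets B∩U (any? λ z → T? (Atom.W B z) ×-dec T? (W z))) ]′ (closed B)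
          where
          meets : (∀ x → T (Atom.W B x) → ¬ T (U x)) → Dec (∃ λ z → T (Atom.W B z) × T (W z)) →
            (∀ x → T (Atom.W B x) → T ((U ∪ W) x)) ⊎ (∀ x → T (Atom.W B x) → ¬ T ((U ∪ W) x))
          meets B∩U (yes (z , b , w)) = inj₁ λ x h → ∨-i₂ {U x} (nested B A {z} b w h)
          meets B∩U (no none) = inj₂ λ x h → [ B∩U x h , (λ w → none (x , h , w)) ]′ ∘ ∨-e

    impossible : ⊥
    impossible = case subst (0ℤ ≤_) full-excess (≤-trans nonneg (∑-mono λ x → step x (U x) refl (covers x))) of λ ()
      where
      open Cover (cover id)
      step : ∀ x b → U x ≡ b → T (U x) ⊎ 0ℤ ≤ excess x → ⟦ U x ⟧ * excess x ≤ ⟦ true ⟧ * excess x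
      step x true e _ = ≤-reflexive (cong (λ b → ⟦ b ⟧ * excess x) e)
      step x false e (inj₁ h) = ⊥-elim (subst T e h)
      step x false e (inj₂ h) = ≤-trans (≤-reflexive (cong (λ b → ⟦ b ⟧ * excess x) e)) (≤-trans h (≤-reflexive (sym (ℤ.*-identityˡ (excess x)))))

  settle : ∀ v → Generated H ⊎ Settled v
  settle v = by-degree (deg adj v full ℤ.≟ + 2) (deg adj v full ℤ.≟ + 3)
    where
    by-atom : Atom v → Generated H ⊎ Settled v
    by-atom A = decide (F adj (complement (Atom.W A)) ℤ.≟ 0ℤ)
      where
      decide : Dec (F adj (complement (Atom.W A)) ≡ 0ℤ) → Generated H ⊎ Settled v
      decide (yes e) = inj₁ (Split.joined H c ih (Atom.W A) (Atom.W-inv A) (Atom.W-tight A) e)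
      decide (no h) = inj₂ (inj₂ (A , h))
    next : ∀ {i j} → i ≤ j → j ≢ i → 1ℤ + i ≤ j
    next le h = ℤ.i<j⇒suc[i]≤j (ℤ.≤∧≢⇒< le (h ∘ sym))
    by-degree : Dec (deg adj v full ≡ + 2) → Dec (deg adj v full ≡ + 3) → Generated H ⊎ Settled v
    by-degree (yes e) _ = case two-elements (adj v) (trans (sym (deg-full adj v)) e) of λ
      { (x , y , x≢y , v~x , v~y , only) → inj₁ (Reduce.inverse-0-extension H c ih v x y x≢y v~x v~y only) }
    by-degree (no _) (yes e) = [ inj₁ , by-atom ]′ (Local.degree-3 H c ih v e)
    by-degree (no h) (no h′) = inj₂ (inj₁ (0≤- (next (next (deg≥2 v) h) h′)))

  generated : Generated H
  generated = [ id , (λ settled → ⊥-elim (impossible settled)) ]′ (choose settle)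

tight⇒generated : ∀ n → Acc ℕ._<_ n → (G : ℤ₂Graph) → ℤ₂Graph.order G ≡ n → CiTight G → Generated G
tight⇒generated n (acc rec) G refl t = Discharge.generated G (CiTight⇒Ci G t) λ G′ lt t′ → tight⇒generated (ℤ₂Graph.order G′) (rec lt) G′ refl t′

theorem5p10 : (G : ℤ₂Graph) → CiTight G ⇔ Generated G
theorem5p10 G = mk⇔ (tight⇒generated (ℤ₂Graph.order G) (<-wellFounded (ℤ₂Graph.order G)) G refl) generated⇒tight
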